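{- Let $p$ be a prime, $q=p$, $n\ge2$ and $k\ge1$ integers, $d=\gcd(k,p-1)$, $d_n=\gcd(k,p^n-1)$. Suppose $p>d+1$ and $p\nmid k$. Then every matrix in $M_n(\mathbb F_p)$ is of the form $A^k+B^k$ with $A,B\in M_n(\mathbb F_p)$ provided $n>\max\left\{\frac{p-1}{2},\frac{4\ln(k-1)}{\ln p}\right\}$; and every matrix in $M_n(\mathbb F_p)$ is of the form $A^k+B^k$ with $A,B\in GL_n(\mathbb F_p)$ provided $n>\max\left\{\frac{p-1}{2},\frac{\ln((k-1)^4+4k)}{\ln p}\right\}$ and $p\frac{p^n-1}{d_n}$ is even.
   Context: Convention: $\ln(0)=-\infty$ (relevant when $k=1$). -}

module Defs where

open import Data.Nat using (ℕ; zero; suc; _+_; _*_; _%_; NonZero)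
open import Data.Fin using (Fin; zero; suc; _≟_)
open import Data.Product using (Σ; ∃; _×_)
open import Relation.Binary.PropositionalEquality using (_≡_)
open import Relation.Nullary using (yes; no)

-- Square n×n matrices with natural-number entries; entries are read
-- modulo p, so these represent matrices over 𝔽_p = ℤ/pℤ.
Mat : ℕ → Set
Mat n = Fin n → Fin n → ℕ

∑ : (n : ℕ) → (Fin n → ℕ) → ℕ
∑ zero    f = 0
∑ (suc n) f = f zero + ∑ n (λ i → f (suc i))

_⊕_ : {n : ℕ} → Mat n → Mat n → Mat n
(A ⊕ B) i j = A i j + B i j

_⊗_ : {n : ℕ} → Mat n → Mat n → Mat n
_⊗_ {n} A B i j = ∑ n (λ l → A i l * B l j)

𝟙 : {n : ℕ} → Mat n
𝟙 i j with i ≟ j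
... | yes _ = 1
... | no  _ = 0

_^ᴹ_ : {n : ℕ} → Mat n → ℕ → Mat n
A ^ᴹ zero    = 𝟙
A ^ᴹ suc k = A ⊗ (A ^ᴹ k)

_≈[_]_ : {n : ℕ} → Mat n → (p : ℕ) → .{{NonZero p}} → Mat n → Set
A ≈[ p ] B = ∀ i j → A i j % p ≡ B i j % p

Invertible : {n : ℕ} → (p : ℕ) → .{{NonZero p}} → Mat n → Set
Invertible {n} p A = Σ (Mat n) λ A' → ((A ⊗ A') ≈[ p ] 𝟙) × ((A' ⊗ A) ≈[ p ] 𝟙)

{-# OPTIONS --safe #-}
module Submission where

-- A non-scalar C is similar, by elementary shears, to a matrix with any prescribed diagonal
-- of trace tr C.  Pick c with t = cᵏ ∉ {0, 1}; since p - 1 < 2n, tr C is a sum of 2n terms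
-- from {1, t}, so C is similar to (lower triangular) + (upper triangular) with diagonal
-- entries 1 and t, and such triangular matrices are k-th powers because p ∤ k.
--
-- A scalar λ is written as xᵏ + yᵏ in a field with q = pⁿ elements acting on 𝔽ₚⁿ.  For
-- f(b) = #{x : xᵏ = b} and f₀ = f - 1, averaging over dilations x ↦ f₀(cx) and the
-- Cauchy–Schwarz inequality bound ‖f₀ * f₀‖ as the Gauss sum estimate would, without
-- characters, and this gives #{xᵏ + yᵏ = λ} > 0 when q > (k - 1)⁴.
--
-- The field is 𝔽ₚ[x]/(xᵐ - c(x)) with m minimal such that x^q = x and
-- W = ∏_{0<j<n} (x^(pʲ) - x) ≠ 0: as a^q = a for all a, each a^(q-1) is idempotent, and
-- a proper idempotent e with e W ≠ 0 would give a smaller such quotient.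

-- Similarity cannot move a scalar matrix, so the two cases need different tools; the lower bounds
-- on pⁿ and the parity condition serve the scalar case. For non-scalar C the sum of 2n terms is 2n
-- + J (t - 1) with 0 ≤ J ≤ 2n, and J meets every residue because p ≤ 2n. The triangular summands
-- need not be diagonalisable: their roots combine a root of the semisimple part, from t = cᵏ, with
-- a power chosen by inverting k modulo pᵐ.
--
-- In the field, characters would give |f̂₀| ≤ u √q with u = f₀(1) < k. Only the second moment ∑ N₀²
-- ≤ (q - 1) u³ q of N₀ = f₀ * f₀ is used. One more Cauchy-Schwarz makes it pointwise: for λ ≠ 0 the
-- number of solutions differs from q by about u² √q, hence the fourth power. Solutions with x = 0
-- or y = 0, at most 2k of them, account for the term 4k.
--
-- No irreducible polynomial of degree n is exhibited: W ≠ 0 keeps x out of proper subfields, and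
-- irreducibility is a consequence of minimality.

open import Level using (0ℓ)
open import Algebra.Bundles using (CommutativeRing; Ring; Semiring)
open import Algebra.Structures using (IsCommutativeRing)
import Algebra.Properties.Semiring.Mult as SemiringMult
open import Data.Empty using (⊥)
open import Data.Fin using (Fin; zero; suc; toℕ; fromℕ; fromℕ<; inject₁; opposite; punchIn)
import Data.Fin as Fin
import Data.Fin.Permutation as Perm
import Data.Fin.Properties as Finₚ
open import Data.Integer as ℤ using (ℤ)
import Data.Integer.Properties as ℤₚ
import Data.Integer.Tactic.RingSolver as ℤ-Solver
open import Data.Maybe using (Maybe; just; nothing)
open import Data.Nat as ℕ using (ℕ; zero; suc; s≤s; z≤n; NonZero)
open import Data.Nat.Base using (_!)
open import Data.Nat.Combinatorics using (nCn≡1; k![n∸k]!∣n!) renaming (_C_ to _choose_)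
open import Data.Nat.Combinatorics.Specification using (nCk≡n!/k![n-k]!)
open import Data.Nat.Coprimality as Coprime using (Coprime; prime⇒coprime; coprime-Bézout; coprime-divisor)
open import Data.Nat.DivMod using (_%_; m%n<n; m<n⇒m%n≡m; m/n*n≡m; n%n≡0; %-distribˡ-+; %-distribˡ-*; [m+kn]%n≡m%n)
open import Data.Nat.Divisibility using (_∣_; divides; ∣⇒≤; ∣-trans; ∣1⇒≡1; m∣m*n)
open import Data.Nat.GCD using (gcd; gcd-GCD; gcd[m,n]≢0; module Bézout)
open import Data.Nat.Primality using (Prime; euclidsLemma; prime⇒irreducible; prime⇒nonTrivial; prime⇒nonZero; prime[2])
import Data.Nat.Properties as ℕₚ
import Data.Nat.Tactic.RingSolver as ℕ-Solver
open import Data.Product using (Σ; ∃; _×_; _,_; proj₁; proj₂)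
open import Data.Sum using (_⊎_; inj₁; inj₂)
open import Data.Vec using (Vec; []; _∷_; lookup; map; replicate; tabulate; zipWith)
import Data.Vec.Properties as Vecₚ
open import Function using (_∘_; mk↔ₛ′)
open import Function.Definitions using (Injective)
open import Relation.Binary.Definitions using (tri<; tri≈; tri>)
open import Relation.Binary.PropositionalEquality as ≡ using (_≡_; _≢_; cong; cong₂; subst; subst₂)
open import Relation.Nullary using (¬_; yes; no; Dec; contradiction)
open import Relation.Nullary.Decidable using (_×-dec_; ¬?; decidable-stable; map′)
import Defs

-- Coefficients in ℤ let the solver recognise cancellation in an arbitrary commutative ring.
module RingSolver {c ℓ} (R : CommutativeRing c ℓ) where
  open CommutativeRing R
    renaming (refl to ≈-refl; sym to ≈-sym; trans to ≈-trans)
  open import Algebra.Properties.Semiring.Mult.TCOptimised semiring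
    renaming (_×_ to _×′_) using (×-homo-+; ×1-homo-*; 1+×)
  open import Data.Integer using (+_; -[1+_]; _⊖_)
  open import Algebra.Properties.Ring ring
  open import Algebra.Properties.AbelianGroup +-abelianGroup using (⁻¹-∙-comm)
  open import Algebra.Solver.Ring.AlmostCommutativeRing
  open import Relation.Binary.Reasoning.Setoid setoid

  private
    ⟦_⟧ᶻ : ℤ → Carrier
    ⟦ + n ⟧ᶻ      = n ×′ 1#
    ⟦ -[1+ n ] ⟧ᶻ = - (suc n ×′ 1#)

    ⊖-homo : ∀ m n → ⟦ m ⊖ n ⟧ᶻ ≈ m ×′ 1# - n ×′ 1#
    ⊖-homo m zero = begin
      m ×′ 1#          ≈⟨ +-identityʳ _ ⟨
      m ×′ 1# + 0#     ≈⟨ +-congˡ -0#≈0# ⟨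
      m ×′ 1# - 0#     ∎
    ⊖-homo zero (suc n) = ≈-sym (+-identityˡ _)
    ⊖-homo (suc m) (suc n) = begin
      ⟦ suc m ⊖ suc n ⟧ᶻ                ≡⟨ cong ⟦_⟧ᶻ (ℤₚ.[1+m]⊖[1+n]≡m⊖n m n) ⟩
      ⟦ m ⊖ n ⟧ᶻ                        ≈⟨ ⊖-homo m n ⟩
      m ×′ 1# - n ×′ 1#                 ≈⟨ +-identityˡ _ ⟨
      0# + (m ×′ 1# - n ×′ 1#)          ≈⟨ +-congʳ (-‿inverseʳ 1#) ⟨
      (1# - 1#) + (m ×′ 1# - n ×′ 1#)   ≈⟨ interchange 1# (- 1#) _ _ ⟩
      (1# + m ×′ 1#) + (- 1# - n ×′ 1#) ≈⟨ +-cong (≈-sym (1+× m 1#)) (⁻¹-∙-comm 1# _) ⟩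
      suc m ×′ 1# - (1# + n ×′ 1#)      ≈⟨ +-congˡ (-‿cong (1+× n 1#)) ⟨
      suc m ×′ 1# - suc n ×′ 1#         ∎
      where open import Algebra.Properties.CommutativeSemigroup
                   (CommutativeRing.+-commutativeSemigroup R) using (interchange)

    +-homo : ∀ i j → ⟦ i ℤ.+ j ⟧ᶻ ≈ ⟦ i ⟧ᶻ + ⟦ j ⟧ᶻ
    +-homo (+ m) (+ n) = ×-homo-+ 1# m n
    +-homo (+ m) -[1+ n ] = ⊖-homo m (suc n)
    +-homo -[1+ m ] (+ n) = ≈-trans (⊖-homo n (suc m)) (+-comm _ _)
    +-homo -[1+ m ] -[1+ n ] = begin
      - (suc (suc (m ℕ.+ n)) ×′ 1#)         ≡⟨ cong (λ k → - (suc k ×′ 1#)) (≡.sym (ℕₚ.+-suc m n)) ⟩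
      - ((suc m ℕ.+ suc n) ×′ 1#)           ≈⟨ -‿cong (×-homo-+ 1# (suc m) (suc n)) ⟩
      - (suc m ×′ 1# + suc n ×′ 1#)         ≈⟨ ⁻¹-∙-comm _ _ ⟨
      - (suc m ×′ 1#) - suc n ×′ 1#         ∎

    -‿homo : ∀ i → ⟦ ℤ.- i ⟧ᶻ ≈ - ⟦ i ⟧ᶻ
    -‿homo (+ zero) = ≈-sym -0#≈0#
    -‿homo (+ suc n) = ≈-refl
    -‿homo -[1+ n ] = ≈-sym (-‿involutive _)

    *-homo⁺ : ∀ m j → ⟦ (+ m) ℤ.* j ⟧ᶻ ≈ m ×′ 1# * ⟦ j ⟧ᶻ
    *-homo⁺ m (+ n) = begin
      ⟦ (+ m) ℤ.* (+ n) ⟧ᶻ  ≡⟨ cong ⟦_⟧ᶻ (≡.sym (ℤₚ.pos-* m n)) ⟩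
      (m ℕ.* n) ×′ 1#       ≈⟨ ×1-homo-* m n ⟩
      m ×′ 1# * n ×′ 1#     ∎
    *-homo⁺ m -[1+ n ] = begin
      ⟦ (+ m) ℤ.* -[1+ n ] ⟧ᶻ        ≡⟨ cong ⟦_⟧ᶻ (≡.sym (ℤₚ.neg-distribʳ-* (+ m) (+ suc n))) ⟩
      ⟦ ℤ.- ((+ m) ℤ.* (+ suc n)) ⟧ᶻ ≈⟨ -‿homo ((+ m) ℤ.* (+ suc n)) ⟩
      - ⟦ (+ m) ℤ.* (+ suc n) ⟧ᶻ     ≈⟨ -‿cong (*-homo⁺ m (+ suc n)) ⟩
      - (m ×′ 1# * suc n ×′ 1#)      ≈⟨ -‿distribʳ-* _ _ ⟩
      m ×′ 1# * - (suc n ×′ 1#)      ∎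

    *-homo : ∀ i j → ⟦ i ℤ.* j ⟧ᶻ ≈ ⟦ i ⟧ᶻ * ⟦ j ⟧ᶻ
    *-homo (+ m) j = *-homo⁺ m j
    *-homo -[1+ m ] j = begin
      ⟦ -[1+ m ] ℤ.* j ⟧ᶻ            ≡⟨ cong ⟦_⟧ᶻ (≡.sym (ℤₚ.neg-distribˡ-* (+ suc m) j)) ⟩
      ⟦ ℤ.- ((+ suc m) ℤ.* j) ⟧ᶻ     ≈⟨ -‿homo ((+ suc m) ℤ.* j) ⟩
      - ⟦ (+ suc m) ℤ.* j ⟧ᶻ         ≈⟨ -‿cong (*-homo⁺ (suc m) j) ⟩
      - (suc m ×′ 1# * ⟦ j ⟧ᶻ)       ≈⟨ -‿distribˡ-* _ _ ⟩
      - (suc m ×′ 1#) * ⟦ j ⟧ᶻ       ∎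

    homomorphism : ℤ.+-*-rawRing -Raw-AlmostCommutative⟶ fromCommutativeRing R
    homomorphism = record
      { ⟦_⟧ = ⟦_⟧ᶻ ; +-homo = +-homo ; *-homo = *-homo ; -‿homo = -‿homo
      ; 0-homo = ≈-refl ; 1-homo = ≈-refl }

    coeff-dec : ∀ i j → Maybe (⟦ i ⟧ᶻ ≈ ⟦ j ⟧ᶻ)
    coeff-dec i j with i ℤₚ.≟ j
    ... | yes i≡j = just (reflexive (cong ⟦_⟧ᶻ i≡j))
    ... | no _    = nothing

  open import Algebra.Solver.Ring ℤ.+-*-rawRing (fromCommutativeRing R) homomorphism coeff-dec public
    using (Polynomial; solve; _:=_; _:+_; _:*_; _:-_; :-_; con)

  :0 :1 : ∀ {n} → Polynomial n
  :0 = con (+ 0)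
  :1 = con (+ 1)

-- The Frobenius map in characteristic p

prime∤! : ∀ {p} → Prime p → ∀ m → m ℕ.< p → ¬ (p ∣ m !)
prime∤! pr zero m<p p∣1 = ℕₚ.<⇒≱ (ℕ.nonTrivial⇒n>1 _ {{prime⇒nonTrivial pr}}) (∣⇒≤ p∣1)
prime∤! pr (suc m) m<p p∣ with euclidsLemma (suc m) (m !) pr p∣
... | inj₁ d = ℕₚ.<⇒≱ m<p (∣⇒≤ d)
... | inj₂ d = prime∤! pr m (ℕₚ.<-trans (ℕₚ.n<1+n m) m<p) d

prime∣choose : ∀ {p} → Prime p → ∀ k → 0 ℕ.< k → k ℕ.< p → p ∣ p choose k
prime∣choose {p@(suc p-1)} pr k 0<k k<p
  with euclidsLemma (p choose k) (k ! ℕ.* (p ℕ.∸ k) !) pr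
         (subst (p ∣_) p!≡ (m∣m*n (p-1 !)))
  where
  p!≡ : p ! ≡ (p choose k) ℕ.* (k ! ℕ.* (p ℕ.∸ k) !)
  p!≡ = ≡.sym (≡.trans (cong (ℕ._* (k ! ℕ.* (p ℕ.∸ k) !)) (nCk≡n!/k![n-k]! (ℕₚ.<⇒≤ k<p)))
                (m/n*n≡m {{k ℕₚ.!* (p ℕ.∸ k) !≢0}} (k![n∸k]!∣n! (ℕₚ.<⇒≤ k<p))))
... | inj₁ d = d
... | inj₂ d with euclidsLemma (k !) ((p ℕ.∸ k) !) pr d
...   | inj₁ d′ = contradiction d′ (prime∤! pr k k<p)
...   | inj₂ d′ = contradiction d′ (prime∤! pr (p ℕ.∸ k) (ℕₚ.∸-monoʳ-< 0<k (ℕₚ.<⇒≤ k<p)))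

module Frobenius {c ℓ} (S : Semiring c ℓ) {p} (pr : Prime p)
  (char : ∀ x → Semiring._≈_ S (SemiringMult._×_ S p x) (Semiring.0# S)) where

  open Semiring S
  open import Algebra.Properties.Semiring.Sum S
  open SemiringMult S renaming (_×_ to _·_)
  open import Algebra.Properties.Semiring.Exp S
  open import Relation.Binary.Reasoning.Setoid setoid
  import Algebra.Properties.Semiring.Binomial S as Binomial

  ∣⇒·≈0 : ∀ {m} → p ∣ m → ∀ x → m · x ≈ 0#
  ∣⇒·≈0 (divides q ≡.refl) x = begin
    (q ℕ.* p) · x  ≈⟨ ×-assocˡ x q p ⟨
    q · (p · x)    ≈⟨ ×-congʳ q (char x) ⟩
    q · 0#         ≈⟨ ×-zeroʳ q ⟩
    0#             ∎
    where
    ×-zeroʳ : ∀ q → q · 0# ≈ 0#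
    ×-zeroʳ zero    = Semiring.refl S
    ×-zeroʳ (suc q) = trans (+-identityˡ _) (×-zeroʳ q)

  sum-zero : ∀ {n} (t : Fin n → Carrier) → (∀ i → t i ≈ 0#) → sum t ≈ 0#
  sum-zero {n} t t≈0 = trans (sum-cong-≋ t≈0) (sum-replicate-zero n)

  frobenius : ∀ x y → x * y ≈ y * x → (x + y) ^ p ≈ x ^ p + y ^ p
  frobenius x y xy≈yx = begin
    (x + y) ^ p                       ≈⟨ Binomial.theorem x y xy≈yx p ⟩
    sum (t p)                         ≈⟨ ends p (ℕₚ.<-trans ℕₚ.0<1+n (ℕ.nonTrivial⇒n>1 p {{prime⇒nonTrivial pr}})) middle ⟩
    (p choose 0) · (x ^ 0 * y ^ p) + (p choose p) · (x ^ p * y ^ (p ℕ.∸ p)) ≈⟨ +-cong first last ⟩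
    y ^ p + x ^ p                     ≈⟨ +-comm _ _ ⟩
    x ^ p + y ^ p                     ∎
    where
    t : ∀ n → Fin (suc n) → Carrier
    t n k = (n choose toℕ k) · (x ^ toℕ k * y ^ (n ℕ.∸ toℕ k))
    g : ℕ → Carrier
    g k = (p choose k) · (x ^ k * y ^ (p ℕ.∸ k))
    middle : ∀ k → 0 ℕ.< k → k ℕ.< p → g k ≈ 0#
    middle k 0<k k<p = ∣⇒·≈0 (prime∣choose pr k 0<k k<p) _
    first : g 0 ≈ y ^ p
    first = trans (+-identityʳ _) (*-identityˡ _)
    last : g p ≈ x ^ p
    last = begin
      (p choose p) · (x ^ p * y ^ (p ℕ.∸ p)) ≡⟨ cong₂ (λ a b → a · (x ^ p * y ^ b)) (nCn≡1 p) (ℕₚ.n∸n≡0 p) ⟩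
      1 · (x ^ p * 1#)                ≈⟨ trans (×-homo-1 _) (*-identityʳ _) ⟩
      x ^ p                           ∎
    -- The bound is a variable `q`, to be matched as a successor while `g` keeps p.
    ends : ∀ q → 0 ℕ.< q → (∀ k → 0 ℕ.< k → k ℕ.< q → g k ≈ 0#) → sum {suc q} (λ k → g (toℕ k)) ≈ g 0 + g q
    ends (suc q) _ mid = +-congˡ (begin
      sum {suc q} (λ k → g (suc (toℕ k))) ≈⟨ sum-init-last {q} (λ k → g (suc (toℕ k))) ⟩
      sum {q} (λ k → g (suc (toℕ (inject₁ k)))) + g (suc (toℕ (fromℕ q)))
        ≈⟨ +-cong (sum-zero {q} _ (λ k → mid _ (s≤s z≤n) (s≤s (subst (ℕ._< q) (≡.sym (Finₚ.toℕ-inject₁ k)) (Finₚ.toℕ<n k)))))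
                  (reflexive (cong (λ j → g (suc j)) (Finₚ.toℕ-fromℕ q))) ⟩
      0# + g (suc q)                      ≈⟨ +-identityˡ _ ⟩
      g (suc q)                           ∎)

  ^-comm : ∀ {x y} → x * y ≈ y * x → ∀ m → x ^ m * y ≈ y * x ^ m
  ^-comm {x} {y} xy≈yx zero = trans (*-identityˡ y) (sym (*-identityʳ y))
  ^-comm {x} {y} xy≈yx (suc m) = begin
    x * x ^ m * y    ≈⟨ *-assoc _ _ _ ⟩
    x * (x ^ m * y)  ≈⟨ *-congˡ (^-comm xy≈yx m) ⟩
    x * (y * x ^ m)  ≈⟨ *-assoc _ _ _ ⟨
    x * y * x ^ m    ≈⟨ *-congʳ xy≈yx ⟩
    y * x * x ^ m    ≈⟨ *-assoc _ _ _ ⟩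
    y * (x * x ^ m)  ∎

  frobenius-iter : ∀ m x y → x * y ≈ y * x → (x + y) ^ (p ℕ.^ m) ≈ x ^ (p ℕ.^ m) + y ^ (p ℕ.^ m)
  frobenius-iter zero x y _ = trans (*-identityʳ _) (sym (+-cong (*-identityʳ _) (*-identityʳ _)))
  frobenius-iter (suc m) x y xy≈yx = begin
    (x + y) ^ (p ℕ.* p ℕ.^ m)               ≈⟨ ^-assocʳ _ p (p ℕ.^ m) ⟨
    ((x + y) ^ p) ^ (p ℕ.^ m)               ≈⟨ ^-congˡ (p ℕ.^ m) (frobenius x y xy≈yx) ⟩
    (x ^ p + y ^ p) ^ (p ℕ.^ m)
      ≈⟨ frobenius-iter m (x ^ p) (y ^ p) (^-comm (sym (^-comm (sym xy≈yx) p)) p) ⟩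
    (x ^ p) ^ (p ℕ.^ m) + (y ^ p) ^ (p ℕ.^ m) ≈⟨ +-cong (^-assocʳ _ p (p ℕ.^ m)) (^-assocʳ _ p (p ℕ.^ m)) ⟩
    x ^ (p ℕ.* p ℕ.^ m) + y ^ (p ℕ.* p ℕ.^ m) ∎

-- A commutative ring containing y, so that the ring solver applies to polynomials in y.
module Bicommutant {c ℓ} (M : Ring c ℓ) (y : Ring.Carrier M) where
  open Ring M
  open import Relation.Binary.Reasoning.Setoid setoid
  open import Algebra.Properties.Ring M using (-‿distribˡ-*; -‿distribʳ-*)

  Commutes : Carrier → Carrier → Set ℓ
  Commutes x z = z * x ≈ x * z

  InBicommutant : Carrier → Set _
  InBicommutant x = ∀ z → Commutes y z → Commutes x z

  B : Set _
  B = Σ Carrier InBicommutant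

  bicommutant : CommutativeRing _ _
  bicommutant = record
    { Carrier = B ; _≈_ = λ u v → proj₁ u ≈ proj₁ v
    ; _+_ = λ (u , cu) (v , cv) → u + v , λ z zy → trans (distribˡ z u v) (trans (+-cong (cu z zy) (cv z zy)) (sym (distribʳ z u v)))
    ; _*_ = λ (u , cu) (v , cv) → u * v , λ z zy → trans (sym (*-assoc z u v))
        (trans (*-congʳ (cu z zy)) (trans (*-assoc u z v) (trans (*-congˡ (cv z zy)) (sym (*-assoc u v z)))))
    ; -_ = λ (u , cu) → - u , λ z zy → trans (sym (-‿distribʳ-* z u)) (trans (-‿cong (cu z zy)) (-‿distribˡ-* u z))
    ; 0# = 0# , λ z _ → trans (zeroʳ z) (sym (zeroˡ z))
    ; 1# = 1# , λ z _ → trans (*-identityʳ z) (sym (*-identityˡ z))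
    ; isCommutativeRing = record
      { isRing = record
        { +-isAbelianGroup = record
          { isGroup = record
            { isMonoid = record
              { isSemigroup = record
                { isMagma = record { isEquivalence = record { refl = refl ; sym = sym ; trans = trans } ; ∙-cong = +-cong }
                ; assoc = λ u v w → +-assoc (proj₁ u) (proj₁ v) (proj₁ w) }
              ; identity = (λ u → +-identityˡ (proj₁ u)) , λ u → +-identityʳ (proj₁ u) }
            ; inverse = (λ u → -‿inverseˡ (proj₁ u)) , λ u → -‿inverseʳ (proj₁ u)
            ; ⁻¹-cong = -‿cong }
          ; comm = λ u v → +-comm (proj₁ u) (proj₁ v) }
        ; *-cong = *-cong
        ; *-assoc = λ u v w → *-assoc (proj₁ u) (proj₁ v) (proj₁ w)
        ; *-identity = (λ u → *-identityˡ (proj₁ u)) , λ u → *-identityʳ (proj₁ u)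
        ; distrib = (λ u v w → distribˡ (proj₁ u) (proj₁ v) (proj₁ w)) , λ u v w → distribʳ (proj₁ u) (proj₁ v) (proj₁ w) }
      -- `u` commutes with y because y commutes with itself; hence the condition on `v` may be
      -- tested at `u`.
      ; *-comm = λ (u , cu) (v , cv) → cv u (sym (cu y refl)) } }

-- Extraction of k-th roots in characteristic p

coprime-power : ∀ {p k} → Prime p → ¬ (p ∣ k) → ∀ m → Coprime k (p ℕ.^ m)
coprime-power {p} {k} pr p∤k m {d} (d∣k , d∣p^m) = go m d∣p^m
  where
  d-p-coprime : Coprime d p
  d-p-coprime (i∣d , i∣p) with prime⇒irreducible pr i∣p
  ... | inj₁ i≡1 = i≡1
  ... | inj₂ ≡.refl = contradiction (∣-trans i∣d d∣k) p∤k
  go : ∀ m → d ∣ p ℕ.^ m → d ≡ 1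
  go zero    d∣ = ∣1⇒≡1 d∣
  go (suc m) d∣ = go m (coprime-divisor d-p-coprime d∣)

modular-inverse : ∀ {k e} → 1 ℕ.< e → Coprime k e → ∃ λ b → ∃ λ s → b ℕ.* k ≡ 1 ℕ.+ s ℕ.* e
modular-inverse {k} {e} 1<e coprime with coprime-Bézout coprime
... | Bézout.+- x y eq = x , y , ≡.sym eq
-- Here x k is -1 modulo e, so (x k)² is 1 and x k x inverts k. The bound e > 1 excludes x k = 0,
-- which would mean y e = 1.
... | Bézout.-+ x y eq = x ℕ.* k ℕ.* x , w ℕ.* y , (begin
    x ℕ.* k ℕ.* x ℕ.* k          ≡⟨ ℕₚ.*-assoc (x ℕ.* k) x k ⟩
    (x ℕ.* k) ℕ.* (x ℕ.* k)      ≡⟨ cong (λ t → t ℕ.* t) xk≡ ⟩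
    suc w ℕ.* suc w              ≡⟨ square w ⟩
    1 ℕ.+ w ℕ.* (1 ℕ.+ suc w)    ≡⟨ cong (λ t → 1 ℕ.+ w ℕ.* t) (≡.trans (cong (1 ℕ.+_) (≡.sym xk≡)) eq) ⟩
    1 ℕ.+ w ℕ.* (y ℕ.* e)        ≡⟨ cong (1 ℕ.+_) (≡.sym (ℕₚ.*-assoc w y e)) ⟩
    1 ℕ.+ w ℕ.* y ℕ.* e          ∎)
  where
  open ≡.≡-Reasoning
  w = ℕ.pred (x ℕ.* k)
  square : ∀ w → suc w ℕ.* suc w ≡ 1 ℕ.+ w ℕ.* (1 ℕ.+ suc w)
  square = ℕ-Solver.solve-∀
  xk≢0 : x ℕ.* k ≢ 0
  xk≢0 xk≡0 = ℕₚ.<⇒≢ 1<e (≡.sym (ℕₚ.m*n≡1⇒n≡1 y e (≡.trans (≡.sym eq) (cong suc xk≡0))))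
  xk≡ : x ℕ.* k ≡ suc w
  xk≡ = ≡.sym (ℕₚ.suc-pred (x ℕ.* k) {{ℕ.≢-nonZero xk≢0}})

-- If y has the two eigenvalues 1 and t = cᵏ then z = y^(pᵐ) is semisimple with these
-- eigenvalues, so z = rᵏ explicitly, and y is recovered from z as pᵐ is coprime to k.
module TwoEigenvalues {ℓ₁ ℓ₂} (C : CommutativeRing ℓ₁ ℓ₂) {p : ℕ} (pr : Prime p)
  (char : ∀ x → CommutativeRing._≈_ C (SemiringMult._×_ (CommutativeRing.semiring C) p x) (CommutativeRing.0# C)) where
  open CommutativeRing C
  open import Algebra.Properties.CommutativeSemiring.Exp commutativeSemiring
  open import Algebra.Properties.Group +-group using (x∙y⁻¹≈ε⇒x≈y)
  open Frobenius semiring pr char using (frobenius-iter)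
  open RingSolver C
  open import Relation.Binary.Reasoning.Setoid setoid

  -- Additivity applied to (x - y) + y avoids having to know the sign of (-1)^(pᵐ).
  ^-sub : ∀ m x y → (x - y) ^ (p ℕ.^ m) ≈ x ^ (p ℕ.^ m) - y ^ (p ℕ.^ m)
  ^-sub m x y = begin
    (x - y) ^ e                     ≈⟨ solve 2 (λ a b → a := a :+ b :- b) refl _ (y ^ e) ⟩
    (x - y) ^ e + y ^ e - y ^ e     ≈⟨ +-congʳ (frobenius-iter m (x - y) y (*-comm _ _)) ⟨
    (x - y + y) ^ e - y ^ e         ≈⟨ +-congʳ (^-congˡ e (solve 2 (λ x y → x :- y :+ y := x) refl x y)) ⟩
    x ^ e - y ^ e                   ∎
    where e = p ℕ.^ m

  1^≈1 : ∀ i → 1# ^ i ≈ 1#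
  1^≈1 zero    = refl
  1^≈1 (suc i) = trans (*-identityˡ _) (1^≈1 i)

  fixed-iter : ∀ {t} → t ^ p ≈ t → ∀ m → t ^ (p ℕ.^ m) ≈ t
  fixed-iter {t} fix zero    = *-identityʳ t
  fixed-iter {t} fix (suc m) = trans (sym (^-assocʳ t p (p ℕ.^ m))) (trans (^-congˡ (p ℕ.^ m) fix) (fixed-iter fix m))

  root : ∀ {k} → ¬ (p ∣ k) → 1 ℕ.≤ k → ∀ m → 1 ℕ.≤ m → ∀ y c d →
    c ^ (p ℕ.∸ 1) ≈ 1# → d * (c ^ k - 1#) ≈ 1# →
    ((y - 1#) * (y - c ^ k)) ^ (p ℕ.^ m) ≈ 0# →
    ∃ λ x → ∃ λ x⁻¹ → x ^ k ≈ y × x * x⁻¹ ≈ 1#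
  root {k@(suc k-1)} p∤k _ m@(suc m-1) _ y c d c^[p-1]≈1 d[t-1]≈1 nilpotent
    with modular-inverse 1<e (coprime-power pr p∤k m)
    where
    1<p = ℕ.nonTrivial⇒n>1 p {{prime⇒nonTrivial pr}}
    1<e : 1 ℕ.< p ℕ.^ m
    1<e = ℕₚ.≤-trans 1<p (ℕₚ.m≤m*n p (p ℕ.^ m-1) {{ℕₚ.m^n≢0 p m-1 {{ℕ.>-nonZero (ℕₚ.<⇒≤ 1<p)}}}})
  ... | b , s , bk≡1+se = x , x ^ k-1 * y ^ (e ℕ.* p-1 ℕ.∸ 1) , x^k≈y , x-inverse
    where
    1<p = ℕ.nonTrivial⇒n>1 p {{prime⇒nonTrivial pr}}
    e = p ℕ.^ m
    p-1 = p ℕ.∸ 1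
    t = c ^ k
    z = y ^ e
    c^p≈c : c ^ p ≈ c
    c^p≈c = trans (reflexive (cong (c ^_) (≡.sym (ℕₚ.m+[n∸m]≡n (ℕₚ.<⇒≤ 1<p))))) (trans (*-congˡ c^[p-1]≈1) (*-identityʳ c))
    t^p≈t : t ^ p ≈ t
    t^p≈t = trans (^-assocʳ c k p) (trans (reflexive (cong (c ^_) (ℕₚ.*-comm k p))) (trans (sym (^-assocʳ c p k)) (^-congˡ k c^p≈c)))
    [z-1][z-t]≈0 : (z - 1#) * (z - t) ≈ 0#
    [z-1][z-t]≈0 = begin
      (z - 1#) * (z - t)                  ≈⟨ *-cong (+-congˡ (-‿cong (1^≈1 e))) (+-congˡ (-‿cong (fixed-iter t^p≈t m))) ⟨
      (z - 1# ^ e) * (z - t ^ e)          ≈⟨ *-cong (^-sub m y 1#) (^-sub m y t) ⟨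
      (y - 1#) ^ e * (y - t) ^ e          ≈⟨ ^-distrib-* _ _ e ⟨
      ((y - 1#) * (y - t)) ^ e            ≈⟨ nilpotent ⟩
      0#                                  ∎
    -- The projection onto the eigenvalue t of z: 0 at z = 1 and 1 at z = t, so that z = 1 + (t - 1)
    -- E.
    E = d * (z - 1#)
    E²≈E : E * E ≈ E
    E²≈E = begin
      E * E
        ≈⟨ solve 3 (λ d z t → (d :* (z :- :1)) :* (d :* (z :- :1))
             := d :* d :* ((z :- :1) :* (z :- t)) :+ d :* (t :- :1) :* (d :* (z :- :1))) refl d z t ⟩
      d * d * ((z - 1#) * (z - t)) + d * (t - 1#) * E  ≈⟨ +-cong (*-congˡ [z-1][z-t]≈0) (*-congʳ d[t-1]≈1) ⟩
      d * d * 0# + 1# * E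
        ≈⟨ solve 2 (λ a b → a :* :0 :+ :1 :* b := b) refl (d * d) E ⟩
      E                                                ∎
    -- The same expression with t replaced by its k-th root c.
    r = 1# + (c - 1#) * E
    r^≈ : ∀ i → r ^ i ≈ 1# + (c ^ i - 1#) * E
    r^≈ zero = solve 1 (λ e → :1 := :1 :+ (:1 :- :1) :* e) refl E
    r^≈ (suc i) = begin
      r * r ^ i                                   ≈⟨ *-congˡ (r^≈ i) ⟩
      (1# + (c - 1#) * E) * (1# + (c ^ i - 1#) * E)
        ≈⟨ solve 3 (λ c a e → (:1 :+ (c :- :1) :* e) :* (:1 :+ (a :- :1) :* e)
             := :1 :+ (c :* a :- :1) :* e :+ (c :- :1) :* (a :- :1) :* (e :* e :- e)) refl c (c ^ i) E ⟩
      1# + (c ^ suc i - 1#) * E + (c - 1#) * (c ^ i - 1#) * (E * E - E)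
        ≈⟨ +-congˡ (*-congˡ (trans (+-congʳ E²≈E) (-‿inverseʳ E))) ⟩
      1# + (c ^ suc i - 1#) * E + (c - 1#) * (c ^ i - 1#) * 0#
        ≈⟨ solve 2 (λ a b → a :+ b :* :0 := a) refl _ _ ⟩
      1# + (c ^ suc i - 1#) * E                   ∎
    r^k≈z : r ^ k ≈ z
    r^k≈z = begin
      r ^ k                        ≈⟨ r^≈ k ⟩
      1# + (t - 1#) * (d * (z - 1#))
        ≈⟨ solve 3 (λ t d z → :1 :+ (t :- :1) :* (d :* (z :- :1))
             := :1 :+ d :* (t :- :1) :* (z :- :1)) refl t d z ⟩
      1# + d * (t - 1#) * (z - 1#) ≈⟨ +-congˡ (*-congʳ d[t-1]≈1) ⟩
      1# + 1# * (z - 1#)           ≈⟨ solve 1 (λ z → :1 :+ :1 :* (z :- :1) := z) refl z ⟩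
      z                            ∎
    z^[p-1]≈1 : z ^ p-1 ≈ 1#
    z^[p-1]≈1 = begin
      z ^ p-1            ≈⟨ ^-congˡ p-1 r^k≈z ⟨
      (r ^ k) ^ p-1      ≈⟨ ^-assocʳ r k p-1 ⟩
      r ^ (k ℕ.* p-1)    ≈⟨ reflexive (cong (r ^_) (ℕₚ.*-comm k p-1)) ⟩
      r ^ (p-1 ℕ.* k)    ≈⟨ ^-assocʳ r p-1 k ⟨
      (r ^ p-1) ^ k      ≈⟨ ^-congˡ k (trans (r^≈ p-1) (trans (+-congˡ (*-congʳ (+-congʳ c^[p-1]≈1)))
                              (solve 1 (λ e → :1 :+ (:1 :- :1) :* e := :1) refl E))) ⟩
      1# ^ k             ≈⟨ 1^≈1 k ⟩
      1#                 ∎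
    -- The power y^b is a root only up to a factor: (y^b)ᵏ = y zˢ. As rᵏ = z and z^(p-1) = 1, the
    -- power r^a contributes z^(s(p-2)), the inverse of zˢ.
    a = s ℕ.* (p ℕ.∸ 2)
    x = r ^ a * y ^ b
    exponent : a ℕ.+ s ≡ p-1 ℕ.* s
    exponent = ≡.trans (≡.trans (ℕₚ.+-comm a s) (≡.sym (ℕₚ.*-suc s (p ℕ.∸ 2))))
      (≡.trans (cong (s ℕ.*_) (≡.sym (ℕₚ.+-∸-assoc 1 1<p))) (ℕₚ.*-comm s p-1))
    x^k≈y : x ^ k ≈ y
    x^k≈y = begin
      (r ^ a * y ^ b) ^ k              ≈⟨ ^-distrib-* _ _ k ⟩
      (r ^ a) ^ k * (y ^ b) ^ k        ≈⟨ *-cong (trans (^-assocʳ r a k) (trans (reflexive (cong (r ^_) (ℕₚ.*-comm a k))) (sym (^-assocʳ r k a)))) (^-assocʳ y b k) ⟩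
      (r ^ k) ^ a * y ^ (b ℕ.* k)      ≈⟨ *-cong (^-congˡ a r^k≈z) (reflexive (cong (y ^_) (≡.trans bk≡1+se (cong suc (ℕₚ.*-comm s e))))) ⟩
      z ^ a * (y * y ^ (e ℕ.* s))      ≈⟨ *-congˡ (*-congˡ (^-assocʳ y e s)) ⟨
      z ^ a * (y * z ^ s)              ≈⟨ solve 3 (λ a y s → a :* (y :* s) := y :* (a :* s)) refl (z ^ a) y (z ^ s) ⟩
      y * (z ^ a * z ^ s)              ≈⟨ *-congˡ (^-homo-* z a s) ⟨
      y * z ^ (a ℕ.+ s)                ≈⟨ *-congˡ (reflexive (cong (z ^_) exponent)) ⟩
      y * z ^ (p-1 ℕ.* s)              ≈⟨ *-congˡ (^-assocʳ z p-1 s) ⟨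
      y * (z ^ p-1) ^ s                ≈⟨ *-congˡ (trans (^-congˡ s z^[p-1]≈1) (1^≈1 s)) ⟩
      y * 1#                           ≈⟨ *-identityʳ y ⟩
      y                                ∎
    0<e[p-1] : 1 ℕ.≤ e ℕ.* p-1
    0<e[p-1] = ℕₚ.*-mono-≤ (ℕₚ.m^n>0 p {{ℕ.>-nonZero (ℕₚ.<⇒≤ 1<p)}} m) (ℕₚ.m<n⇒0<n∸m 1<p)
    x-inverse : x * (x ^ k-1 * y ^ (e ℕ.* p-1 ℕ.∸ 1)) ≈ 1#
    x-inverse = begin
      x * (x ^ k-1 * y ^ (e ℕ.* p-1 ℕ.∸ 1))  ≈⟨ *-assoc _ _ _ ⟨
      x ^ k * y ^ (e ℕ.* p-1 ℕ.∸ 1)          ≈⟨ *-congʳ x^k≈y ⟩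
      y * y ^ (e ℕ.* p-1 ℕ.∸ 1)              ≈⟨ reflexive (cong (y ^_) (ℕₚ.m+[n∸m]≡n 0<e[p-1])) ⟩
      y ^ (e ℕ.* p-1)                        ≈⟨ ^-assocʳ y e p-1 ⟨
      z ^ p-1                                ≈⟨ z^[p-1]≈1 ⟩
      1#                                     ∎

-- Conjugation in a ring

module Conjugation {c ℓ} (R : Ring c ℓ) where
  open Ring R renaming (refl to ≈-refl; sym to ≈-sym; trans to ≈-trans)
  open import Algebra.Properties.Semiring.Exp semiring using (_^_)
  open import Relation.Binary.Reasoning.Setoid setoid

  cancel-inner : ∀ {a a′ b b′} → a * a′ ≈ 1# → b * b′ ≈ 1# → (a * b) * (b′ * a′) ≈ 1#
  cancel-inner {a} {a′} {b} {b′} aa′≈1 bb′≈1 = begin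
    (a * b) * (b′ * a′)   ≈⟨ *-assoc a b (b′ * a′) ⟩
    a * (b * (b′ * a′))   ≈⟨ *-congˡ (*-assoc b b′ a′) ⟨
    a * (b * b′ * a′)     ≈⟨ *-congˡ (*-congʳ bb′≈1) ⟩
    a * (1# * a′)         ≈⟨ *-congˡ (*-identityˡ a′) ⟩
    a * a′                ≈⟨ aa′≈1 ⟩
    1#                    ∎

  conjugate-back : ∀ {s s′ x y} → s′ * s ≈ 1# → s * x * s′ ≈ y → x ≈ s′ * y * s
  conjugate-back {s} {s′} {x} {y} s′s≈1 eq = begin
    x                          ≈⟨ *-identityˡ x ⟨
    1# * x                     ≈⟨ *-congʳ s′s≈1 ⟨
    s′ * s * x                 ≈⟨ *-identityʳ _ ⟨
    s′ * s * x * 1#            ≈⟨ *-congˡ s′s≈1 ⟨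
    s′ * s * x * (s′ * s)      ≈⟨ *-congʳ (*-assoc s′ s x) ⟩
    s′ * (s * x) * (s′ * s)    ≈⟨ *-assoc _ s′ s ⟨
    s′ * (s * x) * s′ * s      ≈⟨ *-congʳ (*-assoc s′ (s * x) s′) ⟩
    s′ * (s * x * s′) * s      ≈⟨ *-congʳ (*-congˡ eq) ⟩
    s′ * y * s                 ∎

  conjugate-conjugate : ∀ a b x c d → a * (b * x * c) * d ≈ (a * b) * x * (c * d)
  conjugate-conjugate a b x c d = begin
    a * (b * x * c) * d        ≈⟨ *-congʳ (*-assoc a (b * x) c) ⟨
    a * (b * x) * c * d        ≈⟨ *-assoc _ c d ⟩
    a * (b * x) * (c * d)      ≈⟨ *-congʳ (*-assoc a b x) ⟨
    a * b * x * (c * d)        ∎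

  conjugate-* : ∀ {s s′} x y → s′ * s ≈ 1# → (s * x * s′) * (s * y * s′) ≈ s * (x * y) * s′
  conjugate-* {s} {s′} x y s′s≈1 = begin
    (s * x * s′) * (s * y * s′)      ≈⟨ *-assoc (s * x) s′ _ ⟩
    s * x * (s′ * (s * y * s′))      ≈⟨ *-congˡ (*-congˡ (*-assoc s y s′)) ⟩
    s * x * (s′ * (s * (y * s′)))    ≈⟨ *-congˡ (*-assoc s′ s _) ⟨
    s * x * (s′ * s * (y * s′))      ≈⟨ *-congˡ (*-congʳ s′s≈1) ⟩
    s * x * (1# * (y * s′))          ≈⟨ *-congˡ (*-identityˡ _) ⟩
    s * x * (y * s′)                 ≈⟨ *-assoc (s * x) y s′ ⟨
    s * x * y * s′                   ≈⟨ *-congʳ (*-assoc s x y) ⟩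
    s * (x * y) * s′                 ∎

  conjugate-^ : ∀ {s s′} x → s′ * s ≈ 1# → s * s′ ≈ 1# → ∀ k → (s * x * s′) ^ k ≈ s * x ^ k * s′
  conjugate-^ {s} {s′} x s′s≈1 ss′≈1 zero    = ≈-trans (≈-sym ss′≈1) (*-congʳ (≈-sym (*-identityʳ s)))
  conjugate-^ {s} {s′} x s′s≈1 ss′≈1 (suc k) = ≈-trans (*-congˡ (conjugate-^ x s′s≈1 ss′≈1 k)) (conjugate-* x (x ^ k) s′s≈1)

  conjugate-1 : ∀ {s s′} → s * s′ ≈ 1# → s * 1# * s′ ≈ 1#
  conjugate-1 {s} {s′} ss′≈1 = ≈-trans (*-congʳ (*-identityʳ s)) ss′≈1

open ≡ using (refl; sym; trans; module ≡-Reasoning)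

-- Commutative and finite rings up to propositional equality

record CRing : Set₁ where
  infixl 6 _+_
  infixl 7 _*_
  infix  8 -_
  field
    Carrier           : Set
    _+_ _*_           : Carrier → Carrier → Carrier
    -_                : Carrier → Carrier
    0# 1#             : Carrier
    isCommutativeRing : IsCommutativeRing _≡_ _+_ _*_ -_ 0# 1#

  commutativeRing : CommutativeRing 0ℓ 0ℓ
  commutativeRing = record { isCommutativeRing = isCommutativeRing }

  open CommutativeRing commutativeRing public
    using ( _-_; +-assoc; +-comm; +-identityˡ; +-identityʳ; *-assoc; *-comm
          ; *-identityˡ; *-identityʳ; distribˡ; distribʳ; zeroˡ; zeroʳ
          ; -‿inverseˡ; -‿inverseʳ; semiring; commutativeSemiring; ring; +-group)
  open import Algebra.Properties.CommutativeSemiring.Exp commutativeSemiring public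
    using (_^_; ^-homo-*; ^-assocʳ; ^-distrib-*)
  open import Algebra.Properties.Ring ring public
    using (-0#≈0#; -‿distribˡ-*; -‿distribʳ-*; -‿involutive)
  open SemiringMult semiring public using () renaming (_×_ to _·_)
  open RingSolver commutativeRing public

  x-y≡0⇒x≡y : ∀ {x y} → x - y ≡ 0# → x ≡ y
  x-y≡0⇒x≡y {x} {y} = Group.x∙y⁻¹≈ε⇒x≈y x y
    where import Algebra.Properties.Group +-group as Group

  x≡y⇒x-y≡0 : ∀ {x y} → x ≡ y → x - y ≡ 0#
  x≡y⇒x-y≡0 {x} refl = -‿inverseʳ x

  1^n≡1 : ∀ n → 1# ^ n ≡ 1#
  1^n≡1 zero    = refl
  1^n≡1 (suc n) = trans (*-identityˡ _) (1^n≡1 n)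

  0^n≡0 : ∀ {n} → 1 ℕ.≤ n → 0# ^ n ≡ 0#
  0^n≡0 {suc n} _ = zeroˡ _

record FiniteRing : Set₁ where
  field
    cring : CRing
  open CRing cring public
  field
    size          : ℕ
    element       : Fin size → Carrier
    index         : Carrier → Fin size
    element-index : ∀ x → element (index x) ≡ x
    index-element : ∀ i → index (element i) ≡ i

  infix 4 _≟_
  _≟_ : (x y : Carrier) → Dec (x ≡ y)
  x ≟ y = map′ (λ eq → trans (sym (element-index x)) (trans (cong element eq) (element-index y)))
               (cong index) (index x Finₚ.≟ index y)

  any? : {P : Carrier → Set} → (∀ x → Dec (P x)) → Dec (∃ P)
  any? {P} P? = map′ (λ (i , px) → element i , px)
                     (λ (x , px) → index x , subst P (sym (element-index x)) px)
                     (Finₚ.any? (P? ∘ element))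

  record IsField : Set where
    field
      1≢0     : 1# ≢ 0#
      inverse : ∀ x → x ≢ 0# → ∃ λ y → x * y ≡ 1#

    x*y≡0⇒y≡0 : ∀ {x y} → x ≢ 0# → x * y ≡ 0# → y ≡ 0#
    x*y≡0⇒y≡0 {x} {y} x≢0 xy≡0 with inverse x x≢0
    ... | x⁻¹ , xx⁻¹≡1 = begin
      y             ≡⟨ sym (*-identityˡ y) ⟩
      1# * y        ≡⟨ cong (_* y) (sym xx⁻¹≡1) ⟩
      x * x⁻¹ * y   ≡⟨ cong (_* y) (*-comm x x⁻¹) ⟩
      x⁻¹ * x * y   ≡⟨ *-assoc x⁻¹ x y ⟩
      x⁻¹ * (x * y) ≡⟨ cong (x⁻¹ *_) xy≡0 ⟩
      x⁻¹ * 0#      ≡⟨ zeroʳ x⁻¹ ⟩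
      0#            ∎
      where open ≡-Reasoning

    x*y≢0 : ∀ {x y} → x ≢ 0# → y ≢ 0# → x * y ≢ 0#
    x*y≢0 x≢0 y≢0 xy≡0 = y≢0 (x*y≡0⇒y≡0 x≢0 xy≡0)

    *-cancelˡ-≢0 : ∀ {x y z} → x ≢ 0# → x * y ≡ x * z → y ≡ z
    *-cancelˡ-≢0 {x} {y} {z} x≢0 eq = x-y≡0⇒x≡y (x*y≡0⇒y≡0 x≢0
      (trans (solve 3 (λ x y z → x :* (y :- z) := x :* y :- x :* z) refl x y z) (x≡y⇒x-y≡0 eq)))

    x^n≢0 : ∀ {x} n → x ≢ 0# → x ^ n ≢ 0#
    x^n≢0 zero    x≢0 = 1≢0
    x^n≢0 (suc n) x≢0 = x*y≢0 x≢0 (x^n≢0 n x≢0)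

-- Counting roots of polynomials

module Polynomial (F : FiniteRing) (isField : FiniteRing.IsField F) where
  open FiniteRing F
  open IsField isField

  -- as stands for the monic polynomial with the remaining coefficients as.
  eval : ∀ {d} → Vec Carrier d → Carrier → Carrier
  eval []       x = 1#
  eval (a ∷ as) x = a + x * eval as x

  quotient : ∀ {d} → Vec Carrier (suc d) → Carrier → Vec Carrier d
  quotient (a ∷ [])         r = []
  quotient (a ∷ as@(_ ∷ _)) r = eval as r ∷ quotient as r

  eval-quotient : ∀ {d} (as : Vec Carrier (suc d)) r x →
    eval as x - eval as r ≡ (x - r) * eval (quotient as r) x
  eval-quotient (a ∷ []) r x =
    solve 3 (λ a r x → (a :+ x :* :1) :- (a :+ r :* :1) := (x :- r) :* :1) refl a r x
  eval-quotient (a ∷ as@(_ ∷ _)) r x = begin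
    (a + x * eval as x) - (a + r * eval as r)
      ≡⟨ solve 5 (λ a r x e f → (a :+ x :* e) :- (a :+ r :* f) := (x :- r) :* f :+ x :* (e :- f))
           refl a r x (eval as x) (eval as r) ⟩
    (x - r) * eval as r + x * (eval as x - eval as r)
      ≡⟨ cong (λ t → (x - r) * eval as r + x * t) (eval-quotient as r x) ⟩
    (x - r) * eval as r + x * ((x - r) * eval (quotient as r) x)
      ≡⟨ solve 4 (λ d f x q → d :* f :+ x :* (d :* q) := d :* (f :+ x :* q)) refl
           (x - r) (eval as r) x (eval (quotient as r) x) ⟩
    (x - r) * (eval as r + x * eval (quotient as r) x) ∎
    where open ≡-Reasoning

  #roots≤degree : ∀ {d m} (as : Vec Carrier d) (f : Fin m → Carrier) → Injective _≡_ _≡_ f →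
    (∀ i → eval as (f i) ≡ 0#) → m ℕ.≤ d
  #roots≤degree {d} {zero} as f inj root = z≤n
  #roots≤degree {zero} {suc m} [] f inj root = contradiction (root zero) 1≢0
  #roots≤degree {suc d} {suc m} as f inj root = s≤s (#roots≤degree (quotient as r) (f ∘ suc)
      (Finₚ.suc-injective ∘ inj) (λ i → x*y≡0⇒y≡0 (λ eq → Finₚ.0≢1+n (inj (sym (x-y≡0⇒x≡y eq)))) (begin
        (f (suc i) - r) * eval (quotient as r) (f (suc i)) ≡⟨ sym (eval-quotient as r (f (suc i))) ⟩
        eval as (f (suc i)) - eval as r                     ≡⟨ x≡y⇒x-y≡0 (trans (root (suc i)) (sym (root zero))) ⟩
        0#                                                  ∎)))
    where
    open ≡-Reasoning
    r = f zero

  eval-zeros : ∀ d x → eval (replicate d 0#) x ≡ x ^ d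
  eval-zeros zero    x = refl
  eval-zeros (suc d) x = trans (+-identityˡ _) (cong (x *_) (eval-zeros d x))

  #roots-of-unity : ∀ {k m} → 1 ℕ.≤ k → (f : Fin m → Carrier) → Injective _≡_ _≡_ f →
    (∀ i → f i ^ k ≡ 1#) → m ℕ.≤ k
  #roots-of-unity {suc k} _ f inj root = #roots≤degree (- 1# ∷ replicate k 0#) f inj (λ i →
    trans (cong (λ t → - 1# + f i * t) (eval-zeros k (f i))) (trans (cong (- 1# +_) (root i)) (-‿inverseˡ 1#)))

  -- The roots of x^q - x; q ≥ 2 makes it monic with lower coefficients 0, -1, 0, ..., 0. This will
  -- bound the degree of the constructed field from above.
  #fixed-by-power : ∀ {q m} → 2 ℕ.≤ q → (f : Fin m → Carrier) → Injective _≡_ _≡_ f →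
    (∀ i → f i ^ q ≡ f i) → m ℕ.≤ q
  #fixed-by-power {suc (suc q)} (s≤s _) f inj root = #roots≤degree (0# ∷ - 1# ∷ replicate q 0#) f inj (λ i → begin
    0# + f i * (- 1# + f i * eval (replicate q 0#) (f i))
      ≡⟨ solve 2 (λ x e → :0 :+ x :* (:- :1 :+ x :* e) := x :* (x :* e) :- x) refl (f i) _ ⟩
    f i * (f i * eval (replicate q 0#) (f i)) - f i ≡⟨ cong (λ t → f i * (f i * t) - f i) (eval-zeros q (f i)) ⟩
    f i ^ suc (suc q) - f i                          ≡⟨ x≡y⇒x-y≡0 (root i) ⟩
    0# ∎)
    where
    open ≡-Reasoning

-- The field of residues modulo p

module ModP (p : ℕ) (pr : Prime p) where
  open ≡-Reasoning
  private instance
    nz : NonZero p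
    nz = prime⇒nonZero pr

  π : ℕ → Fin p
  π a = fromℕ< (m%n<n a p)

  toℕ-π : ∀ a → toℕ (π a) ≡ a % p
  toℕ-π a = Finₚ.toℕ-fromℕ< (m%n<n a p)

  π-cong : ∀ {a b} → a % p ≡ b % p → π a ≡ π b
  π-cong {a} {b} eq = Finₚ.toℕ-injective (trans (toℕ-π a) (trans eq (sym (toℕ-π b))))

  π-injective : ∀ {a b} → π a ≡ π b → a % p ≡ b % p
  π-injective {a} {b} eq = trans (sym (toℕ-π a)) (trans (cong toℕ eq) (toℕ-π b))

  π-toℕ : ∀ x → π (toℕ x) ≡ x
  π-toℕ x = Finₚ.toℕ-injective (trans (toℕ-π (toℕ x)) (m<n⇒m%n≡m (Finₚ.toℕ<n x)))

  infixl 6 _+ₚ_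
  infixl 7 _*ₚ_
  _+ₚ_ _*ₚ_ : Fin p → Fin p → Fin p
  x +ₚ y = π (toℕ x ℕ.+ toℕ y)
  x *ₚ y = π (toℕ x ℕ.* toℕ y)

  -ₚ_ : Fin p → Fin p
  -ₚ x = π (p ℕ.∸ toℕ x)

  π-+ : ∀ a b → π (a ℕ.+ b) ≡ π a +ₚ π b
  π-+ a b = π-cong (trans (%-distribˡ-+ a b p) (cong₂ (λ s t → (s ℕ.+ t) % p) (sym (toℕ-π a)) (sym (toℕ-π b))))

  π-* : ∀ a b → π (a ℕ.* b) ≡ π a *ₚ π b
  π-* a b = π-cong (trans (%-distribˡ-* a b p) (cong₂ (λ s t → (s ℕ.* t) % p) (sym (toℕ-π a)) (sym (toℕ-π b))))

  private
    +-assoc : ∀ x y z → x +ₚ y +ₚ z ≡ x +ₚ (y +ₚ z)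
    +-assoc x y z = begin
      π (toℕ x ℕ.+ toℕ y) +ₚ z                 ≡⟨ cong (π (toℕ x ℕ.+ toℕ y) +ₚ_) (sym (π-toℕ z)) ⟩
      π (toℕ x ℕ.+ toℕ y) +ₚ π (toℕ z)         ≡⟨ sym (π-+ (toℕ x ℕ.+ toℕ y) (toℕ z)) ⟩
      π (toℕ x ℕ.+ toℕ y ℕ.+ toℕ z)            ≡⟨ cong π (ℕₚ.+-assoc (toℕ x) _ _) ⟩
      π (toℕ x ℕ.+ (toℕ y ℕ.+ toℕ z))          ≡⟨ π-+ (toℕ x) _ ⟩
      π (toℕ x) +ₚ (y +ₚ z)                    ≡⟨ cong (_+ₚ (y +ₚ z)) (π-toℕ x) ⟩
      x +ₚ (y +ₚ z)                            ∎

    *-assoc : ∀ x y z → x *ₚ y *ₚ z ≡ x *ₚ (y *ₚ z)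
    *-assoc x y z = begin
      π (toℕ x ℕ.* toℕ y) *ₚ z                 ≡⟨ cong (π (toℕ x ℕ.* toℕ y) *ₚ_) (sym (π-toℕ z)) ⟩
      π (toℕ x ℕ.* toℕ y) *ₚ π (toℕ z)         ≡⟨ sym (π-* (toℕ x ℕ.* toℕ y) (toℕ z)) ⟩
      π (toℕ x ℕ.* toℕ y ℕ.* toℕ z)            ≡⟨ cong π (ℕₚ.*-assoc (toℕ x) _ _) ⟩
      π (toℕ x ℕ.* (toℕ y ℕ.* toℕ z))          ≡⟨ π-* (toℕ x) _ ⟩
      π (toℕ x) *ₚ (y *ₚ z)                    ≡⟨ cong (_*ₚ (y *ₚ z)) (π-toℕ x) ⟩
      x *ₚ (y *ₚ z)                            ∎

    +-comm : ∀ x y → x +ₚ y ≡ y +ₚ x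
    +-comm x y = cong π (ℕₚ.+-comm (toℕ x) (toℕ y))

    *-comm : ∀ x y → x *ₚ y ≡ y *ₚ x
    *-comm x y = cong π (ℕₚ.*-comm (toℕ x) (toℕ y))

    +-identityˡ : ∀ x → π 0 +ₚ x ≡ x
    +-identityˡ x = begin
      π 0 +ₚ x             ≡⟨ cong (π 0 +ₚ_) (sym (π-toℕ x)) ⟩
      π 0 +ₚ π (toℕ x)     ≡⟨ sym (π-+ 0 (toℕ x)) ⟩
      π (toℕ x)            ≡⟨ π-toℕ x ⟩
      x                    ∎

    *-identityˡ : ∀ x → π 1 *ₚ x ≡ x
    *-identityˡ x = begin
      π 1 *ₚ x             ≡⟨ cong (π 1 *ₚ_) (sym (π-toℕ x)) ⟩
      π 1 *ₚ π (toℕ x)     ≡⟨ sym (π-* 1 (toℕ x)) ⟩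
      π (1 ℕ.* toℕ x)      ≡⟨ cong π (ℕₚ.*-identityˡ (toℕ x)) ⟩
      π (toℕ x)            ≡⟨ π-toℕ x ⟩
      x                    ∎

    inverseˡ : ∀ x → -ₚ x +ₚ x ≡ π 0
    inverseˡ x = begin
      π (p ℕ.∸ toℕ x) +ₚ x            ≡⟨ cong (π (p ℕ.∸ toℕ x) +ₚ_) (sym (π-toℕ x)) ⟩
      π (p ℕ.∸ toℕ x) +ₚ π (toℕ x)    ≡⟨ sym (π-+ (p ℕ.∸ toℕ x) (toℕ x)) ⟩
      π (p ℕ.∸ toℕ x ℕ.+ toℕ x)       ≡⟨ cong π (ℕₚ.m∸n+n≡m (ℕₚ.<⇒≤ (Finₚ.toℕ<n x))) ⟩
      π p                           ≡⟨ π-cong {p} {0} (trans (cong (_% p) (sym (ℕₚ.*-identityˡ p))) ([m+kn]%n≡m%n 0 1 p)) ⟩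
      π 0                           ∎

    distribˡ : ∀ x y z → x *ₚ (y +ₚ z) ≡ x *ₚ y +ₚ x *ₚ z
    distribˡ x y z = begin
      x *ₚ (y +ₚ z)                                   ≡⟨ cong (_*ₚ (y +ₚ z)) (sym (π-toℕ x)) ⟩
      π (toℕ x) *ₚ π (toℕ y ℕ.+ toℕ z)                ≡⟨ sym (π-* (toℕ x) (toℕ y ℕ.+ toℕ z)) ⟩
      π (toℕ x ℕ.* (toℕ y ℕ.+ toℕ z))                 ≡⟨ cong π (ℕₚ.*-distribˡ-+ (toℕ x) (toℕ y) (toℕ z)) ⟩
      π (toℕ x ℕ.* toℕ y ℕ.+ toℕ x ℕ.* toℕ z)         ≡⟨ π-+ (toℕ x ℕ.* toℕ y) (toℕ x ℕ.* toℕ z) ⟩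
      x *ₚ y +ₚ x *ₚ z                                ∎

  𝔽ʳ : CRing
  𝔽ʳ = record
    { Carrier = Fin p ; _+_ = _+ₚ_ ; _*_ = _*ₚ_ ; -_ = -ₚ_ ; 0# = π 0 ; 1# = π 1
    ; isCommutativeRing = record
      { isRing = record
        { +-isAbelianGroup = record
          { isGroup = record
            { isMonoid = record
              { isSemigroup = record
                { isMagma = record { isEquivalence = ≡.isEquivalence ; ∙-cong = cong₂ _+ₚ_ }
                ; assoc = +-assoc }
              ; identity = +-identityˡ , λ x → trans (+-comm x (π 0)) (+-identityˡ x) }
            ; inverse = inverseˡ , (λ x → trans (+-comm x (-ₚ x)) (inverseˡ x))
            ; ⁻¹-cong = cong -ₚ_ }
          ; comm = +-comm }
        ; *-cong = cong₂ _*ₚ_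
        ; *-assoc = *-assoc
        ; *-identity = *-identityˡ , (λ x → trans (*-comm x (π 1)) (*-identityˡ x))
        ; distrib = distribˡ , λ x y z → trans (*-comm (y +ₚ z) x)
            (trans (distribˡ x y z) (cong₂ _+ₚ_ (*-comm x y) (*-comm x z))) }
      ; *-comm = *-comm } }

  𝔽 : FiniteRing
  𝔽 = record
    { cring = 𝔽ʳ
    ; size = p ; element = λ i → i ; index = λ i → i
    ; element-index = λ _ → refl ; index-element = λ _ → refl }

  open FiniteRing 𝔽 using (_·_)

  π-≢0 : ∀ {x} → x ≢ π 0 → 0 ℕ.< toℕ x
  π-≢0 {x} x≢0 = ℕₚ.n≢0⇒n>0 (λ eq → x≢0 (trans (sym (π-toℕ x)) (cong π eq)))

  isField : FiniteRing.IsField 𝔽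
  isField = record { 1≢0 = 1≢0 ; inverse = inverse }
    where
    1<p : 1 ℕ.< p
    1<p = ℕ.nonTrivial⇒n>1 p {{prime⇒nonTrivial pr}}
    1≢0 : π 1 ≢ π 0
    1≢0 eq = ℕₚ.1+n≢0 (trans (sym (m<n⇒m%n≡m 1<p)) (trans (π-injective {1} {0} eq)
               (m<n⇒m%n≡m (ℕₚ.<-trans ℕₚ.0<1+n 1<p))))
    inverse : ∀ x → x ≢ π 0 → ∃ λ y → x *ₚ y ≡ π 1
    inverse x x≢0 with coprime-Bézout
        (Coprime.sym (prime⇒coprime pr {{ℕ.>-nonZero (π-≢0 x≢0)}} (Finₚ.toℕ<n x)))
    ... | Bézout.+- a b eq = π a , (begin
      x *ₚ π a                   ≡⟨ cong (_*ₚ π a) (sym (π-toℕ x)) ⟩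
      π (toℕ x) *ₚ π a           ≡⟨ sym (π-* (toℕ x) a) ⟩
      π (toℕ x ℕ.* a)            ≡⟨ cong π (trans (ℕₚ.*-comm (toℕ x) a) (sym eq)) ⟩
      π (1 ℕ.+ b ℕ.* p)          ≡⟨ π-cong {1 ℕ.+ b ℕ.* p} {1} ([m+kn]%n≡m%n 1 b p) ⟩
      π 1                        ∎)
    -- Here 1 + a x = b p, so a is minus the inverse.
    ... | Bézout.-+ a b eq = -ₚ π a , (begin
      x *ₚ (-ₚ π a)              ≡⟨ R.solve 2 (λ x a → x R.:* (R.:- a) R.:= R.:1 R.:- (R.:1 R.:+ a R.:* x)) refl x (π a) ⟩
      π 1 R.- (π 1 +ₚ π a *ₚ x)  ≡⟨ cong (λ t → π 1 R.- t) lemma ⟩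
      π 1 R.- π 0                ≡⟨ R.solve 1 (λ a → a R.:- R.:0 R.:= a) refl (π 1) ⟩
      π 1                        ∎)
      where
      module R = FiniteRing 𝔽
      lemma : π 1 +ₚ π a *ₚ x ≡ π 0
      lemma = begin
        π 1 +ₚ π a *ₚ x             ≡⟨ cong (λ t → π 1 +ₚ π a *ₚ t) (sym (π-toℕ x)) ⟩
        π 1 +ₚ π a *ₚ π (toℕ x)     ≡⟨ cong (π 1 +ₚ_) (sym (π-* a (toℕ x))) ⟩
        π 1 +ₚ π (a ℕ.* toℕ x)      ≡⟨ sym (π-+ 1 (a ℕ.* toℕ x)) ⟩
        π (1 ℕ.+ a ℕ.* toℕ x)       ≡⟨ cong π eq ⟩
        π (b ℕ.* p)                 ≡⟨ π-cong {b ℕ.* p} {0} ([m+kn]%n≡m%n 0 b p) ⟩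
        π 0                         ∎

  ·1≡π : ∀ a → a · π 1 ≡ π a
  ·1≡π zero    = refl
  ·1≡π (suc a) = trans (cong (π 1 +ₚ_) (·1≡π a)) (sym (π-+ 1 a))

-- Sums over a finite ring with values in an ordered ring

record OrderedRing : Set₁ where
  field
    cring : CRing
  open CRing cring public
  infix 4 _≤_
  field
    _≤_            : Carrier → Carrier → Set
    ≤-refl         : ∀ {x} → x ≤ x
    ≤-trans        : ∀ {x y z} → x ≤ y → y ≤ z → x ≤ z
    +-mono-≤       : ∀ {w x y z} → w ≤ x → y ≤ z → w + y ≤ x + z
    *-monoˡ-≤      : ∀ {c x y} → 0# ≤ c → x ≤ y → c * x ≤ c * y
    0≤x*x          : ∀ x → 0# ≤ x * x
    0≤x+x⇒0≤x      : ∀ {x} → 0# ≤ x + x → 0# ≤ x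

  ≤-reflexive : ∀ {x y} → x ≡ y → x ≤ y
  ≤-reflexive refl = ≤-refl

  0≤y-x⇒x≤y : ∀ {x y} → 0# ≤ y - x → x ≤ y
  0≤y-x⇒x≤y {x} {y} 0≤y-x = ≤-trans (≤-reflexive (sym (+-identityˡ x)))
    (≤-trans (+-mono-≤ 0≤y-x ≤-refl) (≤-reflexive (solve 2 (λ x y → y :- x :+ x := y) refl x y)))

module FiniteSum (R : FiniteRing) (O : OrderedRing) where
  open FiniteRing R using (element; index; element-index; index-element; size; _≟_)
    renaming (Carrier to F; 0# to 𝟘)
  open OrderedRing O
  import Algebra.Properties.Semiring.Sum semiring as Sum
  open Sum using (sum; sum-cong-≗)
  open ≡-Reasoning

  opaque
    -- Opaque, so that goals keep `∑` instead of a sum over indices and unification can recover the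
    -- summand.
    ∑ : (F → Carrier) → Carrier
    ∑ g = sum (λ i → g (element i))

    ∑-cong : ∀ {g h : F → Carrier} → (∀ x → g x ≡ h x) → ∑ g ≡ ∑ h
    ∑-cong g≗h = sum-cong-≗ (λ i → g≗h (element i))

    ∑-+ : ∀ (g h : F → Carrier) → ∑ (λ x → g x + h x) ≡ ∑ g + ∑ h
    ∑-+ g h = Sum.∑-distrib-+ (g ∘ element) (h ∘ element)

    ∑-*ˡ : ∀ c (g : F → Carrier) → ∑ (λ x → c * g x) ≡ c * ∑ g
    ∑-*ˡ c g = sym (Sum.*-distribˡ-sum c (g ∘ element))

    ∑-comm : ∀ (g : F → F → Carrier) → ∑ (λ x → ∑ (g x)) ≡ ∑ (λ y → ∑ (λ x → g x y))
    ∑-comm g = Sum.∑-comm (λ i j → g (element i) (element j))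

    ∑-const : ∀ c → ∑ (λ _ → c) ≡ (size · 1#) * c
    ∑-const c = go size
      where
      go : ∀ n → sum {n} (λ _ → c) ≡ (n · 1#) * c
      go zero    = sym (zeroˡ c)
      go (suc n) = trans (cong₂ _+_ (sym (*-identityˡ c)) (go n)) (sym (distribʳ c 1# (n · 1#)))

    ∑-bijection : ∀ (to from : F → F) → (∀ x → to (from x) ≡ x) → (∀ x → from (to x) ≡ x) →
      ∀ g → ∑ (λ x → g (to x)) ≡ ∑ g
    ∑-bijection to from to∘from from∘to g = begin
      sum {size} (λ i → g (to (element i)))
        ≡⟨ sum-cong-≗ {size} (λ i → cong g (sym (element-index (to (element i))))) ⟩
      sum {size} (λ i → g (element (index (to (element i))))) ≡⟨ sym (Sum.sum-permute (g ∘ element) π) ⟩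
      sum {size} (λ i → g (element i))                        ∎
      where
      π : Perm.Permutation size size
      π = mk↔ₛ′ (index ∘ to ∘ element) (index ∘ from ∘ element)
        (λ i → trans (cong (index ∘ to) (element-index _)) (trans (cong index (to∘from _)) (index-element i)))
        (λ i → trans (cong (index ∘ from) (element-index _)) (trans (cong index (from∘to _)) (index-element i)))

    ∑-mono : ∀ {g h : F → Carrier} → (∀ x → g x ≤ h x) → ∑ g ≤ ∑ h
    ∑-mono {g} {h} g≤h = go (g≤h ∘ element)
      where
      go : ∀ {n} {g h : Fin n → Carrier} → (∀ i → g i ≤ h i) → sum g ≤ sum h
      go {zero}  le = ≤-refl
      go {suc n} le = +-mono-≤ (le zero) (go (le ∘ suc))

  ∑-*ʳ : ∀ c (g : F → Carrier) → ∑ (λ x → g x * c) ≡ ∑ g * c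
  ∑-*ʳ c g = trans (∑-cong (λ x → *-comm (g x) c)) (trans (∑-*ˡ c g) (*-comm c (∑ g)))

  ∑-+₃ : ∀ (f g h : F → Carrier) → ∑ (λ x → f x + g x + h x) ≡ ∑ f + ∑ g + ∑ h
  ∑-+₃ f g h = trans (∑-+ (λ x → f x + g x) h) (cong (_+ ∑ h) (∑-+ f g))

  ∑-zero : ∀ {g : F → Carrier} → (∀ x → g x ≡ 0#) → ∑ g ≡ 0#
  ∑-zero g≗0 = trans (∑-cong g≗0) (trans (∑-const 0#) (zeroʳ _))

  ∑-product : ∀ (g h : F → Carrier) → ∑ (λ x → ∑ (λ y → g x * h y)) ≡ ∑ g * ∑ h
  ∑-product g h = trans (∑-cong (λ x → ∑-*ˡ (g x) h)) (∑-*ʳ (∑ h) g)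

  ∑-nonneg : ∀ {g : F → Carrier} → (∀ x → 0# ≤ g x) → 0# ≤ ∑ g
  ∑-nonneg 0≤g = ≤-trans (≤-reflexive (sym (∑-zero (λ _ → refl)))) (∑-mono 0≤g)

  -- Lagrange's identity: the double sum of the squares (g x h y - g y h x)² is twice the difference
  -- of the two sides. The factor 2 is removed by `0≤x+x⇒0≤x`, as there is no division.
  cauchy-schwarz : ∀ (g h : F → Carrier) →
    ∑ (λ x → g x * h x) * ∑ (λ x → g x * h x) ≤ ∑ (λ x → g x * g x) * ∑ (λ x → h x * h x)
  cauchy-schwarz g h = 0≤y-x⇒x≤y (0≤x+x⇒0≤x (≤-trans
      (∑-nonneg (λ x → ∑-nonneg (λ y → 0≤x*x (g x * h y - g y * h x)))) (≤-reflexive lagrange)))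
    where
    A = ∑ (λ x → g x * g x)
    B = ∑ (λ x → g x * h x)
    C = ∑ (λ x → h x * h x)
    lagrange : ∑ (λ x → ∑ (λ y → (g x * h y - g y * h x) * (g x * h y - g y * h x)))
      ≡ (A * C - B * B) + (A * C - B * B)
    lagrange = begin
      ∑ (λ x → ∑ (λ y → (g x * h y - g y * h x) * (g x * h y - g y * h x)))
        ≡⟨ ∑-cong (λ x → trans
             (∑-cong (λ y → solve 4 (λ a b c d → (a :* d :- b :* c) :* (a :* d :- b :* c)
               := (a :* a) :* (d :* d) :+ (c :* c) :* (b :* b) :+ (con (ℤ.-[1+ 1 ]) :* (a :* c)) :* (b :* d))
               refl (g x) (g y) (h x) (h y)))
             (∑-+₃ _ _ _)) ⟩
      ∑ (λ x → ∑ (λ y → (g x * g x) * (h y * h y)) + ∑ (λ y → (h x * h x) * (g y * g y))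
               + ∑ (λ y → (- (1# + 1#) * (g x * h x)) * (g y * h y)))
        ≡⟨ ∑-+₃ _ _ _ ⟩
      ∑ (λ x → ∑ (λ y → (g x * g x) * (h y * h y))) + ∑ (λ x → ∑ (λ y → (h x * h x) * (g y * g y)))
               + ∑ (λ x → ∑ (λ y → (- (1# + 1#) * (g x * h x)) * (g y * h y)))
        ≡⟨ cong₂ _+_ (cong₂ _+_ (∑-product _ _) (∑-product _ _)) (∑-product _ _) ⟩
      A * C + C * A + ∑ (λ x → - (1# + 1#) * (g x * h x)) * B
        ≡⟨ cong (λ t → A * C + C * A + t * B) (∑-*ˡ _ _) ⟩
      A * C + C * A + (- (1# + 1#) * B) * B
        ≡⟨ solve 3 (λ a b c → a :* c :+ c :* a :+ (con (ℤ.-[1+ 1 ]) :* b) :* b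
             := (a :* c :- b :* b) :+ (a :* c :- b :* b)) refl A B C ⟩
      (A * C - B * B) + (A * C - B * B) ∎

  δ : F → F → Carrier
  δ a x with a ≟ x
  ... | yes _ = 1#
  ... | no  _ = 0#

  δ-≡ : ∀ {a x} → a ≡ x → δ a x ≡ 1#
  δ-≡ {a} {x} a≡x with a ≟ x
  ... | yes _  = refl
  ... | no a≢x = contradiction a≡x a≢x

  δ-≢ : ∀ {a x} → a ≢ x → δ a x ≡ 0#
  δ-≢ {a} {x} a≢x with a ≟ x
  ... | yes a≡x = contradiction a≡x a≢x
  ... | no _    = refl

  δ-⇔ : ∀ {a x b y} → (a ≡ x → b ≡ y) → (b ≡ y → a ≡ x) → δ a x ≡ δ b y
  δ-⇔ {a} {x} to from with a ≟ x
  ... | yes a≡x = sym (δ-≡ (to a≡x))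
  ... | no a≢x  = sym (δ-≢ (a≢x ∘ from))

  opaque
    unfolding ∑
    ∑-δ1 : ∀ a → ∑ (δ a) ≡ 1#
    ∑-δ1 a = trans (sum-cong-≗ δ-index) (go (index a))
      where
      d : ∀ {n} → Fin n → Fin n → Carrier
      d j i with j Finₚ.≟ i
      ... | yes _ = 1#
      ... | no  _ = 0#
      d-suc : ∀ {n} (j i : Fin n) → d (suc j) (suc i) ≡ d j i
      d-suc j i with j Finₚ.≟ i
      ... | yes _ = refl
      ... | no  _ = refl
      δ-index : ∀ i → δ a (element i) ≡ d (index a) i
      δ-index i with index a Finₚ.≟ i
      ... | yes eq = δ-≡ (trans (sym (element-index a)) (cong element eq))
      ... | no neq = δ-≢ (λ eq → neq (trans (cong index eq) (index-element i)))
      go : ∀ {n} (j : Fin n) → sum (d j) ≡ 1#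
      go {suc n} zero    = trans (cong (λ t → 1# + t) (Sum.sum-replicate-zero n)) (+-identityʳ 1#)
      go {suc n} (suc j) = trans (+-identityˡ _) (trans (sum-cong-≗ (d-suc j)) (go j))

  ∑-δ : ∀ a (g : F → Carrier) → ∑ (λ x → δ a x * g x) ≡ g a
  ∑-δ a g = begin
    ∑ (λ x → δ a x * g x) ≡⟨ ∑-cong pointwise ⟩
    ∑ (λ x → δ a x * g a) ≡⟨ ∑-*ʳ (g a) (δ a) ⟩
    ∑ (δ a) * g a         ≡⟨ cong (_* g a) (∑-δ1 a) ⟩
    1# * g a              ≡⟨ *-identityˡ (g a) ⟩
    g a                   ∎
    where
    pointwise : ∀ x → δ a x * g x ≡ δ a x * g a
    pointwise x with a ≟ x
    ... | yes refl = refl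
    ... | no _     = trans (zeroˡ _) (sym (zeroˡ _))

  ∑-const-off-𝟘 : ∀ (g : F → Carrier) c → (∀ x → x ≢ 𝟘 → g x ≡ c) → ∑ g ≡ g 𝟘 + (size · 1# - 1#) * c
  ∑-const-off-𝟘 g c g≡c = begin
    ∑ g                                        ≡⟨ ∑-cong pointwise ⟩
    ∑ (λ x → c + δ 𝟘 x * (g 𝟘 - c))            ≡⟨ ∑-+ _ _ ⟩
    ∑ (λ _ → c) + ∑ (λ x → δ 𝟘 x * (g 𝟘 - c))  ≡⟨ cong₂ _+_ (∑-const c) (∑-δ 𝟘 (λ _ → g 𝟘 - c)) ⟩
    size · 1# * c + (g 𝟘 - c)
      ≡⟨ solve 3 (λ q c a → q :* c :+ (a :- c) := a :+ (q :- :1) :* c) refl (size · 1#) c (g 𝟘) ⟩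
    g 𝟘 + (size · 1# - 1#) * c                 ∎
    where
    pointwise : ∀ x → g x ≡ c + δ 𝟘 x * (g 𝟘 - c)
    pointwise x with 𝟘 ≟ x
    ... | yes refl = solve 2 (λ c a → a := c :+ :1 :* (a :- c)) refl c (g 𝟘)
    ... | no 0≢x   = trans (g≡c x (0≢x ∘ sym)) (solve 2 (λ c a → c := c :+ :0 :* (a :- c)) refl c (g 𝟘))

  opaque
    unfolding ∑
    -- Turns the sum of a 0-1 function into a number of distinct elements, to which a bound on roots
    -- of polynomials applies.
    ∑-count : ∀ (g : F → Carrier) → (∀ x → g x ≡ 0# ⊎ g x ≡ 1#) →
      Σ ℕ λ m → Σ (Fin m → F) λ ι → Injective _≡_ _≡_ ι × (∀ j → g (ι j) ≡ 1#) × ∑ g ≡ m · 1#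
    ∑-count g g∈ with go (g ∘ element) (g∈ ∘ element)
      where
      go : ∀ {n} (h : Fin n → Carrier) → (∀ i → h i ≡ 0# ⊎ h i ≡ 1#) →
        Σ ℕ λ m → Σ (Fin m → Fin n) λ ι → Injective _≡_ _≡_ ι × (∀ j → h (ι j) ≡ 1#) × sum h ≡ m · 1#
      go {zero} h h∈ = 0 , (λ ()) , (λ {x} → contradiction x λ ()) , (λ ()) , refl
      go {suc n} h h∈ with go (h ∘ suc) (h∈ ∘ suc) | h∈ zero
      ... | m , ι , inj , one , eq | inj₁ h0≡0 =
        m , suc ∘ ι , inj ∘ Finₚ.suc-injective , one , trans (cong₂ _+_ h0≡0 eq) (+-identityˡ _)
      ... | m , ι , inj , one , eq | inj₂ h0≡1 = suc m , ι′ , inj′ , one′ , cong₂ _+_ h0≡1 eq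
        where
        ι′ : Fin (suc m) → Fin (suc n)
        ι′ zero    = zero
        ι′ (suc j) = suc (ι j)
        inj′ : Injective _≡_ _≡_ ι′
        inj′ {zero}  {zero}  _ = refl
        inj′ {suc i} {suc j} p = cong suc (inj (Finₚ.suc-injective p))
        one′ : ∀ j → h (ι′ j) ≡ 1#
        one′ zero    = h0≡1
        one′ (suc j) = one j
    ... | m , ι , inj , one , eq = m , element ∘ ι
        , (λ p → inj (trans (sym (index-element _)) (trans (cong index p) (index-element _)))) , one , eq

-- Second-moment estimates for sums of two k-th powers

module PowerCount (R : FiniteRing) (isField : FiniteRing.IsField R) (O : OrderedRing)
  (k : ℕ) (1≤k : 1 ℕ.≤ k) where

  private module F = FiniteRing R
  open F using (size; _^_; _≟_)
    renaming (Carrier to F; 0# to 𝟘; 1# to 𝟙; _+_ to _⊕_; _*_ to _⊗_; _-_ to _⊖_; -_ to ⊝_)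
  open F.IsField isField
  open OrderedRing O hiding (_^_)
  open FiniteSum R O
  open ≡-Reasoning

  q q-1 : Carrier
  q   = size · 1#
  q-1 = q - 1#

  ∑-scale : ∀ {a} → a ≢ 𝟘 → ∀ (g : F → Carrier) → ∑ (λ x → g (a ⊗ x)) ≡ ∑ g
  ∑-scale {a} a≢0 with inverse a a≢0
  ... | a⁻¹ , aa⁻¹≡1 = ∑-bijection (a ⊗_) (a⁻¹ ⊗_)
    (λ x → trans (sym (F.*-assoc a a⁻¹ x)) (trans (cong (_⊗ x) aa⁻¹≡1) (F.*-identityˡ x)))
    (λ x → trans (sym (F.*-assoc a⁻¹ a x)) (trans (cong (_⊗ x) (trans (F.*-comm a⁻¹ a) aa⁻¹≡1)) (F.*-identityˡ x)))

  ∑-translate : ∀ a (g : F → Carrier) → ∑ (λ x → g (x ⊕ a)) ≡ ∑ g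
  ∑-translate a = ∑-bijection (_⊕ a) (_⊖ a)
    (λ x → F.solve 2 (λ x a → x F.:- a F.:+ a F.:= x) refl x a)
    (λ x → F.solve 2 (λ x a → x F.:+ a F.:- a F.:= x) refl x a)

  ∑-reflect : ∀ a (g : F → Carrier) → ∑ (λ x → g (a ⊖ x)) ≡ ∑ g
  ∑-reflect a = ∑-bijection (a ⊖_) (a ⊖_) involutive involutive
    where
    involutive : ∀ x → a ⊖ (a ⊖ x) ≡ x
    involutive x = F.solve 2 (λ x a → a F.:- (a F.:- x) F.:= x) refl x a

  -- In terms of characters, `f₀` is the sum of the nontrivial multiplicative characters χ with χᵏ =
  -- 1, and `u` below is their number.
  f f₀ : F → Carrier
  f  b = ∑ (λ x → δ (x ^ k) b)
  f₀ b = f b - 1#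

  u : Carrier
  u = f₀ 𝟙

  ∑-f : ∀ (φ : F → Carrier) → ∑ (λ c → f c * φ c) ≡ ∑ (λ x → φ (x ^ k))
  ∑-f φ = begin
    ∑ (λ c → ∑ (λ x → δ (x ^ k) c) * φ c)   ≡⟨ ∑-cong (λ c → sym (∑-*ʳ (φ c) _)) ⟩
    ∑ (λ c → ∑ (λ x → δ (x ^ k) c * φ c))   ≡⟨ ∑-comm _ ⟩
    ∑ (λ x → ∑ (λ c → δ (x ^ k) c * φ c))   ≡⟨ ∑-cong (λ x → ∑-δ (x ^ k) φ) ⟩
    ∑ (λ x → φ (x ^ k))                     ∎

  f-invariant : ∀ {w} → w ≢ 𝟘 → ∀ b → f (w ^ k ⊗ b) ≡ f b
  f-invariant {w} w≢0 b = begin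
    ∑ (λ x → δ (x ^ k) (w ^ k ⊗ b))         ≡⟨ sym (∑-scale w≢0 _) ⟩
    ∑ (λ x → δ ((w ⊗ x) ^ k) (w ^ k ⊗ b))   ≡⟨ ∑-cong (λ x → δ-⇔
      (λ eq → *-cancelˡ-≢0 (x^n≢0 k w≢0) (trans (sym (F.^-distrib-* w x k)) eq))
      (λ eq → trans (F.^-distrib-* w x k) (cong (w ^ k ⊗_) eq))) ⟩
    ∑ (λ x → δ (x ^ k) b)                   ∎

  f₀-invariant : ∀ {w} → w ≢ 𝟘 → ∀ b → f₀ (w ^ k ⊗ b) ≡ f₀ b
  f₀-invariant w≢0 b = cong (_- 1#) (f-invariant w≢0 b)

  f𝟘≡1 : f 𝟘 ≡ 1#
  f𝟘≡1 = begin
    ∑ (λ x → δ (x ^ k) 𝟘)     ≡⟨ ∑-const-off-𝟘 _ 0# (λ x x≢0 → δ-≢ (x^n≢0 k x≢0)) ⟩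
    δ (𝟘 ^ k) 𝟘 + q-1 * 0#    ≡⟨ cong₂ _+_ (δ-≡ (F.0^n≡0 1≤k)) (zeroʳ q-1) ⟩
    1# + 0#                   ≡⟨ +-identityʳ 1# ⟩
    1#                        ∎

  f₀𝟘≡0 : f₀ 𝟘 ≡ 0#
  f₀𝟘≡0 = trans (cong (_- 1#) f𝟘≡1) (-‿inverseʳ 1#)

  ∑-sub-const : ∀ (g : F → Carrier) c → ∑ (λ x → g x - c) ≡ ∑ g - q * c
  ∑-sub-const g c = trans (∑-+ g (λ _ → - c)) (cong (λ t → ∑ g + t) (trans (∑-const (- c)) (sym (-‿distribʳ-* q c))))

  ∑f₀≡0 : ∑ f₀ ≡ 0#
  ∑f₀≡0 = begin
    ∑ (λ c → f c - 1#)         ≡⟨ ∑-sub-const f 1# ⟩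
    ∑ f - q * 1#               ≡⟨ cong (_- q * 1#) (trans (∑-cong (λ c → sym (*-identityʳ (f c)))) (trans (∑-f (λ _ → 1#)) (∑-const 1#))) ⟩
    q * 1# - q * 1#            ≡⟨ -‿inverseʳ _ ⟩
    0#                         ∎

  -- The pairing is the sum of φ over all xᵏ minus the total of φ. The two hypotheses make the
  -- former φ 0 + (q - 1) φ 1 and the latter φ 0. Thus a value of φ becomes an inner product with
  -- `f₀`, ready for Cauchy-Schwarz.
  f₀-evaluation : ∀ (φ : F → Carrier) → (∀ {w} → w ≢ 𝟘 → φ (w ^ k) ≡ φ 𝟙) → ∑ φ ≡ φ 𝟘 →
    ∑ (λ c → f₀ c * φ c) ≡ q-1 * φ 𝟙
  f₀-evaluation φ invariant ∑φ≡ = begin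
    ∑ (λ c → f₀ c * φ c)
      ≡⟨ ∑-cong (λ c → solve 2 (λ a b → (a :- :1) :* b := a :* b :+ con (ℤ.-[1+ 0 ]) :* b) refl (f c) (φ c)) ⟩
    ∑ (λ c → f c * φ c + - 1# * φ c)           ≡⟨ ∑-+ _ _ ⟩
    ∑ (λ c → f c * φ c) + ∑ (λ c → - 1# * φ c) ≡⟨ cong₂ _+_ (∑-f φ) (∑-*ˡ (- 1#) φ) ⟩
    ∑ (λ x → φ (x ^ k)) + - 1# * ∑ φ
      ≡⟨ cong₂ _+_ (∑-const-off-𝟘 _ (φ 𝟙) (λ x x≢0 → invariant x≢0)) (cong (- 1# *_) ∑φ≡) ⟩
    φ (𝟘 ^ k) + q-1 * φ 𝟙 + - 1# * φ 𝟘         ≡⟨ cong (λ t → φ t + q-1 * φ 𝟙 + - 1# * φ 𝟘) (F.0^n≡0 1≤k) ⟩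
    φ 𝟘 + q-1 * φ 𝟙 + - 1# * φ 𝟘
      ≡⟨ solve 2 (λ a b → a :+ b :+ con (ℤ.-[1+ 0 ]) :* a := b) refl (φ 𝟘) (q-1 * φ 𝟙) ⟩
    q-1 * φ 𝟙                                  ∎

  w^k*𝟙 : ∀ {A : Set} (g : F → A) w → g (w ^ k ⊗ 𝟙) ≡ g (w ^ k)
  w^k*𝟙 g w = cong g (F.*-identityʳ (w ^ k))

  ∑f₀²≡ : ∑ (λ c → f₀ c * f₀ c) ≡ q-1 * u
  ∑f₀²≡ = f₀-evaluation f₀ (λ {w} w≢0 → trans (sym (w^k*𝟙 f₀ w)) (f₀-invariant w≢0 𝟙))
    (trans ∑f₀≡0 (sym f₀𝟘≡0))

  ∑f₀-dilate : ∀ x → ∑ (λ c → f₀ (c ⊗ x)) ≡ 0#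
  ∑f₀-dilate x with x ≟ 𝟘
  ... | yes refl = ∑-zero (λ c → trans (cong f₀ (F.zeroʳ c)) f₀𝟘≡0)
  ... | no x≢0   = trans (∑-cong (λ c → cong f₀ (F.*-comm c x))) (trans (∑-scale x≢0 f₀) ∑f₀≡0)

  f₀[0*x]≡0 : ∀ x → f₀ (𝟘 ⊗ x) ≡ 0#
  f₀[0*x]≡0 x = trans (cong f₀ (F.zeroˡ x)) f₀𝟘≡0

  -- Convolution of the dilate of `f₀` by c with `f₀`. The additional variable c is the one averaged
  -- over.
  T : F → F → Carrier
  T c z = ∑ (λ y → f₀ (c ⊗ (z ⊖ y)) * f₀ y)

  N₀ : F → Carrier
  N₀ z = ∑ (λ y → f₀ (z ⊖ y) * f₀ y)

  T-𝟙 : ∀ z → T 𝟙 z ≡ N₀ z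
  T-𝟙 z = ∑-cong (λ y → cong (λ t → f₀ t * f₀ y) (F.*-identityˡ (z ⊖ y)))

  -- Recovers the single convolution `N₀` from all the dilated ones, so that its square is
  -- controlled by the mean square of `T` over c.
  T-evaluation : ∀ z → ∑ (λ c → f₀ c * T c z) ≡ q-1 * N₀ z
  T-evaluation z = trans (f₀-evaluation (λ c → T c z)
      (λ w≢0 → ∑-cong (λ y → cong (_* f₀ y) (trans (f₀-invariant w≢0 _) (cong f₀ (sym (F.*-identityˡ _))))))
      (trans ∑T≡0 (sym T𝟘≡0)))
    (cong (q-1 *_) (T-𝟙 z))
    where
    T𝟘≡0 : T 𝟘 z ≡ 0#
    T𝟘≡0 = ∑-zero (λ y → trans (cong (_* f₀ y) (f₀[0*x]≡0 _)) (zeroˡ _))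
    ∑T≡0 : ∑ (λ c → T c z) ≡ 0#
    ∑T≡0 = trans (∑-comm _) (∑-zero (λ y → trans (∑-*ʳ (f₀ y) _)
      (trans (cong (_* f₀ y) (∑f₀-dilate (z ⊖ y))) (zeroˡ _))))

  -- The autocorrelation of the dilate of `f₀` by c. Its sum `H` over c takes one value at 0 and one
  -- elsewhere, since a shift w ≠ 0 can be absorbed into c: averaging over dilations flattens the
  -- Fourier spectrum.
  G : F → F → Carrier
  G c w = ∑ (λ z → f₀ (c ⊗ z) * f₀ (c ⊗ (z ⊕ w)))

  H : F → Carrier
  H w = ∑ (λ c → G c w)

  G𝟘≡0 : ∀ w → G 𝟘 w ≡ 0#
  G𝟘≡0 w = ∑-zero (λ z → trans (cong (_* f₀ (𝟘 ⊗ (z ⊕ w))) (f₀[0*x]≡0 z)) (zeroˡ _))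

  H𝟘≡ : H 𝟘 ≡ q-1 * (q-1 * u)
  H𝟘≡ = begin
    ∑ (λ c → G c 𝟘)                ≡⟨ ∑-const-off-𝟘 _ (q-1 * u) (λ c c≢0 →
      trans (∑-cong (λ z → cong (λ t → f₀ (c ⊗ z) * f₀ (c ⊗ t)) (F.+-identityʳ z)))
        (trans (∑-scale c≢0 (λ z → f₀ z * f₀ z)) ∑f₀²≡)) ⟩
    G 𝟘 𝟘 + q-1 * (q-1 * u)        ≡⟨ cong (_+ q-1 * (q-1 * u)) (G𝟘≡0 𝟘) ⟩
    0# + q-1 * (q-1 * u)           ≡⟨ +-identityˡ _ ⟩
    q-1 * (q-1 * u)                ∎

  H-const : ∀ w → w ≢ 𝟘 → H w ≡ H 𝟙
  H-const w w≢0 = begin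
    ∑ (λ c → G c w)          ≡⟨ ∑-cong (λ c → sym (∑-scale w≢0 _)) ⟩
    ∑ (λ c → ∑ (λ z → f₀ (c ⊗ (w ⊗ z)) * f₀ (c ⊗ (w ⊗ z ⊕ w))))
      ≡⟨ ∑-cong (λ c → ∑-cong (λ z → cong₂ (λ s t → f₀ s * f₀ t)
           (F.solve 3 (λ c w z → c F.:* (w F.:* z) F.:= (w F.:* c) F.:* z) refl c w z)
           (F.solve 3 (λ c w z → c F.:* (w F.:* z F.:+ w) F.:= (w F.:* c) F.:* (z F.:+ F.:1)) refl c w z))) ⟩
    ∑ (λ c → G (w ⊗ c) 𝟙)    ≡⟨ ∑-scale w≢0 (λ c → G c 𝟙) ⟩
    ∑ (λ c → G c 𝟙)          ∎

  ∑H≡0 : ∑ H ≡ 0#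
  ∑H≡0 = trans (∑-comm _) (∑-zero (λ c → trans (∑-comm _) (∑-zero (λ z → begin
    ∑ (λ w → f₀ (c ⊗ z) * f₀ (c ⊗ (z ⊕ w))) ≡⟨ ∑-*ˡ (f₀ (c ⊗ z)) _ ⟩
    f₀ (c ⊗ z) * ∑ (λ w → f₀ (c ⊗ (z ⊕ w))) ≡⟨ cong (f₀ (c ⊗ z) *_) (begin
      ∑ (λ w → f₀ (c ⊗ (z ⊕ w)))  ≡⟨ ∑-cong (λ w → cong (λ t → f₀ (c ⊗ t)) (F.+-comm z w)) ⟩
      ∑ (λ w → f₀ (c ⊗ (w ⊕ z)))  ≡⟨ ∑-translate z (λ w → f₀ (c ⊗ w)) ⟩
      ∑ (λ w → f₀ (c ⊗ w))        ≡⟨ ∑-cong (λ w → cong f₀ (F.*-comm c w)) ⟩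
      ∑ (λ w → f₀ (w ⊗ c))        ≡⟨ ∑f₀-dilate c ⟩
      0#                          ∎) ⟩
    f₀ (c ⊗ z) * 0#                         ≡⟨ zeroʳ _ ⟩
    0# ∎))))

  -- The three hypotheses express that q - 1 is positive; the chosen ordered ring has to supply
  -- them.
  module Bound
    (cancel-≤ : ∀ {x y} → q-1 * x ≤ q-1 * y → x ≤ y)
    (cancel-≡0 : ∀ {x} → q-1 * x ≡ 0# → x ≡ 0#)
    (0≤q-1 : 0# ≤ q-1) where

    -- The total of `H` vanishes, and it consists of `H 𝟘` and q - 1 copies of the common value off
    -- 0.
    H𝟙≡ : H 𝟙 ≡ - (q-1 * u)
    H𝟙≡ = x-y≡0⇒x≡y (cancel-≡0 (begin
      q-1 * (H 𝟙 - - (q-1 * u))          ≡⟨ solve 3 (λ a h b → a :* (h :- (:- b)) := a :* b :+ a :* h) refl q-1 (H 𝟙) (q-1 * u) ⟩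
      q-1 * (q-1 * u) + q-1 * H 𝟙        ≡⟨ cong (_+ q-1 * H 𝟙) (sym H𝟘≡) ⟩
      H 𝟘 + q-1 * H 𝟙                    ≡⟨ sym (∑-const-off-𝟘 H (H 𝟙) H-const) ⟩
      ∑ H                                ≡⟨ ∑H≡0 ⟩
      0#                                 ∎))

    H≡ : ∀ w → H w ≡ δ 𝟘 w * (q-1 * u * q) + - (q-1 * u)
    H≡ w with 𝟘 ≟ w
    ... | yes refl = trans H𝟘≡ (solve 2 (λ q u → (q :- :1) :* ((q :- :1) :* u)
            := :1 :* ((q :- :1) :* u :* q) :+ (:- ((q :- :1) :* u))) refl q u)
    ... | no 0≢w   = trans (H-const w (0≢w ∘ sym)) (trans H𝟙≡
            (solve 2 (λ a b → a := :0 :* b :+ a) refl (- (q-1 * u)) (q-1 * u * q)))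

    -- Opening the square and translating z by y turns the sum over z into an autocorrelation at y -
    -- y′, and the sum over c then gives `H`. The constant part of `H` disappears because `f₀` has
    -- sum 0, so only y = y′ contributes.
    ∑∑T²≡ : ∑ (λ z → ∑ (λ c → T c z * T c z)) ≡ q-1 * u * q * (q-1 * u)
    ∑∑T²≡ = begin
      ∑ (λ z → ∑ (λ c → T c z * T c z))
        ≡⟨ ∑-cong (λ z → ∑-cong (λ c → sym (∑-product _ _))) ⟩
      ∑ (λ z → ∑ (λ c → ∑ (λ y → ∑ (λ y′ → (f₀ (c ⊗ (z ⊖ y)) * f₀ y) * (f₀ (c ⊗ (z ⊖ y′)) * f₀ y′)))))
        ≡⟨ ∑-comm _ ⟩
      ∑ (λ c → ∑ (λ z → ∑ (λ y → ∑ (λ y′ → (f₀ (c ⊗ (z ⊖ y)) * f₀ y) * (f₀ (c ⊗ (z ⊖ y′)) * f₀ y′)))))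
        ≡⟨ ∑-cong (λ c → trans (∑-comm _) (∑-cong (λ y → ∑-comm _))) ⟩
      ∑ (λ c → ∑ (λ y → ∑ (λ y′ → ∑ (λ z → (f₀ (c ⊗ (z ⊖ y)) * f₀ y) * (f₀ (c ⊗ (z ⊖ y′)) * f₀ y′)))))
        ≡⟨ ∑-cong (λ c → ∑-cong (λ y → ∑-cong (λ y′ → inner c y y′))) ⟩
      ∑ (λ c → ∑ (λ y → ∑ (λ y′ → f₀ y * f₀ y′ * G c (y ⊖ y′))))
        ≡⟨ trans (∑-comm _) (∑-cong (λ y → trans (∑-comm _) (∑-cong (λ y′ → ∑-*ˡ (f₀ y * f₀ y′) _)))) ⟩
      ∑ (λ y → ∑ (λ y′ → f₀ y * f₀ y′ * H (y ⊖ y′)))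
        ≡⟨ ∑-cong (λ y → ∑-cong (λ y′ → expand y y′)) ⟩
      ∑ (λ y → ∑ (λ y′ → δ y y′ * (f₀ y * f₀ y′ * (q-1 * u * q)) + (f₀ y * - (q-1 * u)) * f₀ y′))
        ≡⟨ ∑-cong (λ y → ∑-+ _ _) ⟩
      ∑ (λ y → ∑ (λ y′ → δ y y′ * (f₀ y * f₀ y′ * (q-1 * u * q))) + ∑ (λ y′ → (f₀ y * - (q-1 * u)) * f₀ y′))
        ≡⟨ ∑-cong (λ y → cong₂ _+_ (∑-δ y (λ y′ → f₀ y * f₀ y′ * (q-1 * u * q)))
             (trans (∑-*ˡ _ f₀) (trans (cong ((f₀ y * - (q-1 * u)) *_) ∑f₀≡0) (zeroʳ _)))) ⟩
      ∑ (λ y → f₀ y * f₀ y * (q-1 * u * q) + 0#)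
        ≡⟨ ∑-cong (λ y → +-identityʳ _) ⟩
      ∑ (λ y → f₀ y * f₀ y * (q-1 * u * q))
        ≡⟨ trans (∑-*ʳ _ _) (trans (cong (_* (q-1 * u * q)) ∑f₀²≡) (*-comm _ _)) ⟩
      q-1 * u * q * (q-1 * u) ∎
      where
      inner : ∀ c y y′ → ∑ (λ z → (f₀ (c ⊗ (z ⊖ y)) * f₀ y) * (f₀ (c ⊗ (z ⊖ y′)) * f₀ y′))
        ≡ f₀ y * f₀ y′ * G c (y ⊖ y′)
      inner c y y′ = begin
        ∑ (λ z → (f₀ (c ⊗ (z ⊖ y)) * f₀ y) * (f₀ (c ⊗ (z ⊖ y′)) * f₀ y′))
          ≡⟨ sym (∑-translate y _) ⟩
        ∑ (λ z → (f₀ (c ⊗ (z ⊕ y ⊖ y)) * f₀ y) * (f₀ (c ⊗ (z ⊕ y ⊖ y′)) * f₀ y′))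
          ≡⟨ ∑-cong (λ z → trans (cong₂ (λ s t → (f₀ (c ⊗ s) * f₀ y) * (f₀ (c ⊗ t) * f₀ y′))
               (F.solve 2 (λ z y → z F.:+ y F.:- y F.:= z) refl z y)
               (F.solve 3 (λ z y y′ → z F.:+ y F.:- y′ F.:= z F.:+ (y F.:- y′)) refl z y y′))
             (solve 4 (λ a b c d → (a :* b) :* (c :* d) := b :* d :* (a :* c)) refl
               (f₀ (c ⊗ z)) (f₀ y) (f₀ (c ⊗ (z ⊕ (y ⊖ y′)))) (f₀ y′))) ⟩
        ∑ (λ z → f₀ y * f₀ y′ * (f₀ (c ⊗ z) * f₀ (c ⊗ (z ⊕ (y ⊖ y′)))))
          ≡⟨ ∑-*ˡ _ _ ⟩
        f₀ y * f₀ y′ * G c (y ⊖ y′) ∎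
      expand : ∀ y y′ → f₀ y * f₀ y′ * H (y ⊖ y′)
        ≡ δ y y′ * (f₀ y * f₀ y′ * (q-1 * u * q)) + (f₀ y * - (q-1 * u)) * f₀ y′
      expand y y′ = trans (cong (f₀ y * f₀ y′ *_) (trans (H≡ (y ⊖ y′))
          (cong (λ t → t * (q-1 * u * q) + - (q-1 * u))
            (δ-⇔ (λ 0≡ → F.x-y≡0⇒x≡y (sym 0≡)) (λ eq → sym (F.x≡y⇒x-y≡0 eq))))))
        (solve 5 (λ a b d s t → a :* b :* (d :* s :+ t) := d :* (a :* b :* s) :+ (a :* t) :* b) refl
          (f₀ y) (f₀ y′) (δ y y′) (q-1 * u * q) (- (q-1 * u)))

    -- Cauchy-Schwarz in c for each z, summed over z. This is exactly what |f̂₀|² ≤ u² q would yield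
    -- through Parseval.
    ∑N₀²≤ : ∑ (λ z → N₀ z * N₀ z) ≤ q-1 * (u * u * u * q)
    ∑N₀²≤ = cancel-≤ (cancel-≤ (≤-trans (≤-reflexive lhs) (≤-trans (∑-mono pointwise) (≤-reflexive rhs))))
      where
      pointwise : ∀ z → (q-1 * N₀ z) * (q-1 * N₀ z) ≤ (q-1 * u) * ∑ (λ c → T c z * T c z)
      pointwise z = ≤-trans (≤-reflexive (cong (λ t → t * t) (sym (T-evaluation z))))
        (≤-trans (cauchy-schwarz f₀ (λ c → T c z)) (≤-reflexive (cong (_* ∑ (λ c → T c z * T c z)) ∑f₀²≡)))
      lhs : q-1 * (q-1 * ∑ (λ z → N₀ z * N₀ z)) ≡ ∑ (λ z → (q-1 * N₀ z) * (q-1 * N₀ z))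
      lhs = sym (trans (∑-cong (λ z → solve 2 (λ a n → (a :* n) :* (a :* n) := a :* a :* (n :* n)) refl q-1 (N₀ z)))
        (trans (∑-*ˡ _ _) (*-assoc q-1 q-1 _)))
      rhs : ∑ (λ z → (q-1 * u) * ∑ (λ c → T c z * T c z)) ≡ q-1 * (q-1 * (q-1 * (u * u * u * q)))
      rhs = trans (∑-*ˡ _ _) (trans (cong ((q-1 * u) *_) ∑∑T²≡)
        (solve 3 (λ a u q → a :* u :* (a :* u :* q :* (a :* u)) := a :* (a :* (a :* (u :* u :* u :* q)))) refl q-1 u q))

    -- Equal to u if -1 is a k-th power and to -1 otherwise. It enters because N₀ at 0 correlates
    -- `f₀` with its reflection.
    e : Carrier
    e = f₀ (⊝ 𝟙)

    ⊖-scale : ∀ a b → ⊝ (a ⊗ b) ≡ a ⊗ ⊝ b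
    ⊖-scale a b = F.-‿distribʳ-* a b

    N₀𝟘≡ : N₀ 𝟘 ≡ q-1 * e
    N₀𝟘≡ = trans (∑-cong (λ y → trans (cong (λ t → f₀ t * f₀ y) (F.+-identityˡ (⊝ y))) (*-comm _ _)))
      (f₀-evaluation (λ y → f₀ (⊝ y))
        (λ {w} w≢0 → trans (cong f₀ (trans (cong ⊝_ (sym (F.*-identityʳ (w ^ k)))) (⊖-scale (w ^ k) 𝟙))) (f₀-invariant w≢0 (⊝ 𝟙)))
        (trans (∑-cong (λ y → cong f₀ (sym (F.+-identityˡ (⊝ y)))))
          (trans (∑-reflect 𝟘 f₀) (trans ∑f₀≡0 (sym (trans (cong f₀ F.-0#≈0#) f₀𝟘≡0))))))

    ∑N₀≡0 : ∑ N₀ ≡ 0#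
    ∑N₀≡0 = trans (∑-comm _) (∑-zero (λ y → trans (∑-*ʳ (f₀ y) _) (trans (cong (_* f₀ y)
      (trans (∑-translate (⊝ y) f₀) ∑f₀≡0)) (zeroˡ _))))

    N₀-invariant : ∀ {w} → w ≢ 𝟘 → ∀ z → N₀ (w ^ k ⊗ z) ≡ N₀ z
    N₀-invariant {w} w≢0 z = begin
      ∑ (λ y → f₀ (w ^ k ⊗ z ⊖ y) * f₀ y)                    ≡⟨ sym (∑-scale (x^n≢0 k w≢0) _) ⟩
      ∑ (λ y → f₀ (w ^ k ⊗ z ⊖ w ^ k ⊗ y) * f₀ (w ^ k ⊗ y))
        ≡⟨ ∑-cong (λ y → cong₂ _*_
             (trans (cong f₀ (F.solve 3 (λ a z y → a F.:* z F.:- a F.:* y F.:= a F.:* (z F.:- y)) refl (w ^ k) z y))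
               (f₀-invariant w≢0 (z ⊖ y)))
             (f₀-invariant w≢0 y)) ⟩
      ∑ (λ y → f₀ (z ⊖ y) * f₀ y)                            ∎

    -- N₀ corrected to have mean 0 on F∖{0} and to vanish at 0.
    M : F → Carrier
    M z = N₀ z + e + δ 𝟘 z * - (q * e)

    M𝟘≡0 : M 𝟘 ≡ 0#
    M𝟘≡0 = trans (cong₂ (λ s t → s + e + t * - (q * e)) N₀𝟘≡ (δ-≡ {𝟘} refl))
      (solve 2 (λ q e → (q :- :1) :* e :+ e :+ :1 :* (:- (q :* e)) := :0) refl q e)

    M≡ : ∀ {z} → z ≢ 𝟘 → M z ≡ N₀ z + e
    M≡ {z} z≢0 = trans (cong (λ t → N₀ z + e + t * - (q * e)) (δ-≢ (z≢0 ∘ sym)))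
      (solve 2 (λ a b → a :+ :0 :* b := a) refl (N₀ z + e) (- (q * e)))

    ∑M≡0 : ∑ M ≡ 0#
    ∑M≡0 = begin
      ∑ M                              ≡⟨ ∑-+₃ N₀ (λ _ → e) (λ z → δ 𝟘 z * - (q * e)) ⟩
      ∑ N₀ + ∑ (λ _ → e) + ∑ (λ z → δ 𝟘 z * - (q * e))
        ≡⟨ cong₂ _+_ (cong₂ _+_ ∑N₀≡0 (∑-const e)) (∑-δ 𝟘 (λ _ → - (q * e))) ⟩
      0# + q * e + - (q * e)           ≡⟨ solve 1 (λ a → :0 :+ a :+ (:- a) := :0) refl (q * e) ⟩
      0#                               ∎

    -- The correction saves the amount (q - 1) q e² that `N₀` spends on its value at 0 and on its
    -- mean elsewhere. In the case e = u this saving is what keeps the threshold at (k - 1)⁴.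
    ∑M²≡ : ∑ (λ z → M z * M z) ≡ ∑ (λ z → N₀ z * N₀ z) + q-1 * - (q * (e * e))
    ∑M²≡ = begin
      ∑ (λ z → M z * M z)              ≡⟨ ∑-cong pointwise ⟩
      ∑ (λ z → N₀ z * N₀ z + (e + e) * N₀ z + (e * e + δ 𝟘 z * - (q * e * (q * e))))
        ≡⟨ ∑-+₃ _ _ _ ⟩
      ∑ (λ z → N₀ z * N₀ z) + ∑ (λ z → (e + e) * N₀ z) + ∑ (λ z → e * e + δ 𝟘 z * - (q * e * (q * e)))
        ≡⟨ cong₂ (λ s t → ∑ (λ z → N₀ z * N₀ z) + s + t)
             (trans (∑-*ˡ (e + e) N₀) (trans (cong ((e + e) *_) ∑N₀≡0) (zeroʳ _)))
             (trans (∑-+ _ _) (cong₂ _+_ (∑-const (e * e)) (∑-δ 𝟘 (λ _ → - (q * e * (q * e)))))) ⟩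
      ∑ (λ z → N₀ z * N₀ z) + 0# + (q * (e * e) + - (q * e * (q * e)))
        ≡⟨ solve 3 (λ n q e → n :+ :0 :+ (q :* (e :* e) :+ (:- (q :* e :* (q :* e))))
             := n :+ (q :- :1) :* (:- (q :* (e :* e)))) refl (∑ (λ z → N₀ z * N₀ z)) q e ⟩
      ∑ (λ z → N₀ z * N₀ z) + q-1 * - (q * (e * e)) ∎
      where
      pointwise : ∀ z → M z * M z ≡ N₀ z * N₀ z + (e + e) * N₀ z + (e * e + δ 𝟘 z * - (q * e * (q * e)))
      pointwise z with z ≟ 𝟘
      ... | no z≢0 = trans (cong (λ t → t * t) (M≡ z≢0))
              (trans (solve 3 (λ n e s → (n :+ e) :* (n :+ e) := n :* n :+ (e :+ e) :* n :+ (e :* e :+ :0 :* s))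
                        refl (N₀ z) e (- (q * e * (q * e))))
                (cong (λ d → N₀ z * N₀ z + (e + e) * N₀ z + (e * e + d * - (q * e * (q * e)))) (sym (δ-≢ (z≢0 ∘ sym)))))
      ... | yes refl = begin
        M 𝟘 * M 𝟘    ≡⟨ cong (λ t → t * t) M𝟘≡0 ⟩
        0# * 0#      ≡⟨ solve 2 (λ q e → :0 :* :0
              := ((q :- :1) :* e) :* ((q :- :1) :* e) :+ (e :+ e) :* ((q :- :1) :* e)
                  :+ (e :* e :+ :1 :* (:- (q :* e :* (q :* e))))) refl q e ⟩
        (q-1 * e) * (q-1 * e) + (e + e) * (q-1 * e) + (e * e + 1# * - (q * e * (q * e)))
          ≡⟨ cong₂ (λ n d → n * n + (e + e) * n + (e * e + d * - (q * e * (q * e)))) (sym N₀𝟘≡) (sym (δ-≡ {𝟘} refl)) ⟩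
        N₀ 𝟘 * N₀ 𝟘 + (e + e) * N₀ 𝟘 + (e * e + δ 𝟘 𝟘 * - (q * e * (q * e))) ∎

    0≤u : 0# ≤ u
    0≤u = cancel-≤ (≤-trans (≤-reflexive (zeroʳ q-1)) (≤-trans (∑-nonneg (λ c → 0≤x*x (f₀ c))) (≤-reflexive ∑f₀²≡)))

    0≤* : ∀ {x y} → 0# ≤ x → 0# ≤ y → 0# ≤ x * y
    0≤* {x} 0≤x 0≤y = ≤-trans (≤-reflexive (sym (zeroʳ x))) (*-monoˡ-≤ 0≤x 0≤y)

    -- From the mean square to a single value: `N₀` is constant on b times the nonzero k-th powers,
    -- so pairing c ↦ M (b c) with `f₀` isolates its value at b. `M` rather than `N₀` is paired
    -- because it satisfies the hypotheses of `f₀-evaluation`.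
    N₀-bound : ∀ {b} → b ≢ 𝟘 → (N₀ b + e) * (N₀ b + e) ≤ u * (q * (u * u * u - e * e))
    N₀-bound {b} b≢0 = cancel-≤ (cancel-≤ (≤-trans (≤-reflexive lhs)
        (≤-trans (cauchy-schwarz f₀ (λ c → M (b ⊗ c)))
        (≤-trans (≤-reflexive (cong₂ _*_ ∑f₀²≡ (∑-scale b≢0 (λ c → M c * M c))))
        (≤-trans (*-monoˡ-≤ (0≤* 0≤q-1 0≤u) ∑M²≤) (≤-reflexive rhs))))))
      where
      ∑M²≤ : ∑ (λ z → M z * M z) ≤ q-1 * (u * u * u * q) + q-1 * - (q * (e * e))
      ∑M²≤ = ≤-trans (≤-reflexive ∑M²≡) (+-mono-≤ ∑N₀²≤ ≤-refl)
      evaluation : ∑ (λ c → f₀ c * M (b ⊗ c)) ≡ q-1 * (N₀ b + e)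
      evaluation = trans (f₀-evaluation (λ c → M (b ⊗ c))
          (λ {w} w≢0 → begin
            M (b ⊗ w ^ k)        ≡⟨ M≡ (x*y≢0 b≢0 (x^n≢0 k w≢0)) ⟩
            N₀ (b ⊗ w ^ k) + e   ≡⟨ cong (_+ e) (trans (cong N₀ (F.*-comm b (w ^ k))) (N₀-invariant w≢0 b)) ⟩
            N₀ b + e             ≡⟨ sym (M≡ b≢0) ⟩
            M b                  ≡⟨ cong M (sym (F.*-identityʳ b)) ⟩
            M (b ⊗ 𝟙)            ∎)
          (trans (∑-scale b≢0 M) (trans ∑M≡0 (sym (trans (cong M (F.zeroʳ b)) M𝟘≡0)))))
        (cong (q-1 *_) (trans (cong M (F.*-identityʳ b)) (M≡ b≢0)))
      lhs : q-1 * (q-1 * ((N₀ b + e) * (N₀ b + e))) ≡ ∑ (λ c → f₀ c * M (b ⊗ c)) * ∑ (λ c → f₀ c * M (b ⊗ c))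
      lhs = trans (solve 2 (λ a n → a :* (a :* (n :* n)) := (a :* n) :* (a :* n)) refl q-1 (N₀ b + e))
        (sym (cong (λ t → t * t) evaluation))
      rhs : (q-1 * u) * (q-1 * (u * u * u * q) + q-1 * - (q * (e * e))) ≡ q-1 * (q-1 * (u * (q * (u * u * u - e * e))))
      rhs = solve 4 (λ a u q e → (a :* u) :* (a :* (u :* u :* u :* q) :+ a :* (:- (q :* (e :* e))))
        := a :* (a :* (u :* (q :* (u :* u :* u :- e :* e))))) refl q-1 u q e

-- Integer inequalities

module IntegerOrder where
  open import Data.Integer using (+_; -[1+_])

  ℤ-ordered : OrderedRing
  ℤ-ordered = record
    { cring = record { isCommutativeRing = ℤₚ.+-*-isCommutativeRing }
    ; _≤_ = ℤ._≤_ ; ≤-refl = ℤₚ.≤-refl ; ≤-trans = ℤₚ.≤-trans ; +-mono-≤ = ℤₚ.+-mono-≤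
    ; *-monoˡ-≤ = λ { {+ n} {x} {y} _ x≤y → ℤₚ.*-monoˡ-≤-nonNeg (+ n) x≤y }
    ; 0≤x*x = 0≤i*i
    ; 0≤x+x⇒0≤x = λ { {+ n} _ → ℤ.+≤+ z≤n } }
    where
    0≤i*i : ∀ i → + 0 ℤ.≤ i ℤ.* i
    0≤i*i (+ n) = subst (+ 0 ℤ.≤_) (ℤₚ.pos-* n n) (ℤ.+≤+ z≤n)
    0≤i*i -[1+ n ] = ℤ.+≤+ z≤n

  i*j≢0⇒i≢0 : ∀ i j → i ℤ.* j ≢ + 0 → i ≢ + 0
  i*j≢0⇒i≢0 i j ij≢0 i≡0 = ij≢0 (cong (ℤ._* j) i≡0)

  i*j≢0⇒j≢0 : ∀ i j → i ℤ.* j ≢ + 0 → j ≢ + 0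
  i*j≢0⇒j≢0 i j ij≢0 j≡0 = ij≢0 (trans (cong (i ℤ.*_) j≡0) (ℤₚ.*-zeroʳ i))

open IntegerOrder

2v≤v³+1 : ∀ v → 2 ℕ.* v ℕ.≤ v ℕ.* v ℕ.* v ℕ.+ 1
2v≤v³+1 zero = z≤n
2v≤v³+1 (suc w) = subst (2 ℕ.* suc w ℕ.≤_) (identity w) (ℕₚ.m≤m+n (2 ℕ.* suc w) _)
  where
  identity : ∀ w → 2 ℕ.* suc w ℕ.+ (w ℕ.* w ℕ.* w ℕ.+ 3 ℕ.* w ℕ.* w ℕ.+ w) ≡ suc w ℕ.* suc w ℕ.* suc w ℕ.+ 1
  identity = ℕ-Solver.solve-∀

-- (Q - s)² ≤ (v⁴ - v³) Q is impossible, with both sides moved so that no subtraction occurs.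
square-gap : ∀ Q v s → v ℕ.≤ s → v ℕ.* v ℕ.* v ℕ.* v ℕ.+ 1 ℕ.+ 2 ℕ.* s ℕ.≤ Q ℕ.+ 2 ℕ.* v →
  ¬ (Q ℕ.* Q ℕ.+ s ℕ.* s ℕ.+ v ℕ.* v ℕ.* v ℕ.* Q ℕ.≤ v ℕ.* v ℕ.* v ℕ.* v ℕ.* Q ℕ.+ 2 ℕ.* s ℕ.* Q)
square-gap Q v s v≤s large small = contradiction Q≤0 (ℕₚ.<⇒≱ 0<Q)
  where
  V³ = v ℕ.* v ℕ.* v
  V⁴ = V³ ℕ.* v
  -- Q times `large` combined with `small` leaves s² + (v³ + 1 - 2v) Q ≤ 0. Then s = 0, so v = 0 by
  -- v ≤ s, and `small` reads Q² ≤ 0 while `large` reads 1 ≤ Q.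
  s²≤0 : s ℕ.* s ℕ.≤ 0
  s²≤0 = ℕₚ.+-cancelʳ-≤ (V³ ℕ.* Q ℕ.+ Q ℕ.+ (V⁴ ℕ.* Q ℕ.+ 2 ℕ.* s ℕ.* Q)) _ _ (begin
    s ℕ.* s ℕ.+ (V³ ℕ.* Q ℕ.+ Q ℕ.+ (V⁴ ℕ.* Q ℕ.+ 2 ℕ.* s ℕ.* Q))
      ≡⟨ shuffle₁ V³ V⁴ Q s ⟩
    (V⁴ ℕ.+ 1 ℕ.+ 2 ℕ.* s) ℕ.* Q ℕ.+ (s ℕ.* s ℕ.+ V³ ℕ.* Q)
      ≤⟨ ℕₚ.+-monoˡ-≤ _ (ℕₚ.*-monoˡ-≤ Q large) ⟩
    (Q ℕ.+ 2 ℕ.* v) ℕ.* Q ℕ.+ (s ℕ.* s ℕ.+ V³ ℕ.* Q)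
      ≡⟨ shuffle₂ V³ Q s v ⟩
    (Q ℕ.* Q ℕ.+ s ℕ.* s ℕ.+ V³ ℕ.* Q) ℕ.+ 2 ℕ.* v ℕ.* Q
      ≤⟨ ℕₚ.+-mono-≤ small (ℕₚ.*-monoˡ-≤ Q (2v≤v³+1 v)) ⟩
    (V⁴ ℕ.* Q ℕ.+ 2 ℕ.* s ℕ.* Q) ℕ.+ (V³ ℕ.+ 1) ℕ.* Q
      ≡⟨ shuffle₃ V³ V⁴ Q s ⟩
    0 ℕ.+ (V³ ℕ.* Q ℕ.+ Q ℕ.+ (V⁴ ℕ.* Q ℕ.+ 2 ℕ.* s ℕ.* Q)) ∎)
    where
    open ℕₚ.≤-Reasoning
    shuffle₁ : ∀ a b q s → s ℕ.* s ℕ.+ (a ℕ.* q ℕ.+ q ℕ.+ (b ℕ.* q ℕ.+ 2 ℕ.* s ℕ.* q))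
      ≡ (b ℕ.+ 1 ℕ.+ 2 ℕ.* s) ℕ.* q ℕ.+ (s ℕ.* s ℕ.+ a ℕ.* q)
    shuffle₁ = ℕ-Solver.solve-∀
    shuffle₂ : ∀ a q s v → (q ℕ.+ 2 ℕ.* v) ℕ.* q ℕ.+ (s ℕ.* s ℕ.+ a ℕ.* q)
      ≡ (q ℕ.* q ℕ.+ s ℕ.* s ℕ.+ a ℕ.* q) ℕ.+ 2 ℕ.* v ℕ.* q
    shuffle₂ = ℕ-Solver.solve-∀
    shuffle₃ : ∀ a b q s → (b ℕ.* q ℕ.+ 2 ℕ.* s ℕ.* q) ℕ.+ (a ℕ.+ 1) ℕ.* q
      ≡ 0 ℕ.+ (a ℕ.* q ℕ.+ q ℕ.+ (b ℕ.* q ℕ.+ 2 ℕ.* s ℕ.* q))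
    shuffle₃ = ℕ-Solver.solve-∀
  s≡0 : s ≡ 0
  s≡0 with ℕₚ.m*n≡0⇒m≡0∨n≡0 s (ℕₚ.n≤0⇒n≡0 s²≤0)
  ... | inj₁ eq = eq
  ... | inj₂ eq = eq
  v≡0 : v ≡ 0
  v≡0 = ℕₚ.n≤0⇒n≡0 (subst (v ℕ.≤_) s≡0 v≤s)
  large′ : 1 ℕ.≤ Q ℕ.+ 0
  large′ = at-zero s≡0 v≡0 large
    where
    at-zero : s ≡ 0 → v ≡ 0 → V⁴ ℕ.+ 1 ℕ.+ 2 ℕ.* s ℕ.≤ Q ℕ.+ 2 ℕ.* v → 1 ℕ.≤ Q ℕ.+ 0
    at-zero refl refl le = le
  0<Q : 0 ℕ.< Q
  0<Q = subst (1 ℕ.≤_) (ℕₚ.+-identityʳ Q) large′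
  Q²≤0 : s ≡ 0 → v ≡ 0 → Q ℕ.* Q ℕ.≤ 0
  Q²≤0 refl refl = subst (ℕ._≤ 0) (trans (ℕₚ.+-identityʳ _) (ℕₚ.+-identityʳ _)) small
  Q≤0 : Q ℕ.≤ 0
  Q≤0 = ℕₚ.≤-trans (ℕₚ.m≤m*n Q Q {{ℕ.>-nonZero 0<Q}}) (Q²≤0 s≡0 v≡0)

-- The origin of 4k: for W = 2m solutions s is 2m + v, and 2s - 2v = 4m ≤ 4k.
gap-margin : ∀ {V a v m k Q} → V ℕ.≤ a → m ℕ.≤ suc v → suc v ℕ.≤ k → a ℕ.+ 4 ℕ.* k ℕ.< Q →
  V ℕ.+ 1 ℕ.+ 2 ℕ.* (m ℕ.+ m ℕ.+ v) ℕ.≤ Q ℕ.+ 2 ℕ.* v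
gap-margin {V} {a} {v} {m} {k} {Q} V≤a m≤v+1 v<k large = begin
  V ℕ.+ 1 ℕ.+ 2 ℕ.* (m ℕ.+ m ℕ.+ v)
    ≤⟨ ℕₚ.+-mono-≤ (ℕₚ.+-monoˡ-≤ 1 V≤a) (ℕₚ.*-monoʳ-≤ 2 (ℕₚ.+-monoˡ-≤ v (ℕₚ.+-mono-≤ m≤v+1 m≤v+1))) ⟩
  a ℕ.+ 1 ℕ.+ 2 ℕ.* (suc v ℕ.+ suc v ℕ.+ v)  ≡⟨ shuffle a v ⟩
  suc (a ℕ.+ 4 ℕ.* suc v) ℕ.+ 2 ℕ.* v        ≤⟨ ℕₚ.+-monoˡ-≤ (2 ℕ.* v) (s≤s (ℕₚ.+-monoʳ-≤ a (ℕₚ.*-monoʳ-≤ 4 v<k))) ⟩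
  suc (a ℕ.+ 4 ℕ.* k) ℕ.+ 2 ℕ.* v            ≤⟨ ℕₚ.+-monoˡ-≤ (2 ℕ.* v) large ⟩
  Q ℕ.+ 2 ℕ.* v                              ∎
  where
  open ℕₚ.≤-Reasoning
  shuffle : ∀ a v → a ℕ.+ 1 ℕ.+ 2 ℕ.* (suc v ℕ.+ suc v ℕ.+ v) ≡ suc (a ℕ.+ 4 ℕ.* suc v) ℕ.+ 2 ℕ.* v
  shuffle = ℕ-Solver.solve-∀

-- Sums of two k-th powers in a finite field

module SumsOfTwoPowers (R : FiniteRing) (isField : FiniteRing.IsField R)
  (k : ℕ) (1≤k : 1 ℕ.≤ k) where

  open import Data.Integer using (+_; -[1+_])
  open FiniteRing R using (size; _^_; _≟_; element; index)
    renaming (Carrier to F; 0# to 𝟘; 1# to 𝟙; _+_ to _⊕_; _*_ to _⊗_; _-_ to _⊖_; -_ to ⊝_)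
  private module F = FiniteRing R
  open F.IsField isField
  open OrderedRing ℤ-ordered using (_·_)
  open FiniteSum R ℤ-ordered
  open PowerCount R isField ℤ-ordered k 1≤k
  open ≡-Reasoning

  ·1≡+ : ∀ n → n · + 1 ≡ + n
  ·1≡+ zero    = refl
  ·1≡+ (suc n) = cong (λ t → + 1 ℤ.+ t) (·1≡+ n)

  1<size : 1 ℕ.< size
  1<size = Finₚ.injective⇒≤ {f = index ∘ pair} (pair-injective ∘ index-injective)
    where
    pair : Fin 2 → F
    pair zero    = 𝟘
    pair (suc _) = 𝟙
    pair-injective : ∀ {i j} → pair i ≡ pair j → i ≡ j
    pair-injective {zero}     {zero}     _  = refl
    pair-injective {zero}     {suc zero} eq = contradiction (sym eq) 1≢0
    pair-injective {suc zero} {zero}     eq = contradiction eq 1≢0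
    pair-injective {suc zero} {suc zero} _  = refl
    index-injective : ∀ {x y} → index x ≡ index y → x ≡ y
    index-injective eq = trans (sym (F.element-index _)) (trans (cong element eq) (F.element-index _))

  q≡ : q ≡ + size
  q≡ = ·1≡+ size

  q-1≡ : Σ ℕ λ s → q-1 ≡ + suc s
  q-1≡ = size ℕ.∸ 2 , cong (ℤ._- + 1) (trans q≡ (cong +_ (sym (ℕₚ.m+[n∸m]≡n 1<size))))

  q-1-cancel-≡0 : ∀ {x} → q-1 ℤ.* x ≡ + 0 → x ≡ + 0
  q-1-cancel-≡0 {x} eq with ℤₚ.i*j≡0⇒i≡0∨j≡0 q-1 eq
  ... | inj₁ q-1≡0 = contradiction (trans (sym (proj₂ q-1≡)) q-1≡0) λ ()
  ... | inj₂ x≡0   = x≡0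

  open Bound
    (λ {x} {y} le → ℤₚ.*-cancelˡ-≤-pos x y (+ suc (proj₁ q-1≡))
      (subst (λ t → t ℤ.* x ℤ.≤ t ℤ.* y) (proj₂ q-1≡) le))
    q-1-cancel-≡0
    (subst (+ 0 ℤ.≤_) (sym (proj₂ q-1≡)) (ℤ.+≤+ z≤n))

  ∑≢0⇒∃≢0 : ∀ (g : F → ℤ) → ∑ g ≢ + 0 → ∃ λ x → g x ≢ + 0
  ∑≢0⇒∃≢0 g ∑≢0 with F.any? (λ x → ¬? (g x ℤₚ.≟ + 0))
  ... | yes found = found
  ... | no none   = contradiction (∑-zero (λ x → decidable-stable (g x ℤₚ.≟ + 0) (λ ≢0 → none (x , ≢0)))) ∑≢0

  δ≢0⇒≡ : ∀ {a x} → δ a x ≢ + 0 → a ≡ x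
  δ≢0⇒≡ {a} {x} δ≢0 with a ≟ x
  ... | yes a≡x = a≡x
  ... | no _    = contradiction refl δ≢0

  f≢0⇒power : ∀ {b} → f b ≢ + 0 → ∃ λ x → x ^ k ≡ b
  f≢0⇒power fb≢0 with ∑≢0⇒∃≢0 _ fb≢0
  ... | x , δ≢0 = x , δ≢0⇒≡ δ≢0

  f-power : ∀ {w} → w ≢ 𝟘 → f (w ^ k) ≡ f 𝟙
  f-power {w} w≢0 = trans (sym (w^k*𝟙 f w)) (f-invariant w≢0 𝟙)

  #roots : Σ ℕ λ m → m ℕ.≤ k × f 𝟙 ≡ + m
  #roots with ∑-count (λ x → δ (x ^ k) 𝟙) δ-values
    where
    δ-values : ∀ x → δ (x ^ k) 𝟙 ≡ + 0 ⊎ δ (x ^ k) 𝟙 ≡ + 1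
    δ-values x with x ^ k ≟ 𝟙
    ... | yes _ = inj₂ refl
    ... | no _  = inj₁ refl
  ... | m , ι , inj , one , eq = m
    , Polynomial.#roots-of-unity R isField 1≤k ι inj
        (λ j → δ≢0⇒≡ (λ δ≡0 → contradiction (trans (sym (one j)) δ≡0) λ ()))
    , trans eq (·1≡+ m)

  u≡ : Σ ℕ λ v → suc v ℕ.≤ k × u ≡ + v × f 𝟙 ≡ + suc v
  u≡ with #roots
  ... | zero , _ , f𝟙≡ = contradiction (subst (+ 0 ℤ.≤_) (cong (ℤ._- + 1) f𝟙≡) 0≤u) λ ()
  ... | suc v , v<k , f𝟙≡ = v , v<k , cong (ℤ._- + 1) f𝟙≡ , f𝟙≡

  N : F → ℤ
  N b = ∑ (λ y → f (b ⊖ y) ℤ.* f y)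

  N≡ : ∀ b → N b ≡ N₀ b ℤ.+ + size
  N≡ b = begin
    ∑ (λ y → f (b ⊖ y) ℤ.* f y)                         ≡⟨ ∑-cong (λ y → expand (f (b ⊖ y)) (f y)) ⟩
    ∑ (λ y → f₀ (b ⊖ y) ℤ.* f₀ y ℤ.+ (f₀ (b ⊖ y) ℤ.+ f₀ y) ℤ.+ + 1)  ≡⟨ ∑-+₃ _ _ _ ⟩
    N₀ b ℤ.+ ∑ (λ y → f₀ (b ⊖ y) ℤ.+ f₀ y) ℤ.+ ∑ (λ _ → + 1)
      ≡⟨ cong₂ (λ s t → N₀ b ℤ.+ s ℤ.+ t)
           (trans (∑-+ (λ y → f₀ (b ⊖ y)) f₀) (cong₂ ℤ._+_ (trans (∑-reflect b f₀) ∑f₀≡0) ∑f₀≡0))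
           (trans (∑-const (+ 1)) (trans (ℤₚ.*-identityʳ q) q≡)) ⟩
    N₀ b ℤ.+ (+ 0 ℤ.+ + 0) ℤ.+ + size                   ≡⟨ cong (ℤ._+ + size) (ℤₚ.+-identityʳ (N₀ b)) ⟩
    N₀ b ℤ.+ + size                                     ∎
    where
    expand : ∀ a b → a ℤ.* b ≡ (a ℤ.- + 1) ℤ.* (b ℤ.- + 1) ℤ.+ ((a ℤ.- + 1) ℤ.+ (b ℤ.- + 1)) ℤ.+ + 1
    expand = ℤ-Solver.solve-∀

  N-bound : ∀ {b} → b ≢ 𝟘 → (N b ℤ.- + size ℤ.+ e) ℤ.* (N b ℤ.- + size ℤ.+ e)
                            ℤ.≤ u ℤ.* (+ size ℤ.* (u ℤ.* u ℤ.* u ℤ.- e ℤ.* e))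
  N-bound {b} b≢0 = subst (λ t → (t ℤ.+ e) ℤ.* (t ℤ.+ e) ℤ.≤ u ℤ.* (+ size ℤ.* (u ℤ.* u ℤ.* u ℤ.- e ℤ.* e)))
    (trans (cancel (N₀ b) (+ size)) (cong (ℤ._- + size) (sym (N≡ b))))
    (subst (λ t → (N₀ b ℤ.+ e) ℤ.* (N₀ b ℤ.+ e) ℤ.≤ u ℤ.* (t ℤ.* (u ℤ.* u ℤ.* u ℤ.- e ℤ.* e))) q≡ (N₀-bound b≢0))
    where
    cancel : ∀ a b → a ≡ a ℤ.+ b ℤ.- b
    cancel = ℤ-Solver.solve-∀

  -1-power? : (∃ λ w → w ^ k ≡ ⊝ 𝟙) ⊎ e ≡ -[1+ 0 ]
  -1-power? with F.any? (λ w → w ^ k ≟ ⊝ 𝟙)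
  ... | yes found = inj₁ found
  ... | no none   = inj₂ (cong (ℤ._- + 1) (∑-zero (λ x → δ-≢ (λ eq → none (x , eq)))))

  -1≢0 : ⊝ 𝟙 ≢ 𝟘
  -1≢0 eq = 1≢0 (trans (sym (F.-‿involutive 𝟙)) (trans (cong ⊝_ eq) F.-0#≈0#))

  power≢0 : ∀ {w b} → w ^ k ≡ b → b ≢ 𝟘 → w ≢ 𝟘
  power≢0 w^k≡b b≢0 refl = b≢0 (trans (sym w^k≡b) (F.0^n≡0 1≤k))

  -1-power⇒e≡u : (∃ λ w → w ^ k ≡ ⊝ 𝟙) → e ≡ u
  -1-power⇒e≡u (w , eq) = cong (ℤ._- + 1) (trans (cong f (sym eq)) (f-power (power≢0 eq -1≢0)))

  -- The bound (Q - s)² ≤ (v⁴ - v³) Q for e = u, with negative terms moved across: the shape that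
  -- `square-gap` refutes.
  N-bound-ℕ : ∀ {b} v W → b ≢ 𝟘 → u ≡ + v → e ≡ u → N b ≡ + W →
    let s = W ℕ.+ v in
    size ℕ.* size ℕ.+ s ℕ.* s ℕ.+ v ℕ.* v ℕ.* v ℕ.* size ℕ.≤ v ℕ.* v ℕ.* v ℕ.* v ℕ.* size ℕ.+ 2 ℕ.* s ℕ.* size
  N-bound-ℕ {b} v W b≢0 u≡v e≡u N≡W = ℤₚ.drop‿+≤+ (subst₂ ℤ._≤_ lhs rhs
      (ℤₚ.+-monoˡ-≤ (+ 2 ℤ.* (W′ ℤ.+ v′) ℤ.* Q′ ℤ.+ v′ ℤ.* v′ ℤ.* v′ ℤ.* Q′) bound))
    where
    W′ = + W
    v′ = + v
    Q′ = + size
    bound : (W′ ℤ.- Q′ ℤ.+ v′) ℤ.* (W′ ℤ.- Q′ ℤ.+ v′) ℤ.≤ v′ ℤ.* (Q′ ℤ.* (v′ ℤ.* v′ ℤ.* v′ ℤ.- v′ ℤ.* v′))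
    bound = subst₂ (λ u e → (W′ ℤ.- Q′ ℤ.+ e) ℤ.* (W′ ℤ.- Q′ ℤ.+ e) ℤ.≤ u ℤ.* (Q′ ℤ.* (u ℤ.* u ℤ.* u ℤ.- e ℤ.* e)))
      u≡v (trans e≡u u≡v) (subst (λ n → (n ℤ.- Q′ ℤ.+ e) ℤ.* (n ℤ.- Q′ ℤ.+ e) ℤ.≤ u ℤ.* (Q′ ℤ.* (u ℤ.* u ℤ.* u ℤ.- e ℤ.* e))) N≡W (N-bound b≢0))
    identity₁ : ∀ w v q → (w ℤ.- q ℤ.+ v) ℤ.* (w ℤ.- q ℤ.+ v) ℤ.+ (+ 2 ℤ.* (w ℤ.+ v) ℤ.* q ℤ.+ v ℤ.* v ℤ.* v ℤ.* q)
      ≡ q ℤ.* q ℤ.+ (w ℤ.+ v) ℤ.* (w ℤ.+ v) ℤ.+ v ℤ.* v ℤ.* v ℤ.* q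
    identity₁ = ℤ-Solver.solve-∀
    identity₂ : ∀ w v q → v ℤ.* (q ℤ.* (v ℤ.* v ℤ.* v ℤ.- v ℤ.* v)) ℤ.+ (+ 2 ℤ.* (w ℤ.+ v) ℤ.* q ℤ.+ v ℤ.* v ℤ.* v ℤ.* q)
      ≡ v ℤ.* v ℤ.* v ℤ.* v ℤ.* q ℤ.+ + 2 ℤ.* (w ℤ.+ v) ℤ.* q
    identity₂ = ℤ-Solver.solve-∀
    +* : ∀ {i j} m n → i ≡ + m → j ≡ + n → i ℤ.* j ≡ + (m ℕ.* n)
    +* m n refl refl = sym (ℤₚ.pos-* m n)
    ++ : ∀ {i j} m n → i ≡ + m → j ≡ + n → i ℤ.+ j ≡ + (m ℕ.+ n)
    ++ m n refl refl = refl
    v³≡ : v′ ℤ.* v′ ℤ.* v′ ≡ + (v ℕ.* v ℕ.* v)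
    v³≡ = +* (v ℕ.* v) v (+* v v refl refl) refl
    v³Q≡ : v′ ℤ.* v′ ℤ.* v′ ℤ.* Q′ ≡ + (v ℕ.* v ℕ.* v ℕ.* size)
    v³Q≡ = +* (v ℕ.* v ℕ.* v) size v³≡ refl
    v⁴Q≡ : v′ ℤ.* v′ ℤ.* v′ ℤ.* v′ ℤ.* Q′ ≡ + (v ℕ.* v ℕ.* v ℕ.* v ℕ.* size)
    v⁴Q≡ = +* (v ℕ.* v ℕ.* v ℕ.* v) size (+* (v ℕ.* v ℕ.* v) v v³≡ refl) refl
    2sQ≡ : + 2 ℤ.* (W′ ℤ.+ v′) ℤ.* Q′ ≡ + (2 ℕ.* (W ℕ.+ v) ℕ.* size)
    2sQ≡ = +* (2 ℕ.* (W ℕ.+ v)) size (+* 2 (W ℕ.+ v) refl refl) refl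
    Q²+s²≡ : Q′ ℤ.* Q′ ℤ.+ (W′ ℤ.+ v′) ℤ.* (W′ ℤ.+ v′) ≡ + (size ℕ.* size ℕ.+ (W ℕ.+ v) ℕ.* (W ℕ.+ v))
    Q²+s²≡ = ++ (size ℕ.* size) ((W ℕ.+ v) ℕ.* (W ℕ.+ v)) (+* size size refl refl) (+* (W ℕ.+ v) (W ℕ.+ v) refl refl)
    lhs : (W′ ℤ.- Q′ ℤ.+ v′) ℤ.* (W′ ℤ.- Q′ ℤ.+ v′) ℤ.+ (+ 2 ℤ.* (W′ ℤ.+ v′) ℤ.* Q′ ℤ.+ v′ ℤ.* v′ ℤ.* v′ ℤ.* Q′)
      ≡ + (size ℕ.* size ℕ.+ (W ℕ.+ v) ℕ.* (W ℕ.+ v) ℕ.+ v ℕ.* v ℕ.* v ℕ.* size)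
    lhs = trans (identity₁ W′ v′ Q′) (++ (size ℕ.* size ℕ.+ (W ℕ.+ v) ℕ.* (W ℕ.+ v)) (v ℕ.* v ℕ.* v ℕ.* size) Q²+s²≡ v³Q≡)
    rhs : v′ ℤ.* (Q′ ℤ.* (v′ ℤ.* v′ ℤ.* v′ ℤ.- v′ ℤ.* v′)) ℤ.+ (+ 2 ℤ.* (W′ ℤ.+ v′) ℤ.* Q′ ℤ.+ v′ ℤ.* v′ ℤ.* v′ ℤ.* Q′)
      ≡ + (v ℕ.* v ℕ.* v ℕ.* v ℕ.* size ℕ.+ 2 ℕ.* (W ℕ.+ v) ℕ.* size)
    rhs = trans (identity₂ W′ v′ Q′) (++ (v ℕ.* v ℕ.* v ℕ.* v ℕ.* size) (2 ℕ.* (W ℕ.+ v) ℕ.* size) v⁴Q≡ 2sQ≡)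

  fourth-power : ∀ {v} → suc v ℕ.≤ k → v ℕ.* v ℕ.* v ℕ.* v ℕ.≤ (k ℕ.∸ 1) ℕ.^ 4
  fourth-power {v} v<k = subst (ℕ._≤ (k ℕ.∸ 1) ℕ.^ 4) (identity v) (ℕₚ.^-monoˡ-≤ 4 (ℕₚ.∸-monoˡ-≤ 1 v<k))
    where
    identity : ∀ v → v ℕ.* (v ℕ.* (v ℕ.* (v ℕ.* 1))) ≡ v ℕ.* v ℕ.* v ℕ.* v
    identity = ℕ-Solver.solve-∀

  -- If -1 is a k-th power, `square-gap` applies with W = 0 and s = v. Otherwise e = -1, and (Q +
  -- 1)² ≤ v⁴ Q - v Q contradicts v⁴ ≤ Q directly.
  N≢0 : (k ℕ.∸ 1) ℕ.^ 4 ℕ.< size → ∀ {b} → b ≢ 𝟘 → N b ≢ + 0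
  N≢0 large {b} b≢0 N≡0 with u≡ | -1-power?
  ... | v , v<k , u≡v , _ | inj₁ -1-power = square-gap size v v ℕₚ.≤-refl
      (ℕₚ.+-monoˡ-≤ (2 ℕ.* v) (ℕₚ.≤-trans (ℕₚ.≤-reflexive (ℕₚ.+-comm _ 1)) (ℕₚ.≤-trans (s≤s (fourth-power v<k)) large)))
      (N-bound-ℕ v 0 b≢0 u≡v (-1-power⇒e≡u -1-power) N≡0)
  ... | v , v<k , u≡v , _ | inj₂ e≡-1 = ℤₚ.<⇒≱ strict bound
    where
    v′ = + v
    Q′ = + size
    bound : (+ 0 ℤ.- Q′ ℤ.+ -[1+ 0 ]) ℤ.* (+ 0 ℤ.- Q′ ℤ.+ -[1+ 0 ]) ℤ.≤ v′ ℤ.* (Q′ ℤ.* (v′ ℤ.* v′ ℤ.* v′ ℤ.- + 1))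
    bound = subst₂ (λ u e → (+ 0 ℤ.- Q′ ℤ.+ e) ℤ.* (+ 0 ℤ.- Q′ ℤ.+ e) ℤ.≤ u ℤ.* (Q′ ℤ.* (u ℤ.* u ℤ.* u ℤ.- e ℤ.* e)))
      u≡v e≡-1 (subst (λ n → (n ℤ.- Q′ ℤ.+ e) ℤ.* (n ℤ.- Q′ ℤ.+ e) ℤ.≤ u ℤ.* (Q′ ℤ.* (u ℤ.* u ℤ.* u ℤ.- e ℤ.* e))) N≡0 (N-bound b≢0))
    v⁴≤Q : v′ ℤ.* v′ ℤ.* v′ ℤ.* v′ ℤ.≤ Q′
    v⁴≤Q = subst (ℤ._≤ Q′) (trans (ℤₚ.pos-* (v ℕ.* v ℕ.* v) v) (cong (ℤ._* v′)
        (trans (ℤₚ.pos-* (v ℕ.* v) v) (cong (ℤ._* v′) (ℤₚ.pos-* v v)))))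
      (ℤ.+≤+ (ℕₚ.≤-trans (fourth-power v<k) (ℕₚ.<⇒≤ large)))
    identity₁ : ∀ q v → v ℤ.* (q ℤ.* (v ℤ.* v ℤ.* v ℤ.- + 1)) ≡ q ℤ.* (v ℤ.* v ℤ.* v ℤ.* v) ℤ.+ (ℤ.- (v ℤ.* q))
    identity₁ = ℤ-Solver.solve-∀
    identity₂ : ∀ q → q ℤ.* q ℤ.+ (+ 2 ℤ.* q ℤ.+ + 1) ≡ (+ 0 ℤ.- q ℤ.+ -[1+ 0 ]) ℤ.* (+ 0 ℤ.- q ℤ.+ -[1+ 0 ])
    identity₂ = ℤ-Solver.solve-∀
    -vQ≤0 : ℤ.- (v′ ℤ.* Q′) ℤ.≤ + 0
    -vQ≤0 = subst (λ t → ℤ.- t ℤ.≤ + 0) (ℤₚ.pos-* v size) (ℤₚ.neg-mono-≤ (ℤ.+≤+ (z≤n {v ℕ.* size})))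
    strict : v′ ℤ.* (Q′ ℤ.* (v′ ℤ.* v′ ℤ.* v′ ℤ.- + 1)) ℤ.< (+ 0 ℤ.- Q′ ℤ.+ -[1+ 0 ]) ℤ.* (+ 0 ℤ.- Q′ ℤ.+ -[1+ 0 ])
    strict = subst₂ ℤ._<_ (sym (identity₁ Q′ v′)) (identity₂ Q′)
      (ℤₚ.+-mono-≤-< (ℤₚ.*-monoˡ-≤-nonNeg Q′ v⁴≤Q)
        (ℤₚ.≤-<-trans -vQ≤0 (subst (λ t → + 0 ℤ.< t ℤ.+ + 1) (ℤₚ.pos-* 2 size)
          (ℤ.+<+ (subst (0 ℕ.<_) (ℕₚ.+-comm 1 _) (s≤s z≤n))))))

  sum-of-two-powers : (k ℕ.∸ 1) ℕ.^ 4 ℕ.< size → ∀ b → b ≢ 𝟘 → ∃ λ x → ∃ λ y → x ^ k ⊕ y ^ k ≡ b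
  sum-of-two-powers large b b≢0 = let (y , fy≢0) = ∑≢0⇒∃≢0 _ (N≢0 large b≢0)
                                      (x₁ , eq₁) = f≢0⇒power (i*j≢0⇒i≢0 (f (b ⊖ y)) (f y) fy≢0)
                                      (x₂ , eq₂) = f≢0⇒power (i*j≢0⇒j≢0 (f (b ⊖ y)) (f y) fy≢0)
    in x₁ , x₂ , trans (cong₂ _⊕_ eq₁ eq₂) (F.solve 2 (λ b y → b F.:- y F.:+ y F.:= b) refl b y)

  -- Counts nonzero roots only: x = 0 is the single root of xᵏ = 0.
  f* : F → ℤ
  f* y = f y ℤ.- δ 𝟘 y

  f*≢0⇒power : ∀ {b} → f* b ≢ + 0 → ∃ λ x → x ≢ 𝟘 × x ^ k ≡ b
  f*≢0⇒power {b} f*b≢0 with b ≟ 𝟘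
  ... | yes refl = contradiction (cong₂ ℤ._-_ f𝟘≡1 (δ-≡ {𝟘} refl)) f*b≢0
  ... | no b≢0 with f≢0⇒power {b} (λ eq → f*b≢0 (cong₂ ℤ._-_ eq (δ-≢ (b≢0 ∘ sym))))
  ...   | x , eq = x , power≢0 eq b≢0 , eq

  -- There are f b solutions with x = 0 and as many with y = 0; b ≠ 0 excludes both at once.
  ∑f*f* : ∀ {b} → b ≢ 𝟘 → ∑ (λ y → f* (b ⊖ y) ℤ.* f* y) ≡ N b ℤ.- (f b ℤ.+ f b)
  ∑f*f* {b} b≢0 = begin
    ∑ (λ y → f* (b ⊖ y) ℤ.* f* y)
      ≡⟨ ∑-cong (λ y → expand (f (b ⊖ y)) (δ 𝟘 (b ⊖ y)) (f y) (δ 𝟘 y)) ⟩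
    ∑ (λ y → f (b ⊖ y) ℤ.* f y ℤ.+ δ 𝟘 (b ⊖ y) ℤ.* (ℤ.- f y) ℤ.+ δ 𝟘 y ℤ.* (ℤ.- f (b ⊖ y) ℤ.+ δ 𝟘 (b ⊖ y)))
      ≡⟨ ∑-+₃ _ _ _ ⟩
    N b ℤ.+ ∑ (λ y → δ 𝟘 (b ⊖ y) ℤ.* (ℤ.- f y)) ℤ.+ ∑ (λ y → δ 𝟘 y ℤ.* (ℤ.- f (b ⊖ y) ℤ.+ δ 𝟘 (b ⊖ y)))
      ≡⟨ cong₂ (λ s t → N b ℤ.+ s ℤ.+ t)
           (trans (∑-cong (λ y → cong (ℤ._* (ℤ.- f y)) (δ-⇔ (λ 0≡ → F.x-y≡0⇒x≡y (sym 0≡)) (λ eq → sym (F.x≡y⇒x-y≡0 eq)))))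
                  (∑-δ b (λ y → ℤ.- f y)))
           (trans (∑-δ 𝟘 _) (cong₂ (λ s t → ℤ.- f s ℤ.+ t) b-0≡b
             (trans (cong (δ 𝟘) b-0≡b) (δ-≢ (b≢0 ∘ sym))))) ⟩
    N b ℤ.+ (ℤ.- f b) ℤ.+ (ℤ.- f b ℤ.+ + 0)    ≡⟨ collect (N b) (f b) ⟩
    N b ℤ.- (f b ℤ.+ f b)                      ∎
    where
    b-0≡b : b ⊖ 𝟘 ≡ b
    b-0≡b = F.solve 1 (λ b → b F.:- F.:0 F.:= b) refl b
    expand : ∀ a d a′ d′ → (a ℤ.- d) ℤ.* (a′ ℤ.- d′) ≡ a ℤ.* a′ ℤ.+ d ℤ.* (ℤ.- a′) ℤ.+ d′ ℤ.* (ℤ.- a ℤ.+ d)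
    expand = ℤ-Solver.solve-∀
    collect : ∀ n a → n ℤ.+ (ℤ.- a) ℤ.+ (ℤ.- a ℤ.+ + 0) ≡ n ℤ.- (a ℤ.+ a)
    collect = ℤ-Solver.solve-∀

  f-bound : ∀ {b} v → f 𝟙 ≡ + suc v → b ≢ 𝟘 → Σ ℕ λ m → m ℕ.≤ suc v × f b ≡ + m
  f-bound {b} v f𝟙≡ b≢0 with f b ℤₚ.≟ + 0
  ... | yes fb≡0 = 0 , z≤n , fb≡0
  ... | no fb≢0 with f≢0⇒power fb≢0
  ...   | w , refl = suc v , ℕₚ.≤-refl , trans (f-power (power≢0 refl b≢0)) f𝟙≡

  -- Otherwise N b = 2 f b, which is at most 2 (v + 1) because f b is 0 or equal to f 1. So few
  -- solutions contradict the bound.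
  ∑f*f*≢0 : (k ℕ.∸ 1) ℕ.^ 4 ℕ.+ 4 ℕ.* k ℕ.< size → (∃ λ w → w ^ k ≡ ⊝ 𝟙) →
    ∀ {b} → b ≢ 𝟘 → ∑ (λ y → f* (b ⊖ y) ℤ.* f* y) ≢ + 0
  ∑f*f*≢0 large -1-power {b} b≢0 ∑≡0 = combine u≡
    where
    combine : (Σ ℕ λ v → suc v ℕ.≤ k × u ≡ + v × f 𝟙 ≡ + suc v) → ⊥
    combine (v , v<k , u≡v , f𝟙≡) = bounded (f-bound v f𝟙≡ b≢0)
      where
      bounded : (Σ ℕ λ m → m ℕ.≤ suc v × f b ≡ + m) → ⊥
      bounded (m , m≤v+1 , fb≡) = square-gap size v (m ℕ.+ m ℕ.+ v) (ℕₚ.m≤n+m v (m ℕ.+ m))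
        (gap-margin {v ℕ.* v ℕ.* v ℕ.* v} {(k ℕ.∸ 1) ℕ.^ 4} {v} {m} {k} {size} (fourth-power v<k) m≤v+1 v<k large)
        (N-bound-ℕ v (m ℕ.+ m) b≢0 u≡v (-1-power⇒e≡u -1-power)
          (trans (ℤₚ.i-j≡0⇒i≡j (N b) (f b ℤ.+ f b) (trans (sym (∑f*f* b≢0)) ∑≡0)) (cong₂ ℤ._+_ fb≡ fb≡)))

  sum-of-two-nonzero-powers : (k ℕ.∸ 1) ℕ.^ 4 ℕ.+ 4 ℕ.* k ℕ.< size → (∃ λ w → w ^ k ≡ ⊝ 𝟙) →
    ∀ b → b ≢ 𝟘 → ∃ λ x → ∃ λ y → x ≢ 𝟘 × y ≢ 𝟘 × x ^ k ⊕ y ^ k ≡ b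
  sum-of-two-nonzero-powers large -1-power b b≢0 =
    let (y , f*y≢0) = ∑≢0⇒∃≢0 _ (∑f*f*≢0 large -1-power b≢0)
        (x₁ , x₁≢0 , eq₁) = f*≢0⇒power (i*j≢0⇒i≢0 (f* (b ⊖ y)) (f* y) f*y≢0)
        (x₂ , x₂≢0 , eq₂) = f*≢0⇒power (i*j≢0⇒j≢0 (f* (b ⊖ y)) (f* y) f*y≢0)
    in x₁ , x₂ , x₁≢0 , x₂≢0 , trans (cong₂ _⊕_ eq₁ eq₂) (F.solve 2 (λ b y → b F.:- y F.:+ y F.:= b) refl b y)

-- Residue classes of polynomials

module Vector (K : FiniteRing) where
  open FiniteRing K
  open ≡-Reasoning

  infixl 6 _⊞_
  infixr 7 _•_

  _⊞_ : ∀ {m} → Vec Carrier m → Vec Carrier m → Vec Carrier m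
  _⊞_ = zipWith _+_

  _•_ : ∀ {m} → Carrier → Vec Carrier m → Vec Carrier m
  a • v = map (a *_) v

  ⊟_ : ∀ {m} → Vec Carrier m → Vec Carrier m
  ⊟_ = map (-_)

  𝕠 : ∀ {m} → Vec Carrier m
  𝕠 {m} = replicate m 0#

  ⊞-identityʳ : ∀ {m} (v : Vec Carrier m) → v ⊞ 𝕠 ≡ v
  ⊞-identityʳ = Vecₚ.zipWith-identityʳ +-identityʳ

  ⊞-identityˡ : ∀ {m} (v : Vec Carrier m) → 𝕠 ⊞ v ≡ v
  ⊞-identityˡ = Vecₚ.zipWith-identityˡ +-identityˡ

  ⊞-comm : ∀ {m} (u v : Vec Carrier m) → u ⊞ v ≡ v ⊞ u
  ⊞-comm = Vecₚ.zipWith-comm +-comm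

  ⊞-assoc : ∀ {m} (u v w : Vec Carrier m) → u ⊞ v ⊞ w ≡ u ⊞ (v ⊞ w)
  ⊞-assoc = Vecₚ.zipWith-assoc +-assoc

  ⊞-inverseˡ : ∀ {m} (v : Vec Carrier m) → ⊟ v ⊞ v ≡ 𝕠
  ⊞-inverseˡ = Vecₚ.zipWith-inverseˡ -‿inverseˡ

  ⊞-interchange : ∀ {m} (t u v w : Vec Carrier m) → (t ⊞ u) ⊞ (v ⊞ w) ≡ (t ⊞ v) ⊞ (u ⊞ w)
  ⊞-interchange [] [] [] [] = refl
  ⊞-interchange (a ∷ t) (b ∷ u) (c ∷ v) (d ∷ w) = cong₂ _∷_
    (solve 4 (λ a b c d → (a :+ b) :+ (c :+ d) := (a :+ c) :+ (b :+ d)) refl a b c d) (⊞-interchange t u v w)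

  •-distribˡ : ∀ {m} a (u v : Vec Carrier m) → a • (u ⊞ v) ≡ a • u ⊞ a • v
  •-distribˡ a [] [] = refl
  •-distribˡ a (x ∷ u) (y ∷ v) = cong₂ _∷_ (distribˡ a x y) (•-distribˡ a u v)

  •-distribʳ : ∀ {m} a b (v : Vec Carrier m) → (a + b) • v ≡ a • v ⊞ b • v
  •-distribʳ a b [] = refl
  •-distribʳ a b (x ∷ v) = cong₂ _∷_ (distribʳ x a b) (•-distribʳ a b v)

  •-assoc : ∀ {m} a b (v : Vec Carrier m) → a • b • v ≡ (a * b) • v
  •-assoc a b [] = refl
  •-assoc a b (x ∷ v) = cong₂ _∷_ (sym (*-assoc a b x)) (•-assoc a b v)

  •-comm : ∀ {m} a b (v : Vec Carrier m) → a • b • v ≡ b • a • v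
  •-comm a b v = trans (•-assoc a b v) (trans (cong (_• v) (*-comm a b)) (sym (•-assoc b a v)))

  •-identityˡ : ∀ {m} (v : Vec Carrier m) → 1# • v ≡ v
  •-identityˡ [] = refl
  •-identityˡ (x ∷ v) = cong₂ _∷_ (*-identityˡ x) (•-identityˡ v)

  •-zeroˡ : ∀ {m} (v : Vec Carrier m) → 0# • v ≡ 𝕠
  •-zeroˡ [] = refl
  •-zeroˡ (x ∷ v) = cong₂ _∷_ (zeroˡ x) (•-zeroˡ v)

  •-zeroʳ : ∀ {m} a → a • 𝕠 {m} ≡ 𝕠
  •-zeroʳ {zero}  a = refl
  •-zeroʳ {suc m} a = cong₂ _∷_ (zeroʳ a) (•-zeroʳ a)

  vector-index : ∀ {m} → Vec Carrier m → Fin (size ℕ.^ m)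
  vector-index {m} v = Fin.funToFin {m} {size} (λ i → index (lookup v i))

  digit : ∀ {m} → Fin (size ℕ.^ m) → Fin m → Carrier
  digit {m} i j = element (Fin.finToFun {size} {m} i j)

  vector : ∀ {m} → Fin (size ℕ.^ m) → Vec Carrier m
  vector {m} i = tabulate (digit {m} i)

  vector-vector-index : ∀ {m} (v : Vec Carrier m) → vector (vector-index v) ≡ v
  vector-vector-index {m} v = trans
    (Vecₚ.tabulate-cong (λ j → trans (cong element (Finₚ.finToFun-funToFin {m} {size} (λ i → index (lookup v i)) j)) (element-index _)))
    (Vecₚ.tabulate∘lookup v)

  vector-index-vector : ∀ {m} (i : Fin (size ℕ.^ m)) → vector-index {m} (vector {m} i) ≡ i
  vector-index-vector {m} i = trans
    (funToFin-cong {m} {size} (λ j → trans (cong index (Vecₚ.lookup∘tabulate (digit {m} i) j)) (index-element _)))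
    (Finₚ.funToFin-finToFin {m} {size} i)
    where
    funToFin-cong : ∀ {m n} {f g : Fin m → Fin n} → (∀ j → f j ≡ g j) → Fin.funToFin {m} {n} f ≡ Fin.funToFin {m} {n} g
    funToFin-cong {zero}          eq = refl
    funToFin-cong {suc m} {n} {f} {g} eq = cong₂ (Fin.combine {n} {n ℕ.^ m}) (eq zero) (funToFin-cong {m} {n} (eq ∘ suc))

  any-vector? : ∀ {m} {P : Vec Carrier m → Set} → (∀ v → Dec (P v)) → Dec (∃ P)
  any-vector? {m} {P} P? = map′ (λ (i , pv) → vector i , pv)
      (λ (v , pv) → vector-index v , subst P (sym (vector-vector-index v)) pv)
      (Finₚ.any? (P? ∘ vector {m}))

  -- shift drops the last entry of a ∷ v, and overflow returns it.
  shift : ∀ {m} → Carrier → Vec Carrier m → Vec Carrier m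
  shift a []      = []
  shift a (x ∷ v) = a ∷ shift x v

  overflow : ∀ {m} → Carrier → Vec Carrier m → Carrier
  overflow a []      = a
  overflow a (x ∷ v) = overflow x v

  shift-⊞ : ∀ {m} a b (u v : Vec Carrier m) → shift (a + b) (u ⊞ v) ≡ shift a u ⊞ shift b v
  shift-⊞ a b [] [] = refl
  shift-⊞ a b (x ∷ u) (y ∷ v) = cong ((a + b) ∷_) (shift-⊞ x y u v)

  shift-• : ∀ {m} a b (v : Vec Carrier m) → shift (a * b) (a • v) ≡ a • shift b v
  shift-• a b [] = refl
  shift-• a b (x ∷ v) = cong ((a * b) ∷_) (shift-• a x v)

  overflow-⊞ : ∀ {m} a b (u v : Vec Carrier m) → overflow (a + b) (u ⊞ v) ≡ overflow a u + overflow b v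
  overflow-⊞ a b [] [] = refl
  overflow-⊞ a b (x ∷ u) (y ∷ v) = overflow-⊞ x y u v

  overflow-• : ∀ {m} a b (v : Vec Carrier m) → overflow (a * b) (a • v) ≡ a * overflow b v
  overflow-• a b [] = refl
  overflow-• a b (x ∷ v) = overflow-• a x v

  shift-𝕠 : ∀ m → shift 0# (𝕠 {m}) ≡ 𝕠
  shift-𝕠 zero    = refl
  shift-𝕠 (suc m) = cong (0# ∷_) (shift-𝕠 m)

  overflow-𝕠 : ∀ m → overflow 0# (𝕠 {m}) ≡ 0#
  overflow-𝕠 zero    = refl
  overflow-𝕠 (suc m) = overflow-𝕠 m

  shift≡𝕠 : ∀ {m} a (v : Vec Carrier m) → shift a v ≡ 𝕠 → overflow a v ≡ 0# → a ∷ v ≡ 𝕠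
  shift≡𝕠 a [] _ o≡0 = cong (_∷ []) o≡0
  shift≡𝕠 a (x ∷ v) s≡𝕠 o≡0 = cong₂ _∷_ (Vecₚ.∷-injectiveˡ s≡𝕠) (shift≡𝕠 x v (Vecₚ.∷-injectiveʳ s≡𝕠) o≡0)

  pad : ∀ {l} m → Vec Carrier l → Vec Carrier m
  pad zero    as       = []
  pad (suc m) []       = 0# ∷ pad m []
  pad (suc m) (a ∷ as) = a ∷ pad m as

  pad-[] : ∀ m → pad m [] ≡ 𝕠
  pad-[] zero    = refl
  pad-[] (suc m) = cong (0# ∷_) (pad-[] m)

  pad-id : ∀ {m} (v : Vec Carrier m) → pad m v ≡ v
  pad-id []      = refl
  pad-id (x ∷ v) = cong (x ∷_) (pad-id v)

  shift-pad : ∀ {l} m a (as : Vec Carrier l) → shift a (pad m as) ≡ pad m (a ∷ as)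
  shift-pad zero    a as       = refl
  shift-pad (suc m) a []       = cong (a ∷_) (trans (cong (shift 0#) (pad-[] m)) (trans (shift-𝕠 m) (sym (pad-[] m))))
  shift-pad (suc m) a (b ∷ as) = cong (a ∷_) (shift-pad m b as)

  overflow-pad : ∀ {l} m a (as : Vec Carrier l) → l ℕ.< m → overflow a (pad m as) ≡ 0#
  overflow-pad (suc m) a []       _         = trans (cong (overflow 0#) (pad-[] m)) (overflow-𝕠 m)
  overflow-pad (suc m) a (b ∷ as) (s≤s l<m) = overflow-pad m b as l<m

-- K[x]/(xᵐ - c): v is the residue class of the polynomial with coefficients v,
-- S is multiplication by x and a polynomial acts by Horner's rule.
module Quotient (K : FiniteRing) (m : ℕ) (c : Vec (FiniteRing.Carrier K) m) where
  open FiniteRing K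
  open Vector K
  open ≡-Reasoning

  V = Vec Carrier m

  S : V → V
  S v = shift 0# v ⊞ overflow 0# v • c

  act : ∀ {l} → Vec Carrier l → V → V
  act []       v = 𝕠
  act (a ∷ as) v = a • v ⊞ S (act as v)

  one : V
  one = shift 1# 𝕠

  S-⊞ : ∀ u v → S (u ⊞ v) ≡ S u ⊞ S v
  S-⊞ u v = begin
    shift 0# (u ⊞ v) ⊞ overflow 0# (u ⊞ v) • c
      ≡⟨ cong₂ (λ s t → s ⊞ t • c) (trans (cong (λ z → shift z (u ⊞ v)) (sym (+-identityˡ 0#))) (shift-⊞ 0# 0# u v))
           (trans (cong (λ z → overflow z (u ⊞ v)) (sym (+-identityˡ 0#))) (overflow-⊞ 0# 0# u v)) ⟩
    (shift 0# u ⊞ shift 0# v) ⊞ (overflow 0# u + overflow 0# v) • c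
      ≡⟨ cong ((shift 0# u ⊞ shift 0# v) ⊞_) (•-distribʳ _ _ c) ⟩
    (shift 0# u ⊞ shift 0# v) ⊞ (overflow 0# u • c ⊞ overflow 0# v • c)
      ≡⟨ ⊞-interchange _ _ _ _ ⟩
    S u ⊞ S v ∎

  S-• : ∀ a v → S (a • v) ≡ a • S v
  S-• a v = begin
    shift 0# (a • v) ⊞ overflow 0# (a • v) • c
      ≡⟨ cong₂ (λ s t → s ⊞ t • c) (trans (cong (λ z → shift z (a • v)) (sym (zeroʳ a))) (shift-• a 0# v))
           (trans (cong (λ z → overflow z (a • v)) (sym (zeroʳ a))) (overflow-• a 0# v)) ⟩
    a • shift 0# v ⊞ (a * overflow 0# v) • c  ≡⟨ cong (a • shift 0# v ⊞_) (sym (•-assoc a _ c)) ⟩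
    a • shift 0# v ⊞ a • overflow 0# v • c    ≡⟨ sym (•-distribˡ a _ _) ⟩
    a • S v ∎

  S-𝕠 : S 𝕠 ≡ 𝕠
  S-𝕠 = trans (cong₂ (λ s t → s ⊞ t • c) (shift-𝕠 m) (overflow-𝕠 m))
    (trans (cong (𝕠 ⊞_) (•-zeroˡ c)) (⊞-identityˡ 𝕠))

  act-⊞ : ∀ {l} (as : Vec Carrier l) u v → act as (u ⊞ v) ≡ act as u ⊞ act as v
  act-⊞ [] u v = sym (⊞-identityˡ 𝕠)
  act-⊞ (a ∷ as) u v = trans (cong₂ _⊞_ (•-distribˡ a u v) (trans (cong S (act-⊞ as u v)) (S-⊞ _ _)))
    (⊞-interchange _ _ _ _)

  act-• : ∀ {l} (as : Vec Carrier l) b v → act as (b • v) ≡ b • act as v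
  act-• [] b v = sym (•-zeroʳ b)
  act-• (a ∷ as) b v = trans (cong₂ _⊞_ (•-comm a b v) (trans (cong S (act-• as b v)) (S-• b _)))
    (sym (•-distribˡ b _ _))

  act-S : ∀ {l} (as : Vec Carrier l) v → act as (S v) ≡ S (act as v)
  act-S [] v = sym S-𝕠
  act-S (a ∷ as) v = trans (cong₂ _⊞_ (sym (S-• a v)) (cong S (act-S as v))) (sym (S-⊞ _ _))

  act-𝕠 : ∀ {l} (as : Vec Carrier l) → act as 𝕠 ≡ 𝕠
  act-𝕠 as = trans (cong (act as) (sym (•-zeroˡ 𝕠))) (trans (act-• as 0# 𝕠) (•-zeroˡ _))

  -- All these operators are polynomials in the one operator `S`.
  act-comm : ∀ {k l} (as : Vec Carrier k) (bs : Vec Carrier l) v → act as (act bs v) ≡ act bs (act as v)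
  act-comm [] bs v = sym (act-𝕠 bs)
  act-comm (a ∷ as) bs v = begin
    a • act bs v ⊞ S (act as (act bs v))   ≡⟨ cong₂ _⊞_ (sym (act-• bs a v)) (cong S (act-comm as bs v)) ⟩
    act bs (a • v) ⊞ S (act bs (act as v)) ≡⟨ cong (act bs (a • v) ⊞_) (sym (act-S bs _)) ⟩
    act bs (a • v) ⊞ act bs (S (act as v)) ≡⟨ sym (act-⊞ bs _ _) ⟩
    act bs (a • v ⊞ S (act as v))          ∎

  -- Below degree m nothing overflows, so Horner's rule reproduces the coefficients.
  act-one : ∀ {l} (as : Vec Carrier l) → l ℕ.≤ m → act as one ≡ pad m as
  act-one []       _   = sym (pad-[] m)
  act-one (a ∷ as) l<m = begin
    a • one ⊞ S (act as one)
      ≡⟨ cong (λ t → a • one ⊞ S t) (act-one as (ℕₚ.<⇒≤ l<m)) ⟩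
    a • one ⊞ (shift 0# (pad m as) ⊞ overflow 0# (pad m as) • c)
      ≡⟨ cong (λ t → a • one ⊞ (shift 0# (pad m as) ⊞ t)) (trans (cong (_• c) (overflow-pad m 0# as l<m)) (•-zeroˡ c)) ⟩
    a • one ⊞ (shift 0# (pad m as) ⊞ 𝕠)
      ≡⟨ cong₂ _⊞_ (trans (sym (shift-• a 1# 𝕠)) (cong₂ shift (*-identityʳ a) (•-zeroʳ a))) (⊞-identityʳ _) ⟩
    shift a 𝕠 ⊞ shift 0# (pad m as)     ≡⟨ sym (shift-⊞ a 0# 𝕠 (pad m as)) ⟩
    shift (a + 0#) (𝕠 ⊞ pad m as)       ≡⟨ cong₂ shift (+-identityʳ a) (⊞-identityˡ _) ⟩
    shift a (pad m as)                  ≡⟨ shift-pad m a as ⟩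
    pad m (a ∷ as)                      ∎

  act-one-id : ∀ (v : V) → act v one ≡ v
  act-one-id v = trans (act-one v ℕₚ.≤-refl) (pad-id v)

  infixl 7 _⊠_
  _⊠_ : V → V → V
  u ⊠ v = act u v

  -- Each v equals `act v one`, so commuting operators give commuting elements. Associativity then
  -- needs no computation: it is `act-comm` read through commutativity.
  ⊠-comm : ∀ u v → u ⊠ v ≡ v ⊠ u
  ⊠-comm u v = begin
    act u v             ≡⟨ cong (act u) (sym (act-one-id v)) ⟩
    act u (act v one)   ≡⟨ act-comm u v one ⟩
    act v (act u one)   ≡⟨ cong (act v) (act-one-id u) ⟩
    act v u             ∎

  ⊠-assoc : ∀ u v w → u ⊠ v ⊠ w ≡ u ⊠ (v ⊠ w)
  ⊠-assoc u v w = begin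
    u ⊠ v ⊠ w     ≡⟨ ⊠-comm (u ⊠ v) w ⟩
    w ⊠ (u ⊠ v)   ≡⟨ act-comm w u v ⟩
    u ⊠ (w ⊠ v)   ≡⟨ cong (u ⊠_) (⊠-comm w v) ⟩
    u ⊠ (v ⊠ w)   ∎

  cringV : CRing
  cringV = record
    { Carrier = V ; _+_ = _⊞_ ; _*_ = _⊠_ ; -_ = ⊟_ ; 0# = 𝕠 ; 1# = one
    ; isCommutativeRing = record
      { isRing = record
        { +-isAbelianGroup = record
          { isGroup = record
            { isMonoid = record
              { isSemigroup = record
                { isMagma = record { isEquivalence = ≡.isEquivalence ; ∙-cong = cong₂ _⊞_ }
                ; assoc = ⊞-assoc }
              ; identity = ⊞-identityˡ , ⊞-identityʳ }
            ; inverse = ⊞-inverseˡ , (λ v → trans (⊞-comm v (⊟ v)) (⊞-inverseˡ v))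
            ; ⁻¹-cong = cong ⊟_ }
          ; comm = ⊞-comm }
        ; *-cong = cong₂ _⊠_
        ; *-assoc = ⊠-assoc
        ; *-identity = (λ v → trans (⊠-comm one v) (act-one-id v)) , act-one-id
        ; distrib = (λ u v w → act-⊞ u v w) , λ u v w → trans (⊠-comm (v ⊞ w) u)
            (trans (act-⊞ u v w) (cong₂ _⊞_ (⊠-comm u v) (⊠-comm u w))) }
      ; *-comm = ⊠-comm } }

  ring-V : FiniteRing
  ring-V = record
    { cring = cringV ; size = size ℕ.^ m ; element = vector {m} ; index = vector-index {m}
    ; element-index = vector-vector-index {m} ; index-element = vector-index-vector {m} }

  x : V
  x = S one

  x⊠ : ∀ v → x ⊠ v ≡ S v
  x⊠ v = trans (⊠-comm x v) (trans (act-S v one) (cong S (act-one-id v)))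

  act≡⊠ : ∀ {l} (as : Vec Carrier l) v → act as v ≡ act as one ⊠ v
  act≡⊠ as v = begin
    act as v              ≡⟨ cong (act as) (sym (act-one-id v)) ⟩
    act as (act v one)    ≡⟨ act-comm as v one ⟩
    v ⊠ act as one        ≡⟨ ⊠-comm v _ ⟩
    act as one ⊠ v        ∎

  •≡⊠ : ∀ a v → a • v ≡ (a • one) ⊠ v
  •≡⊠ a v = sym (trans (⊠-comm (a • one) v) (trans (act-• v a one) (cong (a •_) (act-one-id v))))

-- Construction of the field with pⁿ elements

least : ∀ {P : ℕ → Set} → (∀ m → Dec (P m)) → ∀ m → P m → Σ ℕ λ j → j ℕ.≤ m × P j × (∀ i → i ℕ.< j → ¬ P i)
least P? zero pm = 0 , z≤n , pm , λ _ ()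
least {P} P? (suc m) pm with P? 0
... | yes p0 = 0 , z≤n , p0 , λ _ ()
... | no ¬p0 with least (P? ∘ suc) m pm
...   | j , j≤m , pj , min = suc j , s≤s j≤m , pj , min′
  where
  min′ : ∀ i → i ℕ.< suc j → ¬ P i
  min′ zero    _         = ¬p0
  min′ (suc i) (s≤s i<j) = min i i<j

module FiniteFieldFermat (R : FiniteRing) (isField : FiniteRing.IsField R) where
  open FiniteRing R
  open IsField isField
  open ≡-Reasoning
  import Algebra.Properties.CommutativeMonoid.Sum (CommutativeRing.*-commutativeMonoid commutativeRing) as Prod

  ∏ : ∀ {m} → (Fin m → Carrier) → Carrier
  ∏ = Prod.sum

  -- Multiplication by a ≠ 0 permutes the elements. Comparing the product of all of them, with 0
  -- replaced by 1, before and after the permutation shows that the factors a cancel to 1.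
  x^size≡x : ∀ a → a ^ size ≡ a
  x^size≡x a with a ≟ 0#
  ... | yes refl = 0^n≡0 (nonempty size (index 0#))
    where
    nonempty : ∀ n → Fin n → 1 ℕ.≤ n
    nonempty (suc n) _ = s≤s z≤n
  ... | no a≢0 = begin
    a ^ size                            ≡⟨ sym (∏-unit (index 0#)) ⟩
    ∏ (factor (index 0#)) * a           ≡⟨ cong (_* a) (*-cancelˡ-≢0 P≢0 (trans (sym scaled) (sym (*-identityʳ P)))) ⟩
    1# * a                              ≡⟨ *-identityˡ a ⟩
    a                                   ∎
    where
    unit : Carrier → Carrier
    unit x with x ≟ 0#
    ... | yes _ = 1#
    ... | no _  = x
    unit≢0 : ∀ x → unit x ≢ 0#
    unit≢0 x with x ≟ 0#
    ... | yes _  = 1≢0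
    ... | no x≢0 = x≢0
    factor : ∀ {m} → Fin m → Fin m → Carrier
    factor j i with j Finₚ.≟ i
    ... | yes _ = 1#
    ... | no _  = a
    factor-suc : ∀ {m} (j i : Fin m) → factor (suc j) (suc i) ≡ factor j i
    factor-suc j i with j Finₚ.≟ i
    ... | yes _ = refl
    ... | no _  = refl
    ∏-const : ∀ m → ∏ {m} (λ _ → a) ≡ a ^ m
    ∏-const zero    = refl
    ∏-const (suc m) = cong (a *_) (∏-const m)
    ∏-unit : ∀ {m} (j : Fin m) → ∏ (factor j) * a ≡ a ^ m
    ∏-unit {suc m} zero = trans (cong (_* a) (trans (*-identityˡ _) (∏-const m))) (*-comm _ a)
    ∏-unit {suc m} (suc j) = trans (*-assoc a _ a) (cong (a *_)
      (trans (cong (_* a) (Prod.sum-cong-≗ (factor-suc j))) (∏-unit j)))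
    P = ∏ (λ i → unit (element i))
    ∏≢0 : ∀ {m} (t : Fin m → Carrier) → (∀ i → t i ≢ 0#) → ∏ t ≢ 0#
    ∏≢0 {zero}  t t≢0 = 1≢0
    ∏≢0 {suc m} t t≢0 = x*y≢0 (t≢0 zero) (∏≢0 (t ∘ suc) (t≢0 ∘ suc))
    P≢0 : P ≢ 0#
    P≢0 = ∏≢0 _ (unit≢0 ∘ element)
    a⁻¹ = proj₁ (inverse a a≢0)
    π : Perm.Permutation size size
    π = mk↔ₛ′ (λ i → index (a * element i)) (λ i → index (a⁻¹ * element i))
      (λ i → trans (cong (λ t → index (a * t)) (element-index _))
        (trans (cong index (trans (sym (*-assoc a a⁻¹ _)) (trans (cong (_* element i) (proj₂ (inverse a a≢0))) (*-identityˡ _)))) (index-element i)))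
      (λ i → trans (cong (λ t → index (a⁻¹ * t)) (element-index _))
        (trans (cong index (trans (sym (*-assoc a⁻¹ a _)) (trans (cong (_* element i) (trans (*-comm a⁻¹ a) (proj₂ (inverse a a≢0)))) (*-identityˡ _)))) (index-element i)))
    pointwise : ∀ i → unit (a * element i) ≡ unit (element i) * factor (index 0#) i
    pointwise i with index 0# Finₚ.≟ i | element i ≟ 0# | a * element i ≟ 0#
    ... | yes _  | yes _   | yes _   = sym (*-identityˡ 1#)
    ... | yes _  | yes x≡0 | no ax≢0 = contradiction (trans (cong (a *_) x≡0) (zeroʳ a)) ax≢0
    ... | yes eq | no x≢0  | _       = contradiction (trans (cong element (sym eq)) (element-index 0#)) x≢0
    ... | no neq | yes x≡0 | _       = contradiction (trans (cong index (sym x≡0)) (index-element i)) neq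
    ... | no _   | no x≢0  | yes ax≡0 = contradiction ax≡0 (x*y≢0 a≢0 x≢0)
    ... | no _   | no _    | no _    = *-comm a _
    scaled : P ≡ P * ∏ (factor (index 0#))
    scaled = begin
      P                                          ≡⟨ Prod.sum-permute (λ i → unit (element i)) π ⟩
      ∏ (λ i → unit (element (index (a * element i))))
        ≡⟨ Prod.sum-cong-≗ {size} (λ i → trans (cong unit (element-index _)) (pointwise i)) ⟩
      ∏ (λ i → unit (element i) * factor (index 0#) i) ≡⟨ Prod.∑-distrib-+ (λ i → unit (element i)) (factor (index 0#)) ⟩
      P * ∏ (factor (index 0#))                  ∎

module QuotientField (K : FiniteRing) (isField : FiniteRing.IsField K) {p : ℕ} (pr : Prime p)
  (char : ∀ a → FiniteRing._·_ K p a ≡ FiniteRing.0# K)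
  (fermat : ∀ a → FiniteRing._^_ K a p ≡ a)
  (n : ℕ) where

  open FiniteRing K using (Carrier; 0#; 1#; -_)
  private module K = FiniteRing K
  open Vector K
  open ≡-Reasoning

  Q : ℕ
  Q = p ℕ.^ n

  module Algebra′ (m : ℕ) (c : Vec Carrier m) where
    open Quotient K m c public
    module R = FiniteRing ring-V
    open R using (_^_)

    ·≡map : ∀ j v → j R.· v ≡ map (K._·_ j) v
    ·≡map zero    v = zeros v
      where
      zeros : ∀ {l} (v : Vec Carrier l) → 𝕠 ≡ map (K._·_ 0) v
      zeros []      = refl
      zeros (_ ∷ v) = cong (0# ∷_) (zeros v)
    ·≡map (suc j) v = trans (cong (v ⊞_) (·≡map j v)) (add v)
      where
      add : ∀ {l} (v : Vec Carrier l) → v ⊞ map (K._·_ j) v ≡ map (K._·_ (suc j)) v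
      add []      = refl
      add (_ ∷ v) = cong (_ ∷_) (add v)

    char-V : ∀ v → p R.· v ≡ 𝕠
    char-V v = trans (·≡map p v) (zeros v)
      where
      zeros : ∀ {l} (v : Vec Carrier l) → map (K._·_ p) v ≡ 𝕠
      zeros []      = refl
      zeros (a ∷ v) = cong₂ _∷_ (char a) (zeros v)

    frobenius : ∀ i u v → (u ⊞ v) ^ (p ℕ.^ i) ≡ u ^ (p ℕ.^ i) ⊞ v ^ (p ℕ.^ i)
    frobenius i u v = Frobenius.frobenius-iter R.semiring pr char-V i u v (⊠-comm u v)

    scalar-^ : ∀ a i → (a • one) ^ i ≡ (K._^_ a i) • one
    scalar-^ a zero    = sym (•-identityˡ one)
    scalar-^ a (suc i) = trans (cong ((a • one) ⊠_) (scalar-^ a i))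
      (trans (sym (•≡⊠ a _)) (•-assoc a _ one))

    fermat-iter : ∀ i a → K._^_ a (p ℕ.^ i) ≡ a
    fermat-iter zero    a = K.*-identityʳ a
    fermat-iter (suc i) a = trans (sym (K.^-assocʳ a p (p ℕ.^ i)))
      (trans (cong (λ b → K._^_ b (p ℕ.^ i)) (fermat a)) (fermat-iter i a))

    -- The map v ↦ v^Q is additive and multiplicative and fixes scalars by Fermat, so its value at x
    -- determines it.
    x^Q≡x⇒v^Q≡v : x ^ Q ≡ x → ∀ v → v ^ Q ≡ v
    x^Q≡x⇒v^Q≡v x^Q≡x v = trans (cong (_^ Q) (sym (act-one-id v))) (trans (go v) (act-one-id v))
      where
      𝕠^Q : ∀ i → 𝕠 ^ (p ℕ.^ i) ≡ 𝕠
      𝕠^Q i = R.0^n≡0 (ℕₚ.m^n>0 p {{ℕ.nonTrivial⇒nonZero p {{prime⇒nonTrivial pr}}}} i)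
      go : ∀ {l} (as : Vec Carrier l) → act as one ^ Q ≡ act as one
      go [] = 𝕠^Q n
      go (a ∷ as) = begin
        (a • one ⊞ S (act as one)) ^ Q          ≡⟨ frobenius n _ _ ⟩
        (a • one) ^ Q ⊞ S (act as one) ^ Q
          ≡⟨ cong₂ _⊞_ (trans (scalar-^ a Q) (cong (_• one) (fermat-iter n a)))
               (trans (cong (_^ Q) (sym (x⊠ (act as one)))) (R.^-distrib-* x (act as one) Q)) ⟩
        a • one ⊞ x ^ Q ⊠ act as one ^ Q        ≡⟨ cong₂ (λ s t → a • one ⊞ s ⊠ t) x^Q≡x (go as) ⟩
        a • one ⊞ x ⊠ act as one                ≡⟨ cong (a • one ⊞_) (x⊠ _) ⟩
        a • one ⊞ S (act as one)                ∎

    w : ℕ → V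
    w zero    = one
    w (suc i) = (x ^ (p ℕ.^ suc i) R.- x) ⊠ w i

    -- Splits off the leading coefficient.
    act-shift : ∀ {j} a (v : Vec Carrier j) → act (a ∷ v) one ≡ act (shift a v) one ⊞ overflow a v • x ^ j
    act-shift a [] = trans (cong (a • one ⊞_) S-𝕠) (⊞-comm _ _)
    act-shift {suc j} a (b ∷ v) = begin
      a • one ⊞ S (act (b ∷ v) one)                                         ≡⟨ cong (λ t → a • one ⊞ S t) (act-shift b v) ⟩
      a • one ⊞ S (act (shift b v) one ⊞ overflow b v • x ^ j)              ≡⟨ cong (a • one ⊞_) (S-⊞ _ _) ⟩
      a • one ⊞ (S (act (shift b v) one) ⊞ S (overflow b v • x ^ j))        ≡⟨ sym (⊞-assoc _ _ _) ⟩
      act (a ∷ shift b v) one ⊞ S (overflow b v • x ^ j)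
        ≡⟨ cong (act (a ∷ shift b v) one ⊞_) (trans (S-• _ _) (cong (overflow b v •_) (sym (x⊠ _)))) ⟩
      act (a ∷ shift b v) one ⊞ overflow b v • x ^ suc j                    ∎

    act-additive : ∀ {l} (as bs : Vec Carrier l) v → act (as ⊞ bs) v ≡ act as v ⊞ act bs v
    act-additive [] [] v = sym (⊞-identityˡ 𝕠)
    act-additive (a ∷ as) (b ∷ bs) v = trans
      (cong₂ _⊞_ (•-distribʳ a b v) (trans (cong S (act-additive as bs v)) (S-⊞ _ _))) (⊞-interchange _ _ _ _)

    act-scalar : ∀ {l} b (as : Vec Carrier l) v → act (b • as) v ≡ b • act as v
    act-scalar b [] v = sym (•-zeroʳ b)
    act-scalar b (a ∷ as) v = trans (cong₂ _⊞_ (sym (•-assoc b a v)) (trans (cong S (act-scalar b as v)) (S-• b _)))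
      (sym (•-distribˡ b _ _))

    act-zeros : ∀ l v → act (𝕠 {l}) v ≡ 𝕠
    act-zeros zero    v = refl
    act-zeros (suc l) v = trans (cong₂ _⊞_ (•-zeroˡ v) (trans (cong S (act-zeros l v)) S-𝕠)) (⊞-identityˡ 𝕠)

  -- Decidable, because c ranges over a finite set, so a least good m can be searched for.
  -- Irreducibility of the modulus is not part of the condition; it will follow from minimality.
  Good : ℕ → Set
  Good m = ∃ λ (c : Vec Carrier m) → Algebra′.R._^_ m c (Algebra′.x m c) Q ≡ Algebra′.x m c × Algebra′.w m c (ℕ.pred n) ≢ 𝕠

  Good? : ∀ m → Dec (Good m)
  Good? m = any-vector? (λ c → Algebra′.R._≟_ m c _ _ ×-dec ¬? (Algebra′.R._≟_ m c _ _))

  -- An idempotent e with e W ≠ 0 gives the smaller quotient eR, so e = 1 by minimality of m.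
  module Minimal (m : ℕ) (c : Vec Carrier m) (minimal : ∀ j → j ℕ.< m → ¬ Good j)
    (x^Q≡x : Algebra′.R._^_ m c (Algebra′.x m c) Q ≡ Algebra′.x m c)
    (W≢0 : Algebra′.w m c (ℕ.pred n) ≢ 𝕠) where
    open Algebra′ m c
    open R using (_^_)

    W : V
    W = w (ℕ.pred n)

    module _ (e : V) (e²≡e : e ⊠ e ≡ e) (eW≢0 : e ⊠ W ≢ 𝕠) where

      Dependent : ℕ → Set
      Dependent j = ∃ λ (as : Vec Carrier j) → e ⊠ x ^ j ≡ e ⊠ act as one

      -- j is the dimension of the ideal eR: the first power of x that depends on lower ones after
      -- multiplication by e. The search stops by m, since every element, x^m included, is a
      -- combination of the powers below m.
      relation = least {Dependent} (λ j → any-vector? (λ as → R._≟_ _ _)) m (x ^ m , cong (e ⊠_) (sym (act-one-id (x ^ m))))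

      j = proj₁ relation
      c′ : Vec Carrier j
      c′ = proj₁ (proj₁ (proj₂ (proj₂ relation)))

      -- The leading coefficient of a relation of length i + 1 must vanish: dividing by it would
      -- make `Dependent i` hold for some i < j.
      independent : ∀ {i} → i ℕ.≤ j → (v : Vec Carrier i) → e ⊠ act v one ≡ 𝕠 → v ≡ 𝕠
      independent {zero} _ [] _ = refl
      independent {suc i} i<j (a ∷ v) eq with overflow a v K.≟ 0#
      ... | yes o≡0 = shift≡𝕠 a v (independent (ℕₚ.<⇒≤ i<j) (shift a v) (begin
        e ⊠ act (shift a v) one      ≡⟨ sym (⊞-identityʳ _) ⟩
        e ⊠ act (shift a v) one ⊞ 𝕠
          ≡⟨ cong (e ⊠ act (shift a v) one ⊞_) (sym (trans (cong (e ⊠_) (trans (cong (_• x ^ i) o≡0) (•-zeroˡ _))) (act-𝕠 e))) ⟩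
        e ⊠ act (shift a v) one ⊞ e ⊠ (overflow a v • x ^ i)   ≡⟨ sym (act-⊞ e _ _) ⟩
        e ⊠ (act (shift a v) one ⊞ overflow a v • x ^ i)       ≡⟨ cong (e ⊠_) (sym (act-shift a v)) ⟩
        e ⊠ act (a ∷ v) one          ≡⟨ eq ⟩
        𝕠                            ∎)) o≡0
      ... | no o≢0 with K.IsField.inverse isField (overflow a v) o≢0
      ...   | o⁻¹ , oo⁻¹≡1 = contradiction (((- o⁻¹) • shift a v) , dependence)
                (proj₂ (proj₂ (proj₂ relation)) i i<j)
        where
        A = e ⊠ act (shift a v) one
        B = e ⊠ x ^ i
        o = overflow a v
        A+oB≡0 : A ⊞ o • B ≡ 𝕠
        A+oB≡0 = begin
          A ⊞ o • B                        ≡⟨ cong (A ⊞_) (sym (act-• e o (x ^ i))) ⟩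
          A ⊞ e ⊠ (o • x ^ i)              ≡⟨ sym (act-⊞ e _ _) ⟩
          e ⊠ (act (shift a v) one ⊞ o • x ^ i) ≡⟨ cong (e ⊠_) (sym (act-shift a v)) ⟩
          e ⊠ act (a ∷ v) one              ≡⟨ eq ⟩
          𝕠                                ∎
        dependence : B ≡ e ⊠ act ((- o⁻¹) • shift a v) one
        dependence = begin
          B                                   ≡⟨ sym (•-identityˡ B) ⟩
          1# • B                              ≡⟨ cong (_• B) (trans (sym oo⁻¹≡1) (K.*-comm o o⁻¹)) ⟩
          (K._*_ o⁻¹ o) • B                   ≡⟨ sym (⊞-identityʳ _) ⟩
          (K._*_ o⁻¹ o) • B ⊞ 𝕠               ≡⟨ cong ((K._*_ o⁻¹ o) • B ⊞_) (sym (trans (cong ((- o⁻¹) •_) A+oB≡0) (•-zeroʳ _))) ⟩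
          (K._*_ o⁻¹ o) • B ⊞ (- o⁻¹) • (A ⊞ o • B) ≡⟨ combine o o⁻¹ A B ⟩
          (- o⁻¹) • A                         ≡⟨ sym (act-• e (- o⁻¹) _) ⟩
          e ⊠ ((- o⁻¹) • act (shift a v) one) ≡⟨ cong (e ⊠_) (sym (act-scalar (- o⁻¹) (shift a v) one)) ⟩
          e ⊠ act ((- o⁻¹) • shift a v) one   ∎
          where
          combine : ∀ {l} o i (A B : Vec Carrier l) → (K._*_ i o) • B ⊞ (- i) • (A ⊞ o • B) ≡ (- i) • A
          combine o i [] [] = refl
          combine o i (a ∷ A) (b ∷ B) = cong₂ _∷_
            (K.solve 4 (λ o i a b → (i K.:* o) K.:* b K.:+ (K.:- i) K.:* (a K.:+ o K.:* b) K.:= (K.:- i) K.:* a) refl o i a b)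
            (combine o i A B)

      module A′ = Algebra′ j c′

      -- An injective map from K[x]/(xʲ - c′) into eR, multiplicative because e is idempotent. It
      -- carries both conditions of `Good` back to j.
      φ : A′.V → V
      φ v = e ⊠ act v one

      φ-⊞ : ∀ u v → φ (u ⊞ v) ≡ φ u ⊞ φ v
      φ-⊞ u v = trans (cong (e ⊠_) (act-additive u v one)) (act-⊞ e _ _)

      φ-• : ∀ a v → φ (a • v) ≡ a • φ v
      φ-• a v = trans (cong (e ⊠_) (act-scalar a v one)) (act-• e a _)

      φ-S : ∀ v → φ (A′.S v) ≡ S (φ v)
      φ-S v = begin
        φ (shift 0# v ⊞ overflow 0# v • c′)                ≡⟨ trans (φ-⊞ (shift 0# v) (overflow 0# v • c′)) (cong (φ (shift 0# v) ⊞_) (φ-• (overflow 0# v) c′)) ⟩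
        φ (shift 0# v) ⊞ overflow 0# v • (e ⊠ act c′ one)
          ≡⟨ cong (λ t → φ (shift 0# v) ⊞ overflow 0# v • t) (sym (proj₂ (proj₁ (proj₂ (proj₂ relation))))) ⟩
        φ (shift 0# v) ⊞ overflow 0# v • (e ⊠ x ^ j)       ≡⟨ cong (φ (shift 0# v) ⊞_) (sym (act-• e _ _)) ⟩
        φ (shift 0# v) ⊞ e ⊠ (overflow 0# v • x ^ j)       ≡⟨ sym (act-⊞ e _ _) ⟩
        e ⊠ (act (shift 0# v) one ⊞ overflow 0# v • x ^ j) ≡⟨ cong (e ⊠_) (sym (act-shift 0# v)) ⟩
        e ⊠ (0# • one ⊞ S (act v one))                     ≡⟨ cong (e ⊠_) (trans (cong (_⊞ S (act v one)) (•-zeroˡ one)) (⊞-identityˡ _)) ⟩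
        e ⊠ S (act v one)                                  ≡⟨ act-S e _ ⟩
        S (φ v)                                            ∎

      φ-act : ∀ {l} (as : Vec Carrier l) v → φ (A′.act as v) ≡ act as (φ v)
      φ-act [] v = trans (cong (e ⊠_) (act-zeros j one)) (act-𝕠 e)
      φ-act (a ∷ as) v = trans (φ-⊞ (a • v) (A′.S (A′.act as v)))
        (cong₂ _⊞_ (φ-• a v) (trans (φ-S (A′.act as v)) (cong S (φ-act as v))))

      φ-⊠ : ∀ u v → φ (u A′.⊠ v) ≡ φ u ⊠ φ v
      φ-⊠ u v = begin
        φ (A′.act u v)                              ≡⟨ φ-act u v ⟩
        act u (φ v)                                 ≡⟨ act≡⊠ u (φ v) ⟩
        act u one ⊠ (e ⊠ act v one)                 ≡⟨ cong (λ t → act u one ⊠ (t ⊠ act v one)) (sym e²≡e) ⟩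
        act u one ⊠ (e ⊠ e ⊠ act v one)
          ≡⟨ R.solve 3 (λ a e b → a R.:* (e R.:* e R.:* b) R.:= (e R.:* a) R.:* (e R.:* b)) refl (act u one) e (act v one) ⟩
        φ u ⊠ φ v                                   ∎

      φ-𝕠 : φ 𝕠 ≡ 𝕠
      φ-𝕠 = φ-act [] 𝕠

      e≢0 : e ≢ 𝕠
      e≢0 refl = eW≢0 (R.zeroˡ W)

      act-one′ : ∀ {i} → 0 ℕ.< i → act (shift 1# (𝕠 {i})) one ≡ one
      act-one′ {suc i} _ = trans (cong₂ _⊞_ (•-identityˡ one) (trans (cong S (trans (cong (λ t → act t one) (shift-𝕠 i)) (act-zeros i one))) S-𝕠)) (⊞-identityʳ one)

      0<j : 0 ℕ.< j
      0<j = ℕₚ.n≢0⇒n>0 (λ j≡0 → nonzero j≡0 (proj₁ (proj₂ (proj₂ relation))))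
        where
        nonzero : ∀ {i} → i ≡ 0 → ¬ Dependent i
        nonzero refl ([] , eq) = e≢0 (trans (sym (act-one-id e)) (trans eq (act-𝕠 e)))

      φ-one : φ A′.one ≡ e
      φ-one = trans (cong (e ⊠_) (act-one′ 0<j)) (act-one-id e)

      φ-x : φ A′.x ≡ e ⊠ x
      φ-x = trans (φ-S A′.one) (trans (cong S φ-one) (trans (sym (x⊠ e)) (⊠-comm x e)))

      φ-x^ : ∀ i → φ (A′.R._^_ A′.x i) ≡ e ⊠ x ^ i
      φ-x^ zero    = trans φ-one (sym (act-one-id e))
      φ-x^ (suc i) = begin
        φ (A′.x A′.⊠ A′.R._^_ A′.x i)   ≡⟨ φ-⊠ A′.x (A′.R._^_ A′.x i) ⟩
        φ A′.x ⊠ φ (A′.R._^_ A′.x i)    ≡⟨ cong₂ _⊠_ φ-x (φ-x^ i) ⟩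
        (e ⊠ x) ⊠ (e ⊠ x ^ i)           ≡⟨ R.solve 3 (λ e a b → (e R.:* a) R.:* (e R.:* b) R.:= (e R.:* e) R.:* (a R.:* b)) refl e x (x ^ i) ⟩
        (e ⊠ e) ⊠ (x ⊠ x ^ i)           ≡⟨ cong (_⊠ (x ⊠ x ^ i)) e²≡e ⟩
        e ⊠ x ^ suc i                   ∎

      φ-⊟ : ∀ u → φ (⊟ u) ≡ ⊟ φ u
      φ-⊟ u = R.x-y≡0⇒x≡y (trans (cong (φ (⊟ u) ⊞_) (R.-‿involutive (φ u))) (trans (sym (φ-⊞ (⊟ u) u)) (trans (cong φ (⊞-inverseˡ u)) φ-𝕠)))

      φ-w : ∀ i → φ (A′.w i) ≡ e ⊠ w i
      φ-w zero    = trans φ-one (sym (act-one-id e))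
      φ-w (suc i) = begin
        φ ((A′.R._-_ (A′.R._^_ A′.x r) A′.x) A′.⊠ A′.w i)   ≡⟨ φ-⊠ (A′.R._-_ (A′.R._^_ A′.x r) A′.x) (A′.w i) ⟩
        φ (A′.R._-_ (A′.R._^_ A′.x r) A′.x) ⊠ φ (A′.w i)
          ≡⟨ cong₂ _⊠_ (trans (φ-⊞ (A′.R._^_ A′.x r) (⊟ A′.x)) (cong₂ _⊞_ (φ-x^ r) (trans (φ-⊟ A′.x) (cong ⊟_ φ-x)))) (φ-w i) ⟩
        (e ⊠ x ^ r ⊞ ⊟ (e ⊠ x)) ⊠ (e ⊠ w i)
          ≡⟨ R.solve 4 (λ e a b c → (e R.:* a R.:- e R.:* b) R.:* (e R.:* c) R.:= (e R.:* e) R.:* ((a R.:- b) R.:* c)) refl e (x ^ r) x (w i) ⟩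
        (e ⊠ e) ⊠ w (suc i)                                 ≡⟨ cong (_⊠ w (suc i)) e²≡e ⟩
        e ⊠ w (suc i)                                       ∎
        where r = p ℕ.^ suc i

      φ-injective : ∀ {u v} → φ u ≡ φ v → u ≡ v
      φ-injective {u} {v} eq = A′.R.x-y≡0⇒x≡y (independent ℕₚ.≤-refl _
        (trans (φ-⊞ u (⊟ v)) (trans (cong₂ _⊞_ eq (φ-⊟ v)) (R.-‿inverseʳ (φ v)))))

      j-good : Good j
      j-good = c′
        , φ-injective (trans (φ-x^ Q) (trans (cong (e ⊠_) x^Q≡x) (sym φ-x)))
        , λ W′≡0 → eW≢0 (trans (sym (φ-w (ℕ.pred n))) (trans (cong φ W′≡0) φ-𝕠))

      j≡m : j ≡ m
      j≡m = ℕₚ.≤-antisym (proj₁ (proj₂ relation)) (ℕₚ.≮⇒≥ (λ j<m → minimal j j<m j-good))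

      -- With j = m, multiplication by e is injective on the whole ring, and e (1 - e) = 0.
      idempotent≡one : e ≡ one
      idempotent≡one = sym (R.x-y≡0⇒x≡y (independent-m j≡m (trans (cong (e ⊠_) (act-one-id _)) (begin
        e ⊠ (one ⊞ ⊟ e)         ≡⟨ R.solve 1 (λ e → e R.:* (R.:1 R.:- e) R.:= e R.:- e R.:* e) refl e ⟩
        e ⊞ ⊟ (e ⊠ e)           ≡⟨ R.x≡y⇒x-y≡0 (sym e²≡e) ⟩
        𝕠                       ∎))))
        where
        independent-m : j ≡ m → ∀ {v : V} → e ⊠ act v one ≡ 𝕠 → v ≡ 𝕠
        independent-m j≡m {v} = independent (ℕₚ.≤-reflexive (sym j≡m)) v

    W≢0⇒1≢0 : one ≢ 𝕠
    W≢0⇒1≢0 one≡0 = W≢0 (trans (sym (R.*-identityˡ W)) (trans (cong (_⊠ W) one≡0) (R.zeroˡ W)))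

    -- For e = a^(Q-1), one of e W and (1 - e) W is nonzero because they add up to W. Hence e or 1 -
    -- e is 1, and e = 0 is impossible since a e = a ≠ 0.
    isField-V : 2 ℕ.≤ Q → R.IsField
    isField-V 2≤Q = record { 1≢0 = W≢0⇒1≢0 ; inverse = inverse }
      where
      r = Q ℕ.∸ 2
      Q≡ : Q ≡ suc (suc r)
      Q≡ = sym (ℕₚ.m+[n∸m]≡n 2≤Q)
      inverse : ∀ a → a ≢ 𝕠 → ∃ λ b → a ⊠ b ≡ one
      inverse a a≢0 = a ^ r , e≡one
        where
        e = a ⊠ a ^ r
        a²aʳ≡a : a ⊠ e ≡ a
        a²aʳ≡a = trans (cong (a ^_) (sym Q≡)) (x^Q≡x⇒v^Q≡v x^Q≡x a)
        e²≡e : e ⊠ e ≡ e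
        e²≡e = begin
          (a ⊠ a ^ r) ⊠ e    ≡⟨ R.solve 3 (λ a b e → (a R.:* b) R.:* e R.:= (a R.:* e) R.:* b) refl a (a ^ r) e ⟩
          (a ⊠ e) ⊠ a ^ r    ≡⟨ cong (_⊠ a ^ r) a²aʳ≡a ⟩
          e                  ∎
        f = one ⊞ ⊟ e
        f²≡f : f ⊠ f ≡ f
        f²≡f = begin
          f ⊠ f              ≡⟨ R.solve 1 (λ e → (R.:1 R.:- e) R.:* (R.:1 R.:- e)
                                  R.:= (R.:1 R.:- e) R.:+ (e R.:* e R.:- e)) refl e ⟩
          f ⊞ (e ⊠ e ⊞ ⊟ e)  ≡⟨ cong (f ⊞_) (R.x≡y⇒x-y≡0 e²≡e) ⟩
          f ⊞ 𝕠              ≡⟨ ⊞-identityʳ f ⟩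
          f                  ∎
        e≡one : e ≡ one
        e≡one with R._≟_ (e ⊠ W) 𝕠
        ... | no eW≢0  = idempotent≡one e e²≡e eW≢0
        ... | yes eW≡0 = contradiction (trans (sym a²aʳ≡a) (trans (cong (a ⊠_) e≡0) (R.zeroʳ a))) a≢0
          where
          fW≡W : f ⊠ W ≡ W
          fW≡W = begin
            f ⊠ W            ≡⟨ R.solve 2 (λ e w → (R.:1 R.:- e) R.:* w R.:= w R.:- e R.:* w) refl e W ⟩
            W ⊞ ⊟ (e ⊠ W)    ≡⟨ cong (λ t → W ⊞ ⊟ t) eW≡0 ⟩
            W R.- 𝕠          ≡⟨ R.solve 1 (λ w → w R.:- R.:0 R.:= w) refl W ⟩
            W                ∎
          e≡0 : e ≡ 𝕠
          e≡0 = begin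
            e                ≡⟨ R.solve 1 (λ e → e R.:= R.:1 R.:- (R.:1 R.:- e)) refl e ⟩
            one R.- f        ≡⟨ R.x≡y⇒x-y≡0 (sym (idempotent≡one f f²≡f (λ fW≡0 → W≢0 (trans (sym fW≡W) fW≡0)))) ⟩
            𝕠                ∎

module GaloisField (K : FiniteRing) (isField : FiniteRing.IsField K) {p : ℕ} (pr : Prime p)
  (char : ∀ a → FiniteRing._·_ K p a ≡ FiniteRing.0# K)
  (fermat : ∀ a → FiniteRing._^_ K a p ≡ a)
  (size≡p : FiniteRing.size K ≡ p)
  (n : ℕ) (1≤n : 1 ℕ.≤ n) where

  open FiniteRing K using (Carrier; 0#; 1#; -_)
  private module K = FiniteRing K
  open Vector K
  open QuotientField K isField pr char fermat n
  open ≡-Reasoning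

  1<p : 1 ℕ.< p
  1<p = ℕ.nonTrivial⇒n>1 p {{prime⇒nonTrivial pr}}

  private instance
    p-nonZero : NonZero p
    p-nonZero = ℕ.>-nonZero (ℕₚ.<⇒≤ 1<p)

  1<p^ : ∀ i → 1 ℕ.≤ i → 1 ℕ.< p ℕ.^ i
  1<p^ (suc i) _ = ℕₚ.≤-trans 1<p (ℕₚ.m≤m*n p (p ℕ.^ i) {{ℕₚ.m^n≢0 p i}})

  degree-w : ℕ → ℕ
  degree-w zero    = 0
  degree-w (suc i) = p ℕ.^ suc i ℕ.+ degree-w i

  -- That is p + ... + pⁱ < p^(i+1), by p ≥ 2. At i = n - 1 it puts the degree of W below Q.
  degree-w< : ∀ i → degree-w i ℕ.< p ℕ.^ suc i
  degree-w< zero    = ℕₚ.<⇒≤ (1<p^ 1 (s≤s z≤n))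
  degree-w< (suc i) = ℕₚ.<-≤-trans (ℕₚ.+-monoʳ-< q (degree-w< i))
    (subst (ℕ._≤ p ℕ.* q) (cong (λ t → q ℕ.+ t) (ℕₚ.+-identityʳ q)) (ℕₚ.*-monoˡ-≤ q 1<p))
    where q = p ℕ.^ suc i

  module Degree (m : ℕ) (c : Vec Carrier m) where
    open Algebra′ m c
    open R using (_^_)

    -- Compares two expansions of x times a vector with last coefficient 1: the definition of `S`
    -- produces c where `act-shift` produces x^m. The all-ones vector is one such choice.
    x^m≡c : 0 ℕ.< m → x ^ m ≡ c
    x^m≡c 0<m = begin
      x ^ m                                         ≡⟨ sym (•-identityˡ _) ⟩
      1# • x ^ m                                    ≡⟨ cong (_• x ^ m) (sym (overflow-ones 0# 0<m)) ⟩
      overflow 0# ones • x ^ m                      ≡⟨ cancelˡ (trans (cong (_⊞ overflow 0# ones • x ^ m) (sym (act-one-id (shift 0# ones))))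
                                                         (trans (sym (act-shift 0# ones)) S-ones)) ⟩
      overflow 0# ones • c                          ≡⟨ cong (_• c) (overflow-ones 0# 0<m) ⟩
      1# • c                                        ≡⟨ •-identityˡ c ⟩
      c                                             ∎
      where
      ones : V
      ones = replicate m 1#
      overflow-ones : ∀ {m} a → 0 ℕ.< m → overflow a (replicate m 1#) ≡ 1#
      overflow-ones {suc zero}    a _ = refl
      overflow-ones {suc (suc m)} a _ = overflow-ones {suc m} 1# (s≤s z≤n)
      S-ones : act (0# ∷ ones) one ≡ shift 0# ones ⊞ overflow 0# ones • c
      S-ones = trans (cong₂ _⊞_ (•-zeroˡ one) (cong S (act-one-id ones))) (⊞-identityˡ _)
      cancelˡ : ∀ {u v w : V} → u ⊞ v ≡ u ⊞ w → v ≡ w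
      cancelˡ {u} {v} {w} eq = begin
        v                  ≡⟨ sym (⊞-identityˡ v) ⟩
        𝕠 ⊞ v              ≡⟨ cong (_⊞ v) (sym (⊞-inverseˡ u)) ⟩
        (⊟ u ⊞ u) ⊞ v      ≡⟨ ⊞-assoc (⊟ u) u v ⟩
        ⊟ u ⊞ (u ⊞ v)      ≡⟨ cong (⊟ u ⊞_) eq ⟩
        ⊟ u ⊞ (u ⊞ w)      ≡⟨ sym (⊞-assoc (⊟ u) u w) ⟩
        (⊟ u ⊞ u) ⊞ w      ≡⟨ cong (_⊞ w) (⊞-inverseˡ u) ⟩
        𝕠 ⊞ w              ≡⟨ ⊞-identityˡ w ⟩
        w                  ∎

    -- as stands for the monic polynomial with the remaining coefficients as.
    monic : ∀ {d} → Vec Carrier d → V → V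
    monic []       v = v
    monic (a ∷ as) v = a • v ⊞ S (monic as v)

    -- The degree belongs to one way of writing v as a polynomial in x. When it is below m it
    -- certifies v ≠ 0, as no reduction has taken place.
    Monic : ℕ → V → Set
    Monic d v = ∃ λ (as : Vec Carrier d) → v ≡ monic as one

    monic-add : ∀ {d d′} → d′ ℕ.< d → ∀ a (bs : Vec Carrier d′) (cs : Vec Carrier d) v →
      ∃ λ (ds : Vec Carrier d) → a • monic bs v ⊞ monic cs v ≡ monic ds v
    monic-add {suc d} _ a [] (c ∷ cs) v = K._+_ a c ∷ cs ,
      trans (sym (⊞-assoc _ _ _)) (cong (_⊞ S (monic cs v)) (sym (•-distribʳ a c v)))
    monic-add {suc d} (s≤s d′<d) a (b ∷ bs) (c ∷ cs) v with monic-add d′<d a bs cs v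
    ... | ds , eq = K._+_ (K._*_ a b) c ∷ ds , (begin
      a • (b • v ⊞ S (monic bs v)) ⊞ (c • v ⊞ S (monic cs v))
        ≡⟨ cong (_⊞ (c • v ⊞ S (monic cs v))) (trans (•-distribˡ a _ _) (cong₂ _⊞_ (•-assoc a b v) (sym (S-• a _)))) ⟩
      (K._*_ a b • v ⊞ S (a • monic bs v)) ⊞ (c • v ⊞ S (monic cs v)) ≡⟨ ⊞-interchange _ _ _ _ ⟩
      (K._*_ a b • v ⊞ c • v) ⊞ (S (a • monic bs v) ⊞ S (monic cs v))
        ≡⟨ cong₂ _⊞_ (sym (•-distribʳ (K._*_ a b) c v)) (trans (sym (S-⊞ _ _)) (cong S eq)) ⟩
      (K._+_ (K._*_ a b) c) • v ⊞ S (monic ds v) ∎)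

    monic-monic : ∀ {d d′} (as : Vec Carrier d) (bs : Vec Carrier d′) v →
      ∃ λ (cs : Vec Carrier (d ℕ.+ d′)) → monic as (monic bs v) ≡ monic cs v
    monic-monic [] bs v = bs , refl
    monic-monic {suc d} {d′} (a ∷ as) bs v with monic-monic as bs v
    ... | cs , eq with monic-add (s≤s (ℕₚ.m≤n+m d′ d)) a bs (0# ∷ cs) v
    ...   | ds , eq′ = ds , trans (cong (a • monic bs v ⊞_) (trans (cong S eq)
              (sym (trans (cong (_⊞ S (monic cs v)) (•-zeroˡ v)) (⊞-identityˡ _))))) eq′

    monic≡⊠ : ∀ {d} (as : Vec Carrier d) v → monic as v ≡ monic as one ⊠ v
    monic≡⊠ [] v = sym (R.*-identityˡ v)
    monic≡⊠ (a ∷ as) v = begin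
      a • v ⊞ S (monic as v)
        ≡⟨ cong₂ _⊞_ (•≡⊠ a v) (trans (sym (x⊠ _)) (cong (x ⊠_) (monic≡⊠ as v))) ⟩
      (a • one) ⊠ v ⊞ x ⊠ (monic as one ⊠ v)  ≡⟨ cong ((a • one) ⊠ v ⊞_) (sym (⊠-assoc x _ v)) ⟩
      (a • one) ⊠ v ⊞ x ⊠ monic as one ⊠ v    ≡⟨ sym (R.distribʳ v (a • one) (x ⊠ monic as one)) ⟩
      (a • one ⊞ x ⊠ monic as one) ⊠ v        ≡⟨ cong (λ t → (a • one ⊞ t) ⊠ v) (x⊠ _) ⟩
      (a • one ⊞ S (monic as one)) ⊠ v        ∎

    Monic-⊠ : ∀ {d d′ u v} → Monic d u → Monic d′ v → Monic (d ℕ.+ d′) (u ⊠ v)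
    Monic-⊠ (as , refl) (bs , refl) with monic-monic as bs one
    ... | cs , eq = cs , trans (sym (monic≡⊠ as (monic bs one))) eq

    x^≡monic : ∀ i → x ^ i ≡ monic (𝕠 {i}) one
    x^≡monic zero    = refl
    x^≡monic (suc i) = trans (x⊠ _) (trans (cong S (x^≡monic i))
      (sym (trans (cong (_⊞ S (monic (𝕠 {i}) one)) (•-zeroˡ one)) (⊞-identityˡ _))))

    -1•≡⊟ : ∀ {l} (v : Vec Carrier l) → (- 1#) • v ≡ ⊟ v
    -1•≡⊟ [] = refl
    -1•≡⊟ (a ∷ v) = cong₂ _∷_ (trans (sym (K.-‿distribˡ-* 1# a)) (cong -_ (K.*-identityˡ a))) (-1•≡⊟ v)

    Monic-x^-x : ∀ {i} → 1 ℕ.< i → Monic i (x ^ i R.- x)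
    Monic-x^-x {i} 1<i with monic-add 1<i (- 1#) (0# ∷ []) (𝕠 {i}) one
    ... | ds , eq = ds , trans (⊞-comm _ _) (trans (cong₂ _⊞_ (sym (trans
            (cong ((- 1#) •_) (trans (cong (_⊞ x) (•-zeroˡ one)) (⊞-identityˡ x))) (-1•≡⊟ x))) (x^≡monic i)) eq)

    Monic-w : ∀ i → Monic (degree-w i) (w i)
    Monic-w zero    = [] , refl
    Monic-w (suc i) = Monic-⊠ (Monic-x^-x (1<p^ (suc i) (s≤s z≤n))) (Monic-w i)

    snoc-1 : ∀ {d} → Vec Carrier d → Vec Carrier (suc d)
    snoc-1 []       = 1# ∷ []
    snoc-1 (a ∷ as) = a ∷ snoc-1 as

    monic≡act : ∀ {d} (as : Vec Carrier d) v → monic as v ≡ act (snoc-1 as) v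
    monic≡act []       v = sym (trans (cong₂ _⊞_ (•-identityˡ v) S-𝕠) (⊞-identityʳ v))
    monic≡act (a ∷ as) v = cong (λ t → a • v ⊞ S t) (monic≡act as v)

    Monic≢0 : ∀ {d v} → d ℕ.< m → Monic d v → v ≢ 𝕠
    Monic≢0 d<m (as , refl) v≡0 = pad≢0 as d<m (trans (sym (act-one (snoc-1 as) d<m)) (trans (sym (monic≡act as one)) v≡0))
      where
      pad≢0 : ∀ {d m} (as : Vec Carrier d) → d ℕ.< m → pad m (snoc-1 as) ≢ 𝕠
      pad≢0 {m = suc m} []       _         eq = K.IsField.1≢0 isField (Vecₚ.∷-injectiveˡ eq)
      pad≢0 {m = suc m} (a ∷ as) (s≤s d<m) eq = pad≢0 as d<m (Vecₚ.∷-injectiveʳ eq)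

  suc-pred-n : suc (ℕ.pred n) ≡ n
  suc-pred-n = ℕₚ.suc-pred n {{ℕ.>-nonZero 1≤n}}

  1<Q : 1 ℕ.< Q
  1<Q = 1<p^ n 1≤n

  -- The starting point of the search: c = x makes the modulus x^Q - x, so x^Q = x by construction,
  -- and W is monic of degree below Q.
  good-Q : Good Q
  good-Q = c , trans (x^m≡c (ℕₚ.<⇒≤ 1<Q)) (sym x≡c)
      , Monic≢0 (subst (λ t → degree-w (ℕ.pred n) ℕ.< p ℕ.^ t) suc-pred-n (degree-w< (ℕ.pred n))) (Monic-w (ℕ.pred n))
    where
    c : Vec Carrier Q
    c = pad Q (0# ∷ 1# ∷ [])
    open Degree Q c
    open Algebra′ Q c
    x≡c : x ≡ c
    x≡c = begin
      S one                                   ≡⟨ cong S (sym (trans (cong₂ _⊞_ (•-identityˡ one) S-𝕠) (⊞-identityʳ one))) ⟩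
      S (act (1# ∷ []) one)                   ≡⟨ sym (trans (cong (_⊞ S (act (1# ∷ []) one)) (•-zeroˡ one)) (⊞-identityˡ _)) ⟩
      act (0# ∷ 1# ∷ []) one                  ≡⟨ act-one (0# ∷ 1# ∷ []) 1<Q ⟩
      pad Q (0# ∷ 1# ∷ [])                    ∎

  -- For the least m the quotient is a field. All its pᵐ elements are roots of x^Q - x, hence m ≤ n.
  -- It also satisfies x^(pᵐ) = x, which for m < n would make a factor of W vanish.
  galois-field : Σ (Vec Carrier n) λ c → FiniteRing.IsField (Quotient.ring-V K n c)
    × (∀ v → FiniteRing._^_ (Quotient.ring-V K n c) v Q ≡ v)
  galois-field with least Good? Q good-Q
  ... | m , _ , (c , x^Q≡x , W≢0) , minimal = subst
      (λ l → Σ (Vec Carrier l) λ c → FiniteRing.IsField (Quotient.ring-V K l c)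
        × (∀ v → FiniteRing._^_ (Quotient.ring-V K l c) v Q ≡ v))
      (ℕₚ.≤-antisym m≤n (ℕₚ.≮⇒≥ m≮n)) (c , field-V , x^Q≡x⇒v^Q≡v x^Q≡x)
    where
    open Algebra′ m c
    open R using (_^_)
    open Minimal m c minimal x^Q≡x W≢0
    field-V : R.IsField
    field-V = isField-V 1<Q
    m≤n : m ℕ.≤ n
    m≤n = ℕₚ.≮⇒≥ (λ n<m → ℕₚ.<⇒≱ (ℕₚ.^-monoʳ-< p 1<p n<m) (subst (λ s → s ℕ.^ m ℕ.≤ Q) size≡p
      (Polynomial.#fixed-by-power ring-V field-V 1<Q R.element element-injective (λ i → x^Q≡x⇒v^Q≡v x^Q≡x _))))
      where
      element-injective : ∀ {i j} → R.element i ≡ R.element j → i ≡ j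
      element-injective eq = trans (sym (R.index-element _)) (trans (cong R.index eq) (R.index-element _))
    w≡0 : ∀ i j → 1 ℕ.≤ j → j ℕ.≤ i → x ^ (p ℕ.^ j) ≡ x → w i ≡ 𝕠
    w≡0 zero    (suc j) _ () _
    w≡0 (suc i) j 1≤j j≤i+1 fixed with ℕₚ.m≤n⇒m<n∨m≡n j≤i+1
    ... | inj₂ refl = trans (cong (_⊠ w i) (R.x≡y⇒x-y≡0 fixed)) (R.zeroˡ (w i))
    ... | inj₁ (s≤s j≤i) = trans (cong (d ⊠_) (w≡0 i j 1≤j j≤i fixed)) (R.zeroʳ d)
      where d = x ^ (p ℕ.^ suc i) R.- x
    1≤m : 1 ℕ.≤ m
    1≤m = ℕₚ.n≢0⇒n>0 (λ m≡0 → FiniteRing.IsField.1≢0 field-V (trivial m≡0 _ _))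
      where
      trivial : ∀ {l} → l ≡ 0 → (u v : Vec Carrier l) → u ≡ v
      trivial refl [] [] = refl
    m≮n : ¬ (m ℕ.< n)
    m≮n m<n = W≢0 (w≡0 (ℕ.pred n) m 1≤m (ℕₚ.<⇒≤pred m<n)
      (subst (λ s → x ^ (s ℕ.^ m) ≡ x) size≡p (FiniteFieldFermat.x^size≡x ring-V field-V x)))

-- Matrices and k-th roots of triangular matrices

module Matrix (K : FiniteRing) where
  open FiniteRing K
  open import Algebra.Properties.Semiring.Sum semiring public
    using (sum; sum-cong-≗; ∑-distrib-+; *-distribˡ-sum; *-distribʳ-sum; sum-replicate-zero) renaming (∑-comm to sum-comm)
  open ≡-Reasoning

  M : ℕ → Set
  M n = Fin n → Fin n → Carrier

  infix 4 _≐_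
  _≐_ : ∀ {n} → M n → M n → Set
  A ≐ B = ∀ i j → A i j ≡ B i j

  infixl 6 _⊕_
  infixl 7 _⊗_
  _⊕_ _⊗_ : ∀ {n} → M n → M n → M n
  (A ⊕ B) i j = A i j + B i j
  (A ⊗ B) i j = sum (λ l → A i l * B l j)

  ⊝_ : ∀ {n} → M n → M n
  (⊝ A) i j = - A i j

  𝟘 𝟙 : ∀ {n} → M n
  𝟘 i j = 0#
  𝟙 i j with i Finₚ.≟ j
  ... | yes _ = 1#
  ... | no  _ = 0#

  𝟙-≡ : ∀ {n} {i j : Fin n} → i ≡ j → 𝟙 i j ≡ 1#
  𝟙-≡ {i = i} {j} i≡j with i Finₚ.≟ j
  ... | yes _  = refl
  ... | no i≢j = contradiction i≡j i≢j

  𝟙-≢ : ∀ {n} {i j : Fin n} → i ≢ j → 𝟙 i j ≡ 0#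
  𝟙-≢ {i = i} {j} i≢j with i Finₚ.≟ j
  ... | yes i≡j = contradiction i≡j i≢j
  ... | no _    = refl

  𝟙-suc : ∀ {n} (i j : Fin n) → 𝟙 (suc i) (suc j) ≡ 𝟙 i j
  𝟙-suc i j with i Finₚ.≟ j
  ... | yes _ = refl
  ... | no _  = refl

  sum-zero : ∀ {n} {g : Fin n → Carrier} → (∀ i → g i ≡ 0#) → sum g ≡ 0#
  sum-zero {n} g≡0 = trans (sum-cong-≗ g≡0) (sum-replicate-zero n)

  sum-𝟙ˡ : ∀ {n} (i : Fin n) (g : Fin n → Carrier) → sum (λ l → 𝟙 i l * g l) ≡ g i
  sum-𝟙ˡ {suc n} zero g = trans (cong₂ _+_ (*-identityˡ (g zero)) (sum-zero {n} (λ l → zeroˡ _))) (+-identityʳ _)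
  sum-𝟙ˡ {suc n} (suc i) g = trans (cong₂ _+_ (zeroˡ (g zero)) (trans (sum-cong-≗ {n} (λ l → cong (_* g (suc l)) (𝟙-suc i l))) (sum-𝟙ˡ i (g ∘ suc)))) (+-identityˡ _)

  𝟙-sym : ∀ {n} (i j : Fin n) → 𝟙 i j ≡ 𝟙 j i
  𝟙-sym i j with i Finₚ.≟ j
  ... | yes i≡j = sym (𝟙-≡ (sym i≡j))
  ... | no i≢j  = sym (𝟙-≢ (i≢j ∘ sym))

  sum-𝟙ʳ : ∀ {n} (j : Fin n) (g : Fin n → Carrier) → sum (λ l → g l * 𝟙 l j) ≡ g j
  sum-𝟙ʳ {n} j g = trans (sum-cong-≗ {n} (λ l → trans (*-comm (g l) _) (cong (_* g l) (𝟙-sym l j)))) (sum-𝟙ˡ j g)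

  ⊗-cong : ∀ {n} {A B C D : M n} → A ≐ B → C ≐ D → A ⊗ C ≐ B ⊗ D
  ⊗-cong {n} A≐B C≐D i j = sum-cong-≗ {n} (λ l → cong₂ _*_ (A≐B i l) (C≐D l j))

  ⊗-assoc : ∀ {n} (A B C : M n) → A ⊗ B ⊗ C ≐ A ⊗ (B ⊗ C)
  ⊗-assoc {n} A B C i j = begin
    sum {n} (λ l → sum {n} (λ h → A i h * B h l) * C l j)   ≡⟨ sum-cong-≗ {n} (λ l → *-distribʳ-sum {n} (C l j) _) ⟩
    sum {n} (λ l → sum {n} (λ h → A i h * B h l * C l j))   ≡⟨ sum-comm {n} {n} _ ⟩
    sum {n} (λ h → sum {n} (λ l → A i h * B h l * C l j))
      ≡⟨ sum-cong-≗ {n} (λ h → trans (sum-cong-≗ {n} (λ l → *-assoc _ _ _)) (sym (*-distribˡ-sum {n} (A i h) _))) ⟩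
    sum {n} (λ h → A i h * sum {n} (λ l → B h l * C l j))   ∎

  matrixRing : ℕ → Ring 0ℓ 0ℓ
  matrixRing n = record
    { Carrier = M n ; _≈_ = _≐_ ; _+_ = _⊕_ ; _*_ = _⊗_ ; -_ = ⊝_ ; 0# = 𝟘 ; 1# = 𝟙
    ; isRing = record
      { +-isAbelianGroup = record
        { isGroup = record
          { isMonoid = record
            { isSemigroup = record
              { isMagma = record
                { isEquivalence = record
                  { refl = λ i j → refl ; sym = λ eq i j → sym (eq i j) ; trans = λ eq eq′ i j → trans (eq i j) (eq′ i j) }
                ; ∙-cong = λ eq eq′ i j → cong₂ _+_ (eq i j) (eq′ i j) }
              ; assoc = λ A B C i j → +-assoc _ _ _ }
            ; identity = (λ A i j → +-identityˡ _) , λ A i j → +-identityʳ _ }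
          ; inverse = (λ A i j → -‿inverseˡ _) , λ A i j → -‿inverseʳ _
          ; ⁻¹-cong = λ eq i j → cong -_ (eq i j) }
        ; comm = λ A B i j → +-comm _ _ }
      ; *-cong = ⊗-cong
      ; *-assoc = ⊗-assoc
      ; *-identity = (λ A i j → sum-𝟙ˡ i (λ l → A l j)) , λ A i j → sum-𝟙ʳ j (A i)
      ; distrib = (λ A B C i j → trans (sum-cong-≗ {n} (λ l → distribˡ _ _ _)) (∑-distrib-+ {n} _ _))
                , λ A B C i j → trans (sum-cong-≗ {n} (λ l → distribʳ _ _ _)) (∑-distrib-+ {n} _ _) } }

  module _ {n : ℕ} where
    open Ring (matrixRing n) public using ()
      renaming ( refl to ≐-refl; sym to ≐-sym; trans to ≐-trans; semiring to matrixSemiring; setoid to matrixSetoid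
               ; *-identityˡ to ⊗-identityˡ; *-identityʳ to ⊗-identityʳ; distribˡ to ⊗-distribˡ; distribʳ to ⊗-distribʳ
               ; +-cong to ⊕-cong)
    open import Algebra.Properties.Semiring.Exp matrixSemiring public
      using () renaming (_^_ to _^ᵐ_; ^-congˡ to ^ᵐ-congˡ)

  InversePair : ∀ {n} → M n → M n → Set
  InversePair P P′ = P ⊗ P′ ≐ 𝟙 × P′ ⊗ P ≐ 𝟙

  SumOfInvertiblePowers : ∀ {n} → ℕ → M n → Set
  SumOfInvertiblePowers k C = ∃ λ A → ∃ λ A′ → ∃ λ B → ∃ λ B′ → InversePair A A′ × InversePair B B′ × A ^ᵐ k ⊕ B ^ᵐ k ≐ C

  module Triangular (isField : IsField) {p : ℕ} (pr : Prime p) (char : ∀ a → p · a ≡ 0#) where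

    ·ᵐ-entry : ∀ {n} m (A : M n) i j → SemiringMult._×_ matrixSemiring m A i j ≡ m · A i j
    ·ᵐ-entry zero    A i j = refl
    ·ᵐ-entry (suc m) A i j = cong (A i j +_) (·ᵐ-entry m A i j)

    -- Triangularity is relative to a rank ρ, so that one argument serves upper triangular matrices
    -- (`toℕ`) and lower ones (`toℕ ∘ opposite`).
    module _ {n : ℕ} (ρ : Fin n → ℕ) (ρ-injective : ∀ {i j} → ρ i ≡ ρ j → i ≡ j) where

      StrictlyUpper : M n → Set
      StrictlyUpper N = ∀ i j → ρ j ℕ.≤ ρ i → N i j ≡ 0#

      -- Each factor raises the rank by at least one.
      strictlyUpper-^ : ∀ {N} → StrictlyUpper N → ∀ m i j → ρ j ℕ.< ρ i ℕ.+ m → (N ^ᵐ m) i j ≡ 0#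
      strictlyUpper-^ strict zero i j lt = 𝟙-≢ (λ i≡j → ℕₚ.<⇒≢ (subst (ρ j ℕ.<_) (ℕₚ.+-identityʳ (ρ i)) lt) (cong ρ (sym i≡j)))
      strictlyUpper-^ {N} strict (suc m) i j lt = sum-zero {n} term
        where
        term : ∀ l → N i l * (N ^ᵐ m) l j ≡ 0#
        term l with ρ l ℕₚ.≤? ρ i
        ... | yes l≤i = trans (cong (_* (N ^ᵐ m) l j) (strict i l l≤i)) (zeroˡ _)
        ... | no l≰i  = trans (cong (N i l *_) (strictlyUpper-^ strict m l j
                (ℕₚ.<-≤-trans lt (ℕₚ.≤-trans (ℕₚ.≤-reflexive (ℕₚ.+-suc (ρ i) m)) (ℕₚ.+-monoˡ-≤ m (ℕₚ.≰⇒> l≰i)))))) (zeroʳ _)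

      scalar : Carrier → M n
      scalar a i j = a * 𝟙 i j

      scalar-⊗ : ∀ a A → scalar a ⊗ A ≐ λ i j → a * A i j
      scalar-⊗ a A i j = trans (sum-cong-≗ {n} (λ l → *-assoc a _ _))
        (trans (sym (*-distribˡ-sum {n} a _)) (cong (a *_) (sum-𝟙ˡ i (λ l → A l j))))

      ⊗-scalar : ∀ a A → A ⊗ scalar a ≐ λ i j → a * A i j
      ⊗-scalar a A i j = trans (sum-cong-≗ {n} (λ l → trans (sym (*-assoc _ a _)) (trans (cong (_* 𝟙 l j) (*-comm _ a)) (*-assoc a _ _))))
        (trans (sym (*-distribˡ-sum {n} a _)) (cong (a *_) (sum-𝟙ʳ j (A i))))

      scalar-^ : ∀ a i → scalar a ^ᵐ i ≐ scalar (a ^ i)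
      scalar-^ a zero    i j = sym (*-identityˡ _)
      scalar-^ a (suc m) i j = trans (scalar-⊗ a (scalar a ^ᵐ m) i j) (trans (cong (a *_) (scalar-^ a m i j)) (sym (*-assoc a _ _)))

      module _ (Y : M n) (t : Carrier) (upper : ∀ i j → ρ j ℕ.< ρ i → Y i j ≡ 0#)
        (diagonal : ∀ i → (Y i i - 1#) * (Y i i - t) ≡ 0#) where

        -- A term is nonzero only for ρ i ≤ ρ l ≤ ρ j. With ρ j ≤ ρ i this forces i = l = j, where
        -- the condition on the diagonal makes it 0.
        product-strict : StrictlyUpper ((Y ⊕ ⊝ 𝟙) ⊗ (Y ⊕ ⊝ scalar t))
        product-strict i j j≤i = sum-zero {n} term
          where
          ≢-of-< : ∀ {a b} → ρ b ℕ.< ρ a → a ≢ b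
          ≢-of-< lt refl = ℕₚ.n≮n _ lt
          vanish : ∀ a b s → ρ b ℕ.< ρ a → Y a b - s * 𝟙 a b ≡ 0#
          vanish a b s lt = trans (cong₂ (λ y o → y - s * o) (upper a b lt) (𝟙-≢ (≢-of-< lt)))
            (solve 1 (λ s → :0 :- s :* :0 := :0) refl s)
          term : ∀ l → (Y i l - 𝟙 i l) * (Y l j - t * 𝟙 l j) ≡ 0#
          term l with ρ l ℕₚ.<? ρ i | ρ j ℕₚ.<? ρ l
          ... | yes l<i | _ = trans (cong (_* (Y l j - t * 𝟙 l j)) (trans (cong (λ o → Y i l - o) (sym (*-identityˡ _))) (vanish i l 1# l<i))) (zeroˡ _)
          ... | no _ | yes j<l = trans (cong ((Y i l - 𝟙 i l) *_) (vanish l j t j<l)) (zeroʳ _)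
          ... | no l≮i | no j≮l with ρ-injective {i} {l} (ℕₚ.≤-antisym (ℕₚ.≮⇒≥ l≮i) (ℕₚ.≤-trans (ℕₚ.≮⇒≥ j≮l) j≤i))
                                   | ρ-injective {l} {j} (ℕₚ.≤-antisym (ℕₚ.≮⇒≥ j≮l) (ℕₚ.≤-trans j≤i (ℕₚ.≮⇒≥ l≮i)))
          ...   | refl | refl = trans (cong₂ (λ a b → (Y i i - a) * (Y i i - t * b)) (𝟙-≡ {i = i} refl) (𝟙-≡ {i = i} refl))
                (trans (cong (λ s → (Y i i - 1#) * (Y i i - s)) (*-identityʳ t)) (diagonal i))

        open Bicommutant (matrixRing n) Y
        private module B = CommutativeRing bicommutant
        open import Algebra.Properties.Semiring.Exp B.semiring using () renaming (_^_ to _^ᴮ_)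

        proj-· : ∀ m (A : B.Carrier) → proj₁ (SemiringMult._×_ B.semiring m A) ≐ SemiringMult._×_ matrixSemiring m (proj₁ A)
        proj-· zero    A i j = refl
        proj-· (suc m) A i j = cong (proj₁ A i j +_) (proj-· m A i j)

        proj-^ : ∀ m (A : B.Carrier) → proj₁ (A ^ᴮ m) ≐ proj₁ A ^ᵐ m
        proj-^ zero    A = ≐-refl {n} {𝟙}
        proj-^ (suc m) A = ⊗-cong (≐-refl {n} {proj₁ A}) (proj-^ m A)

        scalarᴮ : Carrier → B.Carrier
        scalarᴮ a = scalar a , λ z _ i j → trans (⊗-scalar a z i j) (sym (scalar-⊗ a z i j))

        proj-nilpotent : ∀ (N : B.Carrier) (N′ : M n) → proj₁ N ≐ N′ → StrictlyUpper N′ → ∀ e → (∀ i → ρ i ℕ.< e) →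
          proj₁ (N ^ᴮ e) ≐ 𝟘
        proj-nilpotent N N′ N≐N′ strict e ρ<e i j = trans (proj-^ e N i j) (trans (^ᵐ-congˡ {n} e {proj₁ N} {N′} N≐N′ i j)
          (strictlyUpper-^ strict e i j (ℕₚ.<-≤-trans (ρ<e j) (ℕₚ.m≤n+m e (ρ i)))))

        -- Scalar matrices lie in the bicommutant of Y, so the root can be taken in that commutative
        -- ring. As pᵐ exceeds every rank, the pᵐ-th power of the strictly triangular (Y - 1)(Y - t)
        -- is 0.
        triangular-root : ∀ {k} → ¬ (p ∣ k) → 1 ℕ.≤ k → ∀ m → 1 ℕ.≤ m → (∀ i → ρ i ℕ.< p ℕ.^ m) → ∀ c →
          c ^ (p ℕ.∸ 1) ≡ 1# → c ^ k ≡ t → t ≢ 1# →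
          ∃ λ X → ∃ λ X′ → X ^ᵐ k ≐ Y × InversePair X X′
        triangular-root {k} p∤k 1≤k m 1≤m ρ<e c c^[p-1]≡1 c^k≡t t≢1
          with IsField.inverse isField (t - 1#) (t≢1 ∘ x-y≡0⇒x≡y)
        ... | d , [t-1]d≡1 with TwoEigenvalues.root bicommutant pr
                (λ A i j → trans (proj-· p A i j) (trans (·ᵐ-entry p (proj₁ A) i j) (char _)))
                p∤k 1≤k m 1≤m (Y , λ z zy → zy) (scalarᴮ c) (scalarᴮ d) c-order d-inverse nilpotent
          where
          c^k : proj₁ (scalarᴮ c ^ᴮ k) ≐ scalar t
          c^k i j = trans (proj-^ k (scalarᴮ c) i j) (trans (scalar-^ c k i j) (cong (_* 𝟙 i j) c^k≡t))
          c-order : proj₁ (scalarᴮ c ^ᴮ (p ℕ.∸ 1)) ≐ 𝟙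
          c-order i j = trans (proj-^ (p ℕ.∸ 1) (scalarᴮ c) i j) (trans (scalar-^ c (p ℕ.∸ 1) i j)
            (trans (cong (_* 𝟙 i j) c^[p-1]≡1) (*-identityˡ _)))
          d-inverse : scalar d ⊗ (proj₁ (scalarᴮ c ^ᴮ k) ⊕ ⊝ 𝟙) ≐ 𝟙
          d-inverse i j = begin
            (scalar d ⊗ (proj₁ (scalarᴮ c ^ᴮ k) ⊕ ⊝ 𝟙)) i j  ≡⟨ scalar-⊗ d (proj₁ (scalarᴮ c ^ᴮ k) ⊕ ⊝ 𝟙) i j ⟩
            d * (proj₁ (scalarᴮ c ^ᴮ k) i j - 𝟙 i j)          ≡⟨ cong (λ s → d * (s - 𝟙 i j)) (c^k i j) ⟩
            d * (t * 𝟙 i j - 𝟙 i j)                           ≡⟨ solve 3 (λ d t o → d :* (t :* o :- o) := (t :- :1) :* d :* o) refl d t (𝟙 i j) ⟩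
            (t - 1#) * d * 𝟙 i j                              ≡⟨ trans (cong (_* 𝟙 i j) [t-1]d≡1) (*-identityˡ _) ⟩
            𝟙 i j                                             ∎
          nilpotent : proj₁ ((((Y , λ z zy → zy) B.- B.1#) B.* ((Y , λ z zy → zy) B.- scalarᴮ c ^ᴮ k)) ^ᴮ (p ℕ.^ m)) ≐ 𝟘
          nilpotent = proj-nilpotent (((Y , λ z zy → zy) B.- B.1#) B.* ((Y , λ z zy → zy) B.- scalarᴮ c ^ᴮ k))
            ((Y ⊕ ⊝ 𝟙) ⊗ (Y ⊕ ⊝ scalar t))
            (⊗-cong (≐-refl {n} {Y ⊕ ⊝ 𝟙}) (λ i j → cong (λ s → Y i j - s) (c^k i j)))
            product-strict (p ℕ.^ m) ρ<e
        ...   | X , X′ , X^k≈Y , XX′≈1 = proj₁ X , proj₁ X′ , (λ i j → trans (sym (proj-^ k X i j)) (X^k≈Y i j))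
                , XX′≈1 , (λ i j → trans (B.*-comm X′ X i j) (XX′≈1 i j))

-- Prescribing the diagonal of a non-scalar matrix by similarity (Fillmore)

module Fillmore (K : FiniteRing) (isField : FiniteRing.IsField K) where
  open FiniteRing K
  open Matrix K
  open IsField isField
  open ≡-Reasoning

  shear : ∀ {n} → Fin n → Fin n → Carrier → M n
  shear a b s i j = 𝟙 i j + s * (𝟙 i a * 𝟙 b j)

  shear-⊗ : ∀ {n} a b s (A : M n) → shear a b s ⊗ A ≐ λ i j → A i j + s * (𝟙 i a * A b j)
  shear-⊗ {n} a b s A i j = begin
    sum {n} (λ l → (𝟙 i l + s * (𝟙 i a * 𝟙 b l)) * A l j)
      ≡⟨ sum-cong-≗ {n} (λ l → solve 5 (λ o s x y z → (o :+ s :* (x :* y)) :* z := o :* z :+ (s :* x) :* (y :* z)) refl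
           (𝟙 i l) s (𝟙 i a) (𝟙 b l) (A l j)) ⟩
    sum {n} (λ l → 𝟙 i l * A l j + (s * 𝟙 i a) * (𝟙 b l * A l j))  ≡⟨ ∑-distrib-+ {n} _ _ ⟩
    sum {n} (λ l → 𝟙 i l * A l j) + sum {n} (λ l → (s * 𝟙 i a) * (𝟙 b l * A l j))
      ≡⟨ cong₂ _+_ (sum-𝟙ˡ i (λ l → A l j)) (trans (sym (*-distribˡ-sum {n} (s * 𝟙 i a) _)) (cong ((s * 𝟙 i a) *_) (sum-𝟙ˡ b (λ l → A l j)))) ⟩
    A i j + (s * 𝟙 i a) * A b j                                      ≡⟨ cong (A i j +_) (*-assoc s _ _) ⟩
    A i j + s * (𝟙 i a * A b j)                                      ∎

  ⊗-shear : ∀ {n} a b s (A : M n) → A ⊗ shear a b s ≐ λ i j → A i j + s * (A i a * 𝟙 b j)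
  ⊗-shear {n} a b s A i j = begin
    sum {n} (λ l → A i l * (𝟙 l j + s * (𝟙 l a * 𝟙 b j)))
      ≡⟨ sum-cong-≗ {n} (λ l → solve 5 (λ o s x y z → z :* (o :+ s :* (x :* y)) := z :* o :+ (s :* y) :* (z :* x)) refl
           (𝟙 l j) s (𝟙 l a) (𝟙 b j) (A i l)) ⟩
    sum {n} (λ l → A i l * 𝟙 l j + (s * 𝟙 b j) * (A i l * 𝟙 l a))  ≡⟨ ∑-distrib-+ {n} _ _ ⟩
    sum {n} (λ l → A i l * 𝟙 l j) + sum {n} (λ l → (s * 𝟙 b j) * (A i l * 𝟙 l a))
      ≡⟨ cong₂ _+_ (sum-𝟙ʳ j (A i)) (trans (sym (*-distribˡ-sum {n} (s * 𝟙 b j) _)) (cong ((s * 𝟙 b j) *_) (sum-𝟙ʳ a (A i)))) ⟩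
    A i j + (s * 𝟙 b j) * A i a
      ≡⟨ cong (A i j +_) (solve 3 (λ s x y → (s :* x) :* y := s :* (y :* x)) refl s (𝟙 b j) (A i a)) ⟩
    A i j + s * (A i a * 𝟙 b j)                                      ∎

  shear-inverse : ∀ {n} {a b : Fin n} → a ≢ b → ∀ s s′ → s + s′ ≡ 0# → shear a b s ⊗ shear a b s′ ≐ 𝟙
  shear-inverse {a = a} {b} a≢b s s′ s+s′≡0 i j = begin
    (shear a b s ⊗ shear a b s′) i j                                   ≡⟨ shear-⊗ a b s (shear a b s′) i j ⟩
    shear a b s′ i j + s * (𝟙 i a * (𝟙 b j + s′ * (𝟙 b a * 𝟙 b j)))   ≡⟨ cong (λ o → shear a b s′ i j + s * (𝟙 i a * (𝟙 b j + s′ * (o * 𝟙 b j)))) (𝟙-≢ (a≢b ∘ sym)) ⟩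
    𝟙 i j + s′ * (𝟙 i a * 𝟙 b j) + s * (𝟙 i a * (𝟙 b j + s′ * (0# * 𝟙 b j)))
      ≡⟨ solve 5 (λ o s s′ x y → o :+ s′ :* (x :* y) :+ s :* (x :* (y :+ s′ :* (:0 :* y))) := o :+ (s :+ s′) :* (x :* y)) refl
           (𝟙 i j) s s′ (𝟙 i a) (𝟙 b j) ⟩
    𝟙 i j + (s + s′) * (𝟙 i a * 𝟙 b j)                                 ≡⟨ cong (λ t → 𝟙 i j + t * (𝟙 i a * 𝟙 b j)) s+s′≡0 ⟩
    𝟙 i j + 0# * (𝟙 i a * 𝟙 b j)                                       ≡⟨ solve 2 (λ o x → o :+ :0 :* x := o) refl _ _ ⟩
    𝟙 i j                                                              ∎

  opaque
    -- Conjugation by a shear, entry by entry: s times row b is added to row a, then s times the new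
    -- column a is subtracted from column b.
    conj : ∀ {n} → Fin n → Fin n → Carrier → M n → M n
    conj a b s C i j = C i j + s * (𝟙 i a * C b j) - s * ((C i a + s * (𝟙 i a * C b a)) * 𝟙 b j)

    conj≐ : ∀ {n} a b s (C : M n) → conj a b s C ≐ shear a b s ⊗ C ⊗ shear a b (- s)
    conj≐ a b s C i j = sym (trans (⊗-shear a b (- s) (shear a b s ⊗ C) i j)
      (trans (cong₂ (λ x y → x + - s * (y * 𝟙 b j)) (shear-⊗ a b s C i j) (shear-⊗ a b s C i a))
        (solve 3 (λ x s y → x :+ (:- s) :* y := x :- s :* y) refl _ s _)))

    conj-cong : ∀ {n} a b s {C D : M n} → C ≐ D → conj a b s C ≐ conj a b s D
    conj-cong a b s C≐D i j = cong₂ (λ x y → x - s * (y * 𝟙 b j))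
      (cong₂ (λ x y → x + s * (𝟙 i a * y)) (C≐D i j) (C≐D b j))
      (cong₂ (λ x y → x + s * (𝟙 i a * y)) (C≐D i a) (C≐D b a))

    conj-row : ∀ {n} {a b : Fin n} s (C : M n) j → b ≢ j → conj a b s C a j ≡ C a j + s * C b j
    conj-row {a = a} {b} s C j b≢j = trans (cong₂ (λ x y → C a j + s * (x * C b j) - s * ((C a a + s * (x * C b a)) * y)) (𝟙-≡ {i = a} refl) (𝟙-≢ b≢j))
      (solve 4 (λ c s x y → c :+ s :* (:1 :* x) :- s :* (y :* :0) := c :+ s :* x) refl (C a j) s (C b j) (C a a + s * (1# * C b a)))

    conj-column : ∀ {n} {a b : Fin n} s (C : M n) i → i ≢ a → conj a b s C i b ≡ C i b - s * C i a
    conj-column {a = a} {b} s C i i≢a = trans (cong₂ (λ x y → C i b + s * (x * C b b) - s * ((C i a + s * (x * C b a)) * y)) (𝟙-≢ i≢a) (𝟙-≡ {i = b} refl))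
      (solve 5 (λ c s x y z → c :+ s :* (:0 :* x) :- s :* ((y :+ s :* (:0 :* z)) :* :1) := c :- s :* y) refl
        (C i b) s (C b b) (C i a) (C b a))

    conj-fixed : ∀ {n} {a b : Fin n} s (C : M n) i j → i ≢ a → b ≢ j → conj a b s C i j ≡ C i j
    conj-fixed {a = a} {b} s C i j i≢a b≢j = trans (cong₂ (λ x y → C i j + s * (x * C b j) - s * ((C i a + s * (x * C b a)) * y)) (𝟙-≢ i≢a) (𝟙-≢ b≢j))
      (solve 4 (λ c s x y → c :+ s :* (:0 :* x) :- s :* (y :* :0) := c) refl (C i j) s (C b j) (C i a + s * (0# * C b a)))

    conj-corner : ∀ {n} {a b : Fin n} s (C : M n) → conj a b s C a b ≡ C a b + s * C b b - s * (C a a + s * C b a)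
    conj-corner {a = a} {b} s C = trans (cong₂ (λ x y → C a b + s * (x * C b b) - s * ((C a a + s * (x * C b a)) * y)) (𝟙-≡ {i = a} refl) (𝟙-≡ {i = b} refl))
      (solve 5 (λ c s x y z → c :+ s :* (:1 :* x) :- s :* ((y :+ s :* (:1 :* z)) :* :1) := c :+ s :* x :- s :* (y :+ s :* z)) refl
        (C a b) s (C b b) (C a a) (C b a))

  trace : ∀ {n} → M n → Carrier
  trace {n} C = sum {n} (λ i → C i i)

  opaque
    unfolding conj
    trace-conj : ∀ {n} {a b : Fin n} → a ≢ b → ∀ s (C : M n) → trace (conj a b s C) ≡ trace C
    trace-conj {n} {a} {b} a≢b s C = begin
      sum {n} (λ i → conj a b s C i i)    ≡⟨ sum-cong-≗ {n} pointwise ⟩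
      sum {n} (λ i → C i i + (s * (𝟙 a i * C b i) + - s * (𝟙 b i * C i a)))   ≡⟨ ∑-distrib-+ {n} _ _ ⟩
      trace C + sum {n} (λ i → s * (𝟙 a i * C b i) + - s * (𝟙 b i * C i a))   ≡⟨ cong (trace C +_) (∑-distrib-+ {n} _ _) ⟩
      trace C + (sum {n} (λ i → s * (𝟙 a i * C b i)) + sum {n} (λ i → - s * (𝟙 b i * C i a)))
        ≡⟨ cong₂ (λ x y → trace C + (x + y))
             (trans (sym (*-distribˡ-sum {n} s _)) (cong (s *_) (sum-𝟙ˡ a (C b))))
             (trans (sym (*-distribˡ-sum {n} (- s) _)) (cong (- s *_) (sum-𝟙ˡ b (λ i → C i a)))) ⟩
      trace C + (s * C b a + - s * C b a)  ≡⟨ solve 3 (λ t s x → t :+ (s :* x :+ (:- s) :* x) := t) refl (trace C) s (C b a) ⟩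
      trace C                              ∎
      where
      pointwise : ∀ i → conj a b s C i i ≡ C i i + (s * (𝟙 a i * C b i) + - s * (𝟙 b i * C i a))
      pointwise i with i Finₚ.≟ a
      ... | no i≢a = trans (solve 6 (λ c s x y z w → c :+ s :* (:0 :* x) :- s :* ((y :+ s :* (:0 :* z)) :* w) := c :+ (s :* (:0 :* x) :+ (:- s) :* (w :* y))) refl
              (C i i) s (C b i) (C i a) (C b a) (𝟙 b i))
            (cong (λ x → C i i + (s * (x * C b i) + - s * (𝟙 b i * C i a))) (sym (𝟙-≢ (i≢a ∘ sym))))
      ... | yes refl = trans (cong (λ y → C i i + s * (1# * C b i) - s * ((C i a + s * (1# * C b a)) * y)) (𝟙-≢ (a≢b ∘ sym)))
            (trans (solve 4 (λ c s x y → c :+ s :* (:1 :* x) :- s :* (y :* :0) := c :+ (s :* (:1 :* x) :+ (:- s) :* (:0 :* c))) refl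
              (C i i) s (C b i) (C i i + s * (1# * C b i)))
            (cong₂ (λ x y → C i i + (s * (x * C b i) + - s * (y * C i i))) (sym (𝟙-≡ {i = i} refl)) (sym (𝟙-≢ (a≢b ∘ sym)))))

  infix 4 _⇝_
  -- Chains of shears rather than arbitrary similarities, because a shear of the lower right block
  -- extends to the whole matrix without moving entry (0,0).
  data _⇝_ {n} (C D : M n) : Set where
    done : C ≐ D → C ⇝ D
    step : ∀ {a b} s → a ≢ b → conj a b s C ⇝ D → C ⇝ D

  ⇝-trans : ∀ {n} {C D E : M n} → C ⇝ D → D ⇝ E → C ⇝ E
  ⇝-trans (step s a≢b C⇝D) D⇝E = step s a≢b (⇝-trans C⇝D D⇝E)
  ⇝-trans (done C≐D) D⇝E = resp C≐D D⇝E
    where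
    resp : ∀ {n} {C D E : M n} → C ≐ D → D ⇝ E → C ⇝ E
    resp C≐D (done D≐E)               = done (λ i j → trans (C≐D i j) (D≐E i j))
    resp C≐D (step {a} {b} s a≢b D⇝E) = step s a≢b (resp (conj-cong a b s C≐D) D⇝E)

  ⇝-step : ∀ {n} {a b : Fin n} s {C} → a ≢ b → C ⇝ conj a b s C
  ⇝-step s a≢b = step s a≢b (done (λ _ _ → refl))

  trace-⇝ : ∀ {n} {C D : M n} → C ⇝ D → trace C ≡ trace D
  trace-⇝ {n} (done C≐D)     = sum-cong-≗ {n} (λ i → C≐D i i)
  trace-⇝ {C = C} (step s a≢b C⇝D) = trans (sym (trace-conj a≢b s C)) (trace-⇝ C⇝D)

  ⇝⇒similar : ∀ {n} {C D : M n} → C ⇝ D → ∃ λ P → ∃ λ P′ → InversePair P P′ × C ≐ P ⊗ D ⊗ P′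
  ⇝⇒similar {n} {C} {D} (done C≐D) = 𝟙 , 𝟙 , (⊗-identityˡ {n} 𝟙 , ⊗-identityˡ {n} 𝟙)
    , ≐-trans {n} {C} {D} C≐D (≐-sym {n} {𝟙 ⊗ D ⊗ 𝟙} {D} (≐-trans {n} {𝟙 ⊗ D ⊗ 𝟙} {𝟙 ⊗ D} (⊗-identityʳ {n} (𝟙 ⊗ D)) (⊗-identityˡ {n} D)))
  ⇝⇒similar {n} {C} {D} (step {a} {b} s a≢b C⇝D) with ⇝⇒similar C⇝D
  ... | P , P′ , (PP′≐𝟙 , P′P≐𝟙) , eq = S′ ⊗ P , P′ ⊗ S
      , (cancel-inner {S′} {S} {P} {P′} S′S≐𝟙 PP′≐𝟙 , cancel-inner {P′} {P} {S} {S′} P′P≐𝟙 SS′≐𝟙)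
      , λ i j → trans (conjugate-back {S} {S′} {C} {P ⊗ D ⊗ P′} S′S≐𝟙 (λ i j → trans (sym (conj≐ a b s C i j)) (eq i j)) i j)
                      (conjugate-conjugate S′ P D P′ S i j)
    where
    open Conjugation (matrixRing n)
    S  = shear a b s
    S′ = shear a b (- s)
    SS′≐𝟙 : S ⊗ S′ ≐ 𝟙
    SS′≐𝟙 = shear-inverse a≢b s (- s) (-‿inverseʳ s)
    S′S≐𝟙 : S′ ⊗ S ≐ 𝟙
    S′S≐𝟙 = shear-inverse a≢b (- s) s (-‿inverseˡ s)

  lower : ∀ {n} → M (suc n) → M n
  lower C i j = C (suc i) (suc j)

  opaque
    unfolding conj
    lower-conj : ∀ {n} a b s (C : M (suc n)) → lower (conj (suc a) (suc b) s C) ≐ conj a b s (lower C)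
    lower-conj a b s C i j = cong₂ (λ x y → C (suc i) (suc j) + s * (x * C (suc b) (suc j)) - s * ((C (suc i) (suc a) + s * (x * C (suc b) (suc a))) * y))
      (𝟙-suc i a) (𝟙-suc b j)

  ⇝-lift : ∀ {n} {C₁ D₁ : M n} → C₁ ⇝ D₁ → ∀ (C : M (suc n)) → lower C ≐ C₁ →
    ∃ λ D → C ⇝ D × lower D ≐ D₁ × D zero zero ≡ C zero zero
  ⇝-lift (done C₁≐D₁) C eq = C , done (λ _ _ → refl) , (λ i j → trans (eq i j) (C₁≐D₁ i j)) , refl
  ⇝-lift (step {a} {b} s a≢b C₁⇝D₁) C eq with ⇝-lift C₁⇝D₁ (conj (suc a) (suc b) s C)
      (λ i j → trans (lower-conj a b s C i j) (conj-cong a b s eq i j))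
  ... | D , C⇝D , lower≐ , D₀₀≡ = D , step s (a≢b ∘ Finₚ.suc-injective) C⇝D , lower≐
      , trans D₀₀≡ (conj-fixed s C zero zero (λ ()) (λ ()))

  divide : ∀ x y {z} → z ≢ 0# → ∃ λ s → x + s * z ≡ y
  divide x y {z} z≢0 with inverse z z≢0
  ... | z⁻¹ , zz⁻¹≡1 = (y - x) * z⁻¹ , (begin
    x + (y - x) * z⁻¹ * z    ≡⟨ solve 4 (λ x y z w → x :+ (y :- x) :* w :* z := x :+ (y :- x) :* (z :* w)) refl x y z z⁻¹ ⟩
    x + (y - x) * (z * z⁻¹)  ≡⟨ cong (λ t → x + (y - x) * t) zz⁻¹≡1 ⟩
    x + (y - x) * 1#         ≡⟨ solve 2 (λ x y → x :+ (y :- x) :* :1 := y) refl x y ⟩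
    y                        ∎)

  +-cancelˡ : ∀ {x y z} → x + y ≡ x + z → y ≡ z
  +-cancelˡ {x} {y} {z} eq = x-y≡0⇒x≡y (trans (solve 3 (λ x y z → y :- z := (x :+ y) :- (x :+ z)) refl x y z) (x≡y⇒x-y≡0 eq))

  pattern 0F = zero
  pattern 1F = suc zero
  pattern 2F = suc (suc zero)

  -- Entry (2,1) is entry (1,0) of the lower right block, so its being nonzero keeps the induction
  -- going. It is arranged first; then row 2, whose entry (2,0) is nonzero, corrects entry (0,0) and
  -- leaves (2,1) alone.
  clear-first : ∀ {n} (C : M (3 ℕ.+ n)) → C 1F 0F ≢ 0# → ∀ a →
    ∃ λ D → C ⇝ D × D 0F 0F ≡ a × D 2F 1F ≢ 0#
  clear-first C C₁₀≢0 a = fix-00 (reach-20 (C 2F 0F ≟ 0#))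
    where
    reach-20 : Dec (C 2F 0F ≡ 0#) → ∃ λ C₁ → C ⇝ C₁ × C₁ 2F 0F ≢ 0#
    reach-20 (no ≢0)  = C , done (λ _ _ → refl) , ≢0
    reach-20 (yes ≡0) = conj 2F 1F 1# C , ⇝-step 1# (λ ()) , λ eq → C₁₀≢0 (begin
      C 1F 0F                    ≡⟨ solve 1 (λ x → x := :0 :+ :1 :* x) refl _ ⟩
      0# + 1# * C 1F 0F          ≡⟨ cong (_+ 1# * C 1F 0F) (sym ≡0) ⟩
      C 2F 0F + 1# * C 1F 0F     ≡⟨ sym (conj-row {a = 2F} {1F} 1# C 0F (λ ())) ⟩
      conj 2F 1F 1# C 2F 0F      ≡⟨ eq ⟩
      0#                         ∎)
    reach-21 : ∀ C₁ → C₁ 2F 0F ≢ 0# → Dec (C₁ 2F 1F ≡ 0#) → ∃ λ C₂ → C₁ ⇝ C₂ × C₂ 2F 0F ≢ 0# × C₂ 2F 1F ≢ 0#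
    reach-21 C₁ ≢0 (no ≢0′)  = C₁ , done (λ _ _ → refl) , ≢0 , ≢0′
    reach-21 C₁ ≢0 (yes ≡0) = conj 0F 1F 1# C₁ , ⇝-step 1# (λ ())
      , (λ eq → ≢0 (trans (sym (conj-fixed {a = 0F} {1F} 1# C₁ 2F 0F (λ ()) (λ ()))) eq))
      , λ eq → ≢0 (begin
        C₁ 2F 0F                               ≡⟨ solve 1 (λ x → x := :- (:0 :- :1 :* x)) refl _ ⟩
        - (0# - 1# * C₁ 2F 0F)                 ≡⟨ cong (λ t → - (t - 1# * C₁ 2F 0F)) (sym ≡0) ⟩
        - (C₁ 2F 1F - 1# * C₁ 2F 0F)           ≡⟨ cong -_ (sym (conj-column {a = 0F} {1F} 1# C₁ 2F (λ ()))) ⟩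
        - conj 0F 1F 1# C₁ 2F 1F               ≡⟨ cong -_ eq ⟩
        - 0#                                   ≡⟨ -0#≈0# ⟩
        0#                                     ∎)
    fix-00 : (∃ λ C₁ → C ⇝ C₁ × C₁ 2F 0F ≢ 0#) → ∃ λ D → C ⇝ D × D 0F 0F ≡ a × D 2F 1F ≢ 0#
    fix-00 (C₁ , C⇝C₁ , ≢0) with reach-21 C₁ ≢0 (C₁ 2F 1F ≟ 0#)
    ... | C₂ , C₁⇝C₂ , ≢0′ , ≢0″ with divide (C₂ 0F 0F) a ≢0′
    ...   | s , eq = conj 0F 2F s C₂ , ⇝-trans C⇝C₁ (⇝-trans C₁⇝C₂ (⇝-step s (λ ())))
            , trans (conj-row {a = 0F} {2F} s C₂ 0F (λ ())) eq
            , λ ≡0 → ≢0″ (trans (sym (conj-fixed {a = 0F} {2F} s C₂ 2F 1F (λ ()) (λ ()))) ≡0)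

  -- One diagonal entry is set at a time. The last one comes out right because shears preserve the
  -- trace.
  prescribe-diagonal : ∀ {n} (C : M (suc (suc n))) → C 1F 0F ≢ 0# → (d : Fin (suc (suc n)) → Carrier) → sum d ≡ trace C →
    ∃ λ D → C ⇝ D × (∀ i → D i i ≡ d i)
  prescribe-diagonal {zero} C C₁₀≢0 d ∑d≡tr with divide (C 0F 0F) (d 0F) C₁₀≢0
  ... | s , eq = conj 0F 1F s C , ⇝-step s (λ ()) , diagonal
    where
    D = conj 0F 1F s C
    D₀₀≡ : D 0F 0F ≡ d 0F
    D₀₀≡ = trans (conj-row {a = 0F} {1F} s C 0F (λ ())) eq
    diagonal : ∀ i → D i i ≡ d i
    diagonal 0F = D₀₀≡
    diagonal 1F = begin
      D 1F 1F         ≡⟨ sym (+-identityʳ _) ⟩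
      D 1F 1F + 0#    ≡⟨ +-cancelˡ {d 0F} (trans (cong (_+ (D 1F 1F + 0#)) (sym D₀₀≡)) (trans (trace-conj (λ ()) s C) (sym ∑d≡tr))) ⟩
      d 1F + 0#       ≡⟨ +-identityʳ _ ⟩
      d 1F            ∎
  prescribe-diagonal {suc n} C C₁₀≢0 d ∑d≡tr = recurse (clear-first C C₁₀≢0 (d 0F))
    where
    Goal = ∃ λ D → C ⇝ D × (∀ i → D i i ≡ d i)
    extend : ∀ C₁ → C ⇝ C₁ → C₁ 0F 0F ≡ d 0F →
      (∃ λ D₁ → lower C₁ ⇝ D₁ × (∀ i → D₁ i i ≡ d (suc i))) → Goal
    extend C₁ C⇝C₁ C₁₀₀≡ (D₁ , low⇝D₁ , diag) with ⇝-lift low⇝D₁ C₁ (λ _ _ → refl)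
    ... | D , C₁⇝D , low≐ , D₀₀≡ = D , ⇝-trans C⇝C₁ C₁⇝D , diagonal
      where
      diagonal : ∀ i → D i i ≡ d i
      diagonal 0F      = trans D₀₀≡ C₁₀₀≡
      diagonal (suc i) = trans (low≐ i i) (diag i)
    recurse : (∃ λ C₁ → C ⇝ C₁ × C₁ 0F 0F ≡ d 0F × C₁ 2F 1F ≢ 0#) → Goal
    recurse (C₁ , C⇝C₁ , C₁₀₀≡ , ≢0) = extend C₁ C⇝C₁ C₁₀₀≡ (prescribe-diagonal (lower C₁) ≢0 (d ∘ suc)
      (+-cancelˡ {d 0F} (trans ∑d≡tr (trans (trace-⇝ C⇝C₁) (cong (_+ trace (lower C₁)) C₁₀₀≡)))))

  module _ (2≢0 : 1# + 1# ≢ 0#) where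

    Reachable : ∀ {n} → M (suc (suc n)) → Set
    Reachable C = ∃ λ C′ → C ⇝ C′ × C′ 1F 0F ≢ 0#

    reach : ∀ {n} {C C′ : M (suc (suc n))} → C ⇝ C′ → Reachable C′ → Reachable C
    reach C⇝C′ (C″ , C′⇝C″ , ≢0) = C″ , ⇝-trans C⇝C′ C′⇝C″ , ≢0

    from-column-0 : ∀ {n} (C : M (suc (suc n))) i → i ≢ 0F → C i 0F ≢ 0# → Reachable C
    from-column-0 C i i≢0 ≢0 with i Finₚ.≟ 1F | C 1F 0F ≟ 0#
    ... | yes refl | _       = C , done (λ _ _ → refl) , ≢0
    ... | no _     | no ≢0′  = C , done (λ _ _ → refl) , ≢0′
    ... | no i≢1   | yes ≡0  = conj 1F i 1# C , ⇝-step 1# (i≢1 ∘ sym) , λ eq → ≢0 (begin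
          C i 0F                    ≡⟨ solve 1 (λ x → x := :0 :+ :1 :* x) refl _ ⟩
          0# + 1# * C i 0F          ≡⟨ cong (_+ 1# * C i 0F) (sym ≡0) ⟩
          C 1F 0F + 1# * C i 0F     ≡⟨ sym (conj-row {a = 1F} {i} 1# C 0F i≢0) ⟩
          conj 1F i 1# C 1F 0F      ≡⟨ eq ⟩
          0#                        ∎)

    -- The shear with parameter s changes entry (j,0) into Cⱼ₀ + s (C₀₀ - Cⱼⱼ) - s² C₀ⱼ. As Cⱼ₀ = 0,
    -- vanishing at both s = 1 and s = -1 would give 2 C₀ⱼ = 0.
    from-row-0 : ∀ {n} (C : M (suc (suc n))) j → j ≢ 0F → C j 0F ≡ 0# → C 0F j ≢ 0# → Reachable C
    from-row-0 C j j≢0 ≡0 ≢0 with conj j 0F 1# C j 0F ≟ 0# | conj j 0F (- 1#) C j 0F ≟ 0#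
    ... | no ≢0₁ | _      = reach (⇝-step 1# j≢0) (from-column-0 _ j j≢0 ≢0₁)
    ... | yes _  | no ≢0₂ = reach (⇝-step (- 1#) j≢0) (from-column-0 _ j j≢0 ≢0₂)
    ... | yes ≡0₁ | yes ≡0₂ = contradiction (x*y≡0⇒y≡0 2≢0 (begin
          (1# + 1#) * C 0F j
            ≡⟨ solve 4 (λ x a b c → (:1 :+ :1) :* x
                 := con (ℤ.+ 2) :* a :- (a :+ :1 :* b :- :1 :* (c :+ :1 :* x))
                    :- (a :+ (:- :1) :* b :- (:- :1) :* (c :+ (:- :1) :* x))) refl
                 (C 0F j) (C j 0F) (C 0F 0F) (C j j) ⟩
          _ ≡⟨ cong₂ (λ x y → (1# + 1#) * C j 0F - x - y) (trans (sym (conj-corner {a = j} {0F} 1# C)) ≡0₁) (trans (sym (conj-corner {a = j} {0F} (- 1#) C)) ≡0₂) ⟩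
          (1# + 1#) * C j 0F - 0# - 0#     ≡⟨ cong (λ x → (1# + 1#) * x - 0# - 0#) ≡0 ⟩
          (1# + 1#) * 0# - 0# - 0#         ≡⟨ solve 1 (λ a → a :* :0 :- :0 :- :0 := :0) refl (1# + 1#) ⟩
          0#                               ∎)) ≢0

    from-off-diagonal : ∀ {n} (C : M (suc (suc n))) i j → i ≢ j → C i j ≢ 0# → Reachable C
    from-off-diagonal C i j i≢j ≢0 with j Finₚ.≟ 0F | i Finₚ.≟ 0F
    ... | yes refl | _ = from-column-0 C i i≢j ≢0
    ... | no j≢0 | no i≢0 with C i 0F ≟ 0#
    ...   | no ≢0′ = from-column-0 C i i≢0 ≢0′
    ...   | yes ≡0 = reach (⇝-step {a = j} {0F} 1# j≢0) (from-column-0 _ i i≢0 λ eq → ≢0 (begin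
            C i j                       ≡⟨ solve 1 (λ x → x := :- (:0 :- :1 :* x)) refl _ ⟩
            - (0# - 1# * C i j)         ≡⟨ cong (λ t → - (t - 1# * C i j)) (sym ≡0) ⟩
            - (C i 0F - 1# * C i j)     ≡⟨ cong -_ (sym (conj-column {a = j} {0F} 1# C i i≢j)) ⟩
            - conj j 0F 1# C i 0F       ≡⟨ cong -_ eq ⟩
            - 0#                        ≡⟨ -0#≈0# ⟩
            0#                          ∎))
    from-off-diagonal C i j i≢j ≢0 | no j≢0 | yes refl with C j 0F ≟ 0#
    ...   | no ≢0′ = from-column-0 C j j≢0 ≢0′
    ...   | yes ≡0 = from-row-0 C j j≢0 ≡0 ≢0

    -- When (0,i) and (i,0) are both 0, a shear puts the difference C₀₀ - Cᵢᵢ at (i,0).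
    from-diagonal : ∀ {n} (C : M (suc (suc n))) i → i ≢ 0F → C i i ≢ C 0F 0F → Reachable C
    from-diagonal C i i≢0 neq with C 0F i ≟ 0# | C i 0F ≟ 0#
    ... | no ≢0  | _      = from-off-diagonal C 0F i (i≢0 ∘ sym) ≢0
    ... | yes _  | no ≢0  = from-column-0 C i i≢0 ≢0
    ... | yes ≡0 | yes ≡0′ = reach (⇝-step {a = i} {0F} 1# i≢0) (from-column-0 _ i i≢0 λ eq → neq (sym (x-y≡0⇒x≡y (begin
          C 0F 0F - C i i       ≡⟨ solve 2 (λ x y → x :- y := :0 :+ :1 :* x :- :1 :* (y :+ :1 :* :0)) refl _ _ ⟩
          0# + 1# * C 0F 0F - 1# * (C i i + 1# * 0#)
            ≡⟨ cong₂ (λ x y → x + 1# * C 0F 0F - 1# * (C i i + 1# * y)) (sym ≡0′) (sym ≡0) ⟩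
          C i 0F + 1# * C 0F 0F - 1# * (C i i + 1# * C 0F i)  ≡⟨ sym (conj-corner {a = i} {0F} 1# C) ⟩
          conj i 0F 1# C i 0F   ≡⟨ eq ⟩
          0#                    ∎))))

    scalar-or-reachable : ∀ {n} (C : M (suc (suc n))) → (C ≐ λ i j → C 0F 0F * 𝟙 i j) ⊎ Reachable C
    scalar-or-reachable C with Finₚ.any? (λ i → Finₚ.any? (λ j → ¬? (C i j ≟ C 0F 0F * 𝟙 i j)))
    ... | no none = inj₁ (λ i j → decidable-stable (C i j ≟ C 0F 0F * 𝟙 i j) (λ neq → none (i , j , neq)))
    ... | yes (i , j , neq) = inj₂ (cases (i Finₚ.≟ j))
      where
      cases : Dec (i ≡ j) → Reachable C
      cases (no i≢j) = from-off-diagonal C i j i≢j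
        (λ ≡0 → neq (trans ≡0 (sym (trans (cong (C 0F 0F *_) (𝟙-≢ i≢j)) (zeroʳ _)))))
      cases (yes i≡j) = from-diagonal C i (λ i≡0 → C≢ (cong (λ l → C l l) i≡0)) C≢
        where
        C≢ : C i i ≢ C 0F 0F
        C≢ eq = neq (trans (cong (C i) (sym i≡j)) (trans eq (sym (trans (cong (C 0F 0F *_) (𝟙-≡ i≡j)) (*-identityʳ _)))))

-- Powers in the unit group of a finite field

module UnitGroup (R : FiniteRing) (isField : FiniteRing.IsField R) where
  open FiniteRing R
  open IsField isField
  open ≡-Reasoning

  non-root-of-unity : ∀ {d} → 1 ℕ.≤ d → d ℕ.+ 1 ℕ.< size → ∃ λ z → z ≢ 0# × z ^ d ≢ 1#
  non-root-of-unity {d} 1≤d d+1<size with any? (λ z → ¬? (z ≟ 0#) ×-dec ¬? (z ^ d ≟ 1#))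
  ... | yes found = found
  ... | no none   = contradiction (go size element index element-index index-element) λ le →
          ℕₚ.<⇒≱ d+1<size (ℕₚ.≤-trans le (ℕₚ.≤-reflexive (ℕₚ.+-comm 1 d)))
    where
    -- The size becomes a variable so that it can be matched as a successor; `punchIn (index 0#)`
    -- then lists the nonzero elements, which would all be roots of z^d = 1.
    go : ∀ s (element : Fin s → Carrier) (index : Carrier → Fin s) → (∀ x → element (index x) ≡ x) →
      (∀ i → index (element i) ≡ i) → s ℕ.≤ suc d
    go zero    _ index _ _ = z≤n
    go (suc s) element index element-index index-element = s≤s (Polynomial.#roots-of-unity R isField 1≤d
        (λ i → element (punchIn (index 0#) i))
        (λ eq → Finₚ.punchIn-injective (index 0#) _ _ (trans (sym (index-element _)) (trans (cong index eq) (index-element _))))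
        (λ i → decidable-stable (_ ≟ _) (λ ≢1 → none (_ , nonzero i , ≢1))))
      where
      nonzero : ∀ i → element (punchIn (index 0#) i) ≢ 0#
      nonzero i eq = Finₚ.punchInᵢ≢i (index 0#) i (trans (sym (index-element _)) (cong index eq))

  fermat-unit : ∀ {q z} → 1 ℕ.≤ q → z ^ q ≡ z → z ≢ 0# → z ^ (q ℕ.∸ 1) ≡ 1#
  fermat-unit {suc q} {z} _ z^q≡z z≢0 = *-cancelˡ-≢0 z≢0 (trans z^q≡z (sym (*-identityʳ z)))

  power-of-1 : ∀ {m z} → z ^ m ≡ 1# → ∀ y → z ^ (y ℕ.* m) ≡ 1#
  power-of-1 {m} {z} z^m≡1 y = trans (cong (z ^_) (ℕₚ.*-comm y m))
    (trans (sym (^-assocʳ z m y)) (trans (cong (_^ y) z^m≡1) (1^n≡1 y)))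

  gcd-power : ∀ k {m z} → 1 ℕ.≤ m → z ^ m ≡ 1# → ∃ λ w → z ^ gcd k m ≡ w ^ k
  gcd-power k {m@(suc m-1)} {z} _ z^m≡1 with Bézout.identity (gcd-GCD k m)
  ... | Bézout.+- x y eq = z ^ x , (begin
    z ^ gcd k m                         ≡⟨ sym (*-identityʳ _) ⟩
    z ^ gcd k m * 1#                    ≡⟨ cong (z ^ gcd k m *_) (sym (power-of-1 {m} {z} z^m≡1 y)) ⟩
    z ^ gcd k m * z ^ (y ℕ.* m)         ≡⟨ sym (^-homo-* z (gcd k m) (y ℕ.* m)) ⟩
    z ^ (gcd k m ℕ.+ y ℕ.* m)           ≡⟨ cong (z ^_) eq ⟩
    z ^ (x ℕ.* k)                       ≡⟨ sym (^-assocʳ z x k) ⟩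
    (z ^ x) ^ k                         ∎)
  -- Here g = y m - x k, and the exponent -x is replaced by x (m - 1), which agrees with it modulo
  -- m.
  ... | Bézout.-+ x y eq = z ^ (x ℕ.* m-1) , (begin
    z ^ g                                         ≡⟨ sym (*-identityʳ _) ⟩
    z ^ g * 1#                                    ≡⟨ cong (z ^ g *_) (sym (power-of-1 {m} {z} z^m≡1 (x ℕ.* k))) ⟩
    z ^ g * z ^ (x ℕ.* k ℕ.* m)                   ≡⟨ sym (^-homo-* z g _) ⟩
    z ^ (g ℕ.+ x ℕ.* k ℕ.* m)                     ≡⟨ cong (z ^_) (rearrange g x k m-1) ⟩
    z ^ ((g ℕ.+ x ℕ.* k) ℕ.+ x ℕ.* m-1 ℕ.* k)     ≡⟨ cong (λ t → z ^ (t ℕ.+ x ℕ.* m-1 ℕ.* k)) eq ⟩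
    z ^ (y ℕ.* m ℕ.+ x ℕ.* m-1 ℕ.* k)             ≡⟨ ^-homo-* z (y ℕ.* m) _ ⟩
    z ^ (y ℕ.* m) * z ^ (x ℕ.* m-1 ℕ.* k)         ≡⟨ cong (_* z ^ (x ℕ.* m-1 ℕ.* k)) (power-of-1 {m} {z} z^m≡1 y) ⟩
    1# * z ^ (x ℕ.* m-1 ℕ.* k)                    ≡⟨ *-identityˡ _ ⟩
    z ^ (x ℕ.* m-1 ℕ.* k)                         ≡⟨ sym (^-assocʳ z (x ℕ.* m-1) k) ⟩
    (z ^ (x ℕ.* m-1)) ^ k                         ∎)
    where
    g = gcd k m
    rearrange : ∀ g x k m → g ℕ.+ x ℕ.* k ℕ.* suc m ≡ (g ℕ.+ x ℕ.* k) ℕ.+ x ℕ.* m ℕ.* k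
    rearrange = ℕ-Solver.solve-∀

  divide-by-1 : ∀ {z} i {j} → z ^ j ≡ 1# → z ^ (i ℕ.+ j) ≡ 1# → z ^ i ≡ 1#
  divide-by-1 {z} i {j} z^j≡1 z^[i+j]≡1 = trans (sym (trans (^-homo-* z i j)
    (trans (cong (z ^ i *_) z^j≡1) (*-identityʳ _)))) z^[i+j]≡1

  gcd-power≡1 : ∀ k m {z} → z ^ k ≡ 1# → z ^ m ≡ 1# → z ^ gcd k m ≡ 1#
  gcd-power≡1 k m {z} z^k≡1 z^m≡1 with Bézout.identity (gcd-GCD k m)
  ... | Bézout.+- x y eq = divide-by-1 {z} (gcd k m) {y ℕ.* m} (power-of-1 {m} {z} z^m≡1 y)
        (trans (cong (z ^_) eq) (power-of-1 {k} {z} z^k≡1 x))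
  ... | Bézout.-+ x y eq = divide-by-1 {z} (gcd k m) {x ℕ.* k} (power-of-1 {k} {z} z^k≡1 x)
        (trans (cong (z ^_) eq) (power-of-1 {m} {z} z^m≡1 y))

  -- z^((q-1)/2) ≠ 1 forces z^((q-1)/2) = -1, and z^d is a k-th power for d = gcd(k, q-1).
  -1-is-power : ∀ k {q} → 1 ℕ.< q → size ≡ q → (∀ z → z ^ q ≡ z) →
    ∀ h → 2 ℕ.* h ℕ.* gcd k (q ℕ.∸ 1) ≡ q ℕ.∸ 1 → ∃ λ w → w ^ k ≡ - 1#
  -1-is-power k {q@(suc q-1)} (s≤s 1≤q-1) size≡q fermat h 2hg≡q-1 =
    let (z , z≢0 , z^e≢1) = non-root-of-unity 1≤e e+1<size
        z^[q-1]≡1 = fermat-unit {q} {z} (s≤s z≤n) (fermat z) z≢0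
        (w , z^g≡w^k) = gcd-power k {q-1} {z} 1≤q-1 z^[q-1]≡1
    in w ^ h , (begin
      (w ^ h) ^ k          ≡⟨ trans (^-assocʳ w h k) (trans (cong (w ^_) (ℕₚ.*-comm h k)) (sym (^-assocʳ w k h))) ⟩
      (w ^ k) ^ h          ≡⟨ cong (_^ h) (sym z^g≡w^k) ⟩
      (z ^ g) ^ h          ≡⟨ trans (^-assocʳ z g h) (cong (z ^_) (ℕₚ.*-comm g h)) ⟩
      z ^ e                ≡⟨ square-root-of-1 (z ^ e) z^e≢1 (trans (^-assocʳ-2 z) z^[q-1]≡1) ⟩
      - 1#                 ∎)
    where
    g = gcd k q-1
    e = h ℕ.* g
    2e≡q-1 : e ℕ.+ e ≡ q-1
    2e≡q-1 = trans (trans (cong (e ℕ.+_) (sym (ℕₚ.+-identityʳ e))) (sym (ℕₚ.*-assoc 2 h g))) 2hg≡q-1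
    1≤e : 1 ℕ.≤ e
    1≤e = ℕₚ.n≢0⇒n>0 (λ e≡0 → ℕₚ.<⇒≢ 1≤q-1 (trans (sym (cong₂ ℕ._+_ e≡0 e≡0)) 2e≡q-1))
    e+1<size : e ℕ.+ 1 ℕ.< size
    e+1<size = subst (e ℕ.+ 1 ℕ.<_) (sym size≡q) (s≤s (ℕₚ.≤-trans (ℕₚ.+-monoʳ-≤ e 1≤e) (ℕₚ.≤-reflexive 2e≡q-1)))
    ^-assocʳ-2 : ∀ z → z ^ e * z ^ e ≡ z ^ q-1
    ^-assocʳ-2 z = trans (sym (^-homo-* z e e)) (cong (z ^_) 2e≡q-1)
    square-root-of-1 : ∀ y → y ≢ 1# → y * y ≡ 1# → y ≡ - 1#
    square-root-of-1 y y≢1 y²≡1 = x-y≡0⇒x≡y (x*y≡0⇒y≡0 (y≢1 ∘ x-y≡0⇒x≡y) (begin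
      (y - 1#) * (y - - 1#)   ≡⟨ solve 1 (λ y → (y :- :1) :* (y :- (:- :1)) := y :* y :- :1) refl y ⟩
      y * y - 1#              ≡⟨ x≡y⇒x-y≡0 y²≡1 ⟩
      0#                      ∎))

-- Characteristic and Fermat's little theorem for 𝔽ₚ

module PrimeField (p : ℕ) (pr : Prime p) where
  open ModP p pr public
  open FiniteRing 𝔽
  open IsField isField

  1<p : 1 ℕ.< p
  1<p = ℕ.nonTrivial⇒n>1 p {{prime⇒nonTrivial pr}}

  char : ∀ a → p · a ≡ 0#
  char a = trans (cong (p ·_) (sym (*-identityˡ a))) (trans (sym (SemiringMult.×-assoc-* semiring p 1# a))
    (trans (cong (_* a) (trans (·1≡π p) (π-cong {p} {0} (trans (n%n≡0 p) (sym (m<n⇒m%n≡m (ℕₚ.<⇒≤ 1<p))))))) (zeroˡ a)))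
    where
    instance _ = prime⇒nonZero pr

  fermat : ∀ a → a ^ p ≡ a
  fermat a = subst (λ b → b ^ p ≡ b) (π-toℕ a) (go (toℕ a))
    where
    go : ∀ m → π m ^ p ≡ π m
    go zero    = 0^n≡0 (ℕₚ.<⇒≤ 1<p)
    go (suc m) = trans (cong (_^ p) (π-+ 1 m)) (trans (Frobenius.frobenius semiring pr char 1# (π m) (*-comm 1# (π m)))
      (trans (cong₂ _+_ (1^n≡1 p) (go m)) (sym (π-+ 1 m))))

  natural : ∀ z → ∃ λ J → J ℕ.< p × z ≡ J · 1#
  natural z = toℕ z , Finₚ.toℕ<n z , sym (trans (·1≡π (toℕ z)) (π-toℕ z))

  2≢0 : 2 ℕ.< p → 1# + 1# ≢ 0#
  2≢0 2<p eq = ℕₚ.1+n≢0 (trans (sym (m<n⇒m%n≡m 2<p)) (trans (π-injective {2} {0} (trans (π-+ 1 1) eq)) (m<n⇒m%n≡m (ℕₚ.<⇒≤ 1<p))))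
    where
    instance _ = prime⇒nonZero pr

-- The extension field acting on 𝔽ₚⁿ

module Representation (K : FiniteRing) {n : ℕ} (c : Vec (FiniteRing.Carrier K) n) where
  open FiniteRing K
  open Vector K
  open Matrix K
  open Quotient K n c
  open ≡-Reasoning
  private module V = FiniteRing ring-V

  unit : ∀ {m} → Fin m → Vec Carrier m
  unit zero    = 1# ∷ 𝕠
  unit (suc i) = 0# ∷ unit i

  lookup-𝕠 : ∀ {m} (j : Fin m) → lookup (𝕠 {m}) j ≡ 0#
  lookup-𝕠 j = Vecₚ.lookup-replicate j 0#

  lookup-unit : ∀ {m} (i j : Fin m) → lookup (unit i) j ≡ 𝟙 i j
  lookup-unit zero    zero    = refl
  lookup-unit zero    (suc j) = lookup-𝕠 j
  lookup-unit (suc i) zero    = refl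
  lookup-unit (suc i) (suc j) = trans (lookup-unit i j) (sym (𝟙-suc i j))

  lookup-linear : ∀ {m l} (T : Vec Carrier m → Vec Carrier l) → (∀ u v → T (u ⊞ v) ≡ T u ⊞ T v) →
    (∀ a v → T (a • v) ≡ a • T v) → ∀ w j → lookup (T w) j ≡ sum (λ i → lookup w i * lookup (T (unit i)) j)
  lookup-linear T T-⊞ T-• [] j = trans (cong (λ v → lookup v j) (trans (T-• 0# []) (•-zeroˡ (T [])))) (lookup-𝕠 j)
  lookup-linear T T-⊞ T-• (a ∷ w) j = begin
    lookup (T (a ∷ w)) j                                    ≡⟨ cong (λ v → lookup (T v) j) decompose ⟩
    lookup (T (a • unit zero ⊞ (0# ∷ w))) j                 ≡⟨ cong (λ v → lookup v j) (trans (T-⊞ _ _) (cong (_⊞ T (0# ∷ w)) (T-• a _))) ⟩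
    lookup (a • T (unit zero) ⊞ T (0# ∷ w)) j               ≡⟨ Vecₚ.lookup-zipWith _+_ j (a • T (unit zero)) (T (0# ∷ w)) ⟩
    lookup (a • T (unit zero)) j + lookup (T (0# ∷ w)) j
      ≡⟨ cong₂ _+_ (Vecₚ.lookup-map j (a *_) (T (unit zero))) (lookup-linear (λ v → T (0# ∷ v))
           (λ u v → trans (cong (λ z → T (z ∷ u ⊞ v)) (sym (+-identityˡ 0#))) (T-⊞ (0# ∷ u) (0# ∷ v)))
           (λ b v → trans (cong (λ z → T (z ∷ b • v)) (sym (zeroʳ b))) (T-• b (0# ∷ v))) w j) ⟩
    a * lookup (T (unit zero)) j + sum (λ i → lookup w i * lookup (T (unit (suc i))) j) ∎
    where
    decompose : a ∷ w ≡ a • unit zero ⊞ (0# ∷ w)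
    decompose = cong₂ _∷_ (sym (trans (+-identityʳ _) (*-identityʳ a)))
      (sym (trans (cong (_⊞ w) (•-zeroʳ a)) (⊞-identityˡ w)))

  -- Row i holds the coordinates of v xⁱ, so this is the transpose of the usual matrix of
  -- multiplication by v. Commutativity of the field lets `rep-⊠` keep the order of the factors.
  rep : V → M n
  rep v i j = lookup (v ⊠ unit i) j

  rep-⊞ : ∀ u v → rep (u ⊞ v) ≐ rep u ⊕ rep v
  rep-⊞ u v i j = trans (cong (λ t → lookup t j) (V.distribʳ (unit i) u v)) (Vecₚ.lookup-zipWith _+_ j (u ⊠ unit i) (v ⊠ unit i))

  rep-⊠ : ∀ u v → rep (u ⊠ v) ≐ rep u ⊗ rep v
  rep-⊠ u v i j = begin
    lookup (u ⊠ v ⊠ unit i) j      ≡⟨ cong (λ t → lookup t j) (trans (cong (_⊠ unit i) (⊠-comm u v)) (⊠-assoc v u (unit i))) ⟩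
    lookup (v ⊠ (u ⊠ unit i)) j    ≡⟨ lookup-linear (v ⊠_) (act-⊞ v) (act-• v) (u ⊠ unit i) j ⟩
    sum (λ l → rep u i l * rep v l j) ∎

  rep-scalar : ∀ a → rep (a • one) ≐ λ i j → a * 𝟙 i j
  rep-scalar a i j = trans (cong (λ t → lookup t j) (sym (•≡⊠ a (unit i))))
    (trans (Vecₚ.lookup-map j (a *_) (unit i)) (cong (a *_) (lookup-unit i j)))

  rep-one : rep one ≐ 𝟙
  rep-one i j = trans (cong (λ t → lookup t j) (V.*-identityˡ (unit i))) (lookup-unit i j)

  rep-^ : ∀ v k → rep (v V.^ k) ≐ rep v ^ᵐ k
  rep-^ v zero    = rep-one
  rep-^ v (suc k) i j = trans (rep-⊠ v (v V.^ k) i j) (⊗-cong {n} {rep v} {rep v} (λ _ _ → refl) (rep-^ v k) i j)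

  rep-inverse : ∀ u v → u ⊠ v ≡ one → InversePair (rep u) (rep v)
  rep-inverse u v uv≡1 = (λ i j → trans (sym (rep-⊠ u v i j)) (trans (cong (λ t → rep t i j) uv≡1) (rep-one i j)))
    , (λ i j → trans (sym (rep-⊠ v u i j)) (trans (cong (λ t → rep t i j) (trans (⊠-comm v u) uv≡1)) (rep-one i j)))

n<p^n : ∀ {p} → 1 ℕ.< p → ∀ n → n ℕ.< p ℕ.^ n
n<p^n         1<p zero    = s≤s z≤n
n<p^n {p} 1<p (suc n) = ℕₚ.≤-trans (ℕₚ.+-mono-≤ (ℕₚ.≤-trans (s≤s z≤n) (n<p^n 1<p n)) (n<p^n 1<p n))
  (ℕₚ.≤-trans (ℕₚ.≤-reflexive (cong (p ℕ.^ n ℕ.+_) (sym (ℕₚ.+-identityʳ (p ℕ.^ n))))) (ℕₚ.*-monoˡ-≤ (p ℕ.^ n) 1<p))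

-- Non-scalar matrices

module NonScalar (K : FiniteRing) (isField : FiniteRing.IsField K) {p : ℕ} (pr : Prime p)
  (char : ∀ a → FiniteRing._·_ K p a ≡ FiniteRing.0# K)
  (fermat : ∀ a → FiniteRing._^_ K a p ≡ a)
  (natural : ∀ z → ∃ λ J → J ℕ.< p × z ≡ FiniteRing._·_ K J (FiniteRing.1# K))
  (2≢0 : FiniteRing._+_ K (FiniteRing.1# K) (FiniteRing.1# K) ≢ FiniteRing.0# K) where

  open FiniteRing K
  open Matrix K
  open Fillmore K isField
  open ≡-Reasoning

  1<p : 1 ℕ.< p
  1<p = ℕ.nonTrivial⇒n>1 p {{prime⇒nonTrivial pr}}

  OneOr : Carrier → Carrier → Set
  OneOr t x = x ≡ 1# ⊎ x ≡ t

  -- Begins with 2n ones and turns J of them into t, each adding t - 1; one index i provides two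
  -- places.
  sum-of-ones-and-ts : ∀ t n J → J ℕ.≤ 2 ℕ.* n → ∃ λ (x : Fin n → Carrier) → ∃ λ (y : Fin n → Carrier) →
    (∀ i → OneOr t (x i)) × (∀ i → OneOr t (y i)) × sum (λ i → x i + y i) ≡ n · (1# + 1#) + J · (t - 1#)
  sum-of-ones-and-ts t zero zero _ = (λ ()) , (λ ()) , (λ ()) , (λ ()) , sym (+-identityʳ 0#)
  sum-of-ones-and-ts t (suc n) J J≤ = extend J J≤
    where
    cons : Carrier → (Fin n → Carrier) → Fin (suc n) → Carrier
    cons a x zero    = a
    cons a x (suc i) = x i
    cons-OneOr : ∀ {a x} → OneOr t a → (∀ i → OneOr t (x i)) → ∀ i → OneOr t (cons a x i)
    cons-OneOr ta tx zero    = ta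
    cons-OneOr ta tx (suc i) = tx i
    extend : ∀ J → J ℕ.≤ 2 ℕ.* suc n → ∃ λ x → ∃ λ y → (∀ i → OneOr t (x i)) × (∀ i → OneOr t (y i))
      × sum (λ i → x i + y i) ≡ suc n · (1# + 1#) + J · (t - 1#)
    extend zero _ =
      let (x , y , tx , ty , eq) = sum-of-ones-and-ts t n 0 z≤n
      in cons 1# x , cons 1# y , cons-OneOr (inj₁ refl) tx , cons-OneOr (inj₁ refl) ty
       , trans (cong (λ s → 1# + 1# + s) eq)
           (solve 1 (λ m → :1 :+ :1 :+ (m :+ :0) := :1 :+ :1 :+ m :+ :0) refl (n · (1# + 1#)))
    extend (suc zero) _ =
      let (x , y , tx , ty , eq) = sum-of-ones-and-ts t n 0 z≤n
      in cons t x , cons 1# y , cons-OneOr (inj₂ refl) tx , cons-OneOr (inj₁ refl) ty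
       , trans (cong (λ s → t + 1# + s) eq)
           (solve 2 (λ m t → t :+ :1 :+ (m :+ :0) := :1 :+ :1 :+ m :+ (t :- :1 :+ :0)) refl (n · (1# + 1#)) t)
    extend (suc (suc J)) J≤ =
      let (x , y , tx , ty , eq) = sum-of-ones-and-ts t n J
            (ℕₚ.≤-pred (ℕₚ.≤-pred (subst (suc (suc J) ℕ.≤_) (ℕₚ.*-suc 2 n) J≤)))
      in cons t x , cons t y , cons-OneOr (inj₂ refl) tx , cons-OneOr (inj₂ refl) ty
       , trans (cong (λ s → t + t + s) eq)
           (solve 3 (λ m t j → t :+ t :+ (m :+ j) := :1 :+ :1 :+ m :+ (t :- :1 :+ (t :- :1 :+ j))) refl
             (n · (1# + 1#)) t (J · (t - 1#)))

  -- τ - 2n is z (t - 1) for some z, and z is the class of a natural J < p ≤ 2n. This is where n >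
  -- (p - 1)/2 enters.
  prescribed-sum : ∀ {t} → t ≢ 1# → ∀ {n} → p ℕ.≤ 2 ℕ.* n → ∀ τ → ∃ λ (x : Fin n → Carrier) → ∃ λ (y : Fin n → Carrier) →
    (∀ i → OneOr t (x i)) × (∀ i → OneOr t (y i)) × sum (λ i → x i + y i) ≡ τ
  prescribed-sum {t} t≢1 {n} p≤2n τ =
    let (z , eq) = divide (n · (1# + 1#)) τ {t - 1#} (t≢1 ∘ x-y≡0⇒x≡y)
        (J , J<p , z≡J) = natural z
        (x , y , tx , ty , ∑≡) = sum-of-ones-and-ts t n J (ℕₚ.≤-trans (ℕₚ.<⇒≤ J<p) p≤2n)
    in x , y , tx , ty , trans ∑≡ (trans (cong (λ s → n · (1# + 1#) + s) (begin
         J · (t - 1#)            ≡⟨ cong (J ·_) (sym (*-identityˡ _)) ⟩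
         J · (1# * (t - 1#))     ≡⟨ sym (SemiringMult.×-assoc-* semiring J 1# (t - 1#)) ⟩
         J · 1# * (t - 1#)       ≡⟨ cong (_* (t - 1#)) (sym z≡J) ⟩
         z * (t - 1#)            ∎)) eq)

  module _ {n : ℕ} (D : M n) (x y : Fin n → Carrier) (D≡ : ∀ i → D i i ≡ x i + y i) where
    lowerPart upperPart : M n
    lowerPart i j with ℕₚ.<-cmp (toℕ i) (toℕ j)
    ... | tri< _ _ _ = 0#
    ... | tri≈ _ _ _ = x i
    ... | tri> _ _ _ = D i j
    upperPart i j with ℕₚ.<-cmp (toℕ i) (toℕ j)
    ... | tri< _ _ _ = D i j
    ... | tri≈ _ _ _ = y i
    ... | tri> _ _ _ = 0#

    lower+upper : lowerPart ⊕ upperPart ≐ D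
    lower+upper i j with ℕₚ.<-cmp (toℕ i) (toℕ j)
    ... | tri< _ _ _ = +-identityˡ _
    ... | tri≈ _ i≡j _ = trans (sym (D≡ i)) (cong (D i) (Finₚ.toℕ-injective i≡j))
    ... | tri> _ _ _ = +-identityʳ _

    lower-triangular : ∀ i j → toℕ i ℕ.< toℕ j → lowerPart i j ≡ 0#
    lower-triangular i j i<j with ℕₚ.<-cmp (toℕ i) (toℕ j)
    ... | tri< _ _ _ = refl
    ... | tri≈ i≮j _ _ = contradiction i<j i≮j
    ... | tri> i≮j _ _ = contradiction i<j i≮j

    upper-triangular : ∀ i j → toℕ j ℕ.< toℕ i → upperPart i j ≡ 0#
    upper-triangular i j j<i with ℕₚ.<-cmp (toℕ i) (toℕ j)
    ... | tri< _ _ j≮i = contradiction j<i j≮i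
    ... | tri≈ _ _ j≮i = contradiction j<i j≮i
    ... | tri> _ _ _ = refl

    lower-diagonal : ∀ i → lowerPart i i ≡ x i
    lower-diagonal i with ℕₚ.<-cmp (toℕ i) (toℕ i)
    ... | tri< _ i≢i _ = contradiction refl i≢i
    ... | tri≈ _ _ _ = refl
    ... | tri> _ i≢i _ = contradiction refl i≢i

    upper-diagonal : ∀ i → upperPart i i ≡ y i
    upper-diagonal i with ℕₚ.<-cmp (toℕ i) (toℕ i)
    ... | tri< _ i≢i _ = contradiction refl i≢i
    ... | tri≈ _ _ _ = refl
    ... | tri> _ i≢i _ = contradiction refl i≢i

  OneOr⇒root : ∀ {t x} → OneOr t x → (x - 1#) * (x - t) ≡ 0#
  OneOr⇒root {t} (inj₁ refl) = trans (cong (_* (1# - t)) (-‿inverseʳ 1#)) (zeroˡ _)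
  OneOr⇒root {t} (inj₂ refl) = trans (cong ((t - 1#) *_) (-‿inverseʳ t)) (zeroʳ _)

  module _ {k : ℕ} (p∤k : ¬ (p ∣ k)) (1≤k : 1 ℕ.≤ k) {c : Carrier} (c≢0 : c ≢ 0#) (c^k≢1 : c ^ k ≢ 1#) where

    prescribed-diagonal⇒sum : ∀ {n} (D : M n) (x y : Fin n → Carrier) → 1 ℕ.≤ n → (∀ i → D i i ≡ x i + y i) →
      (∀ i → OneOr (c ^ k) (x i)) → (∀ i → OneOr (c ^ k) (y i)) → SumOfInvertiblePowers k D
    prescribed-diagonal⇒sum {n} D x y 1≤n D≡ tx ty =
      let open Triangular isField pr char
          c-order = UnitGroup.fermat-unit K isField (ℕₚ.<⇒≤ 1<p) (fermat c) c≢0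
          -- Reversing the order of the indices makes the lower part upper triangular. The exponent
          -- m is n, since all ranks are below n < pⁿ.
          (A , A′ , A^k≐ , AA′) = triangular-root (toℕ ∘ opposite) opposite-injective (lowerPart D x y D≡) (c ^ k)
            (λ i j lt → lower-triangular D x y D≡ i j (opposite-< lt))
            (λ i → OneOr⇒root (subst (OneOr (c ^ k)) (sym (lower-diagonal D x y D≡ i)) (tx i)))
            p∤k 1≤k n 1≤n (λ i → ℕₚ.<-trans (Finₚ.toℕ<n (opposite i)) (n<p^n 1<p n)) c c-order refl c^k≢1
          (B , B′ , B^k≐ , BB′) = triangular-root toℕ Finₚ.toℕ-injective (upperPart D x y D≡) (c ^ k)
            (upper-triangular D x y D≡)
            (λ i → OneOr⇒root (subst (OneOr (c ^ k)) (sym (upper-diagonal D x y D≡ i)) (ty i)))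
            p∤k 1≤k n 1≤n (λ i → ℕₚ.<-trans (Finₚ.toℕ<n i) (n<p^n 1<p n)) c c-order refl c^k≢1
      in A , A′ , B , B′ , AA′ , BB′ , λ i j → trans (cong₂ _+_ (A^k≐ i j) (B^k≐ i j)) (lower+upper D x y D≡ i j)
      where
      opposite-injective : ∀ {i j : Fin n} → toℕ (opposite i) ≡ toℕ (opposite j) → i ≡ j
      opposite-injective {i} {j} eq = trans (sym (Finₚ.opposite-involutive i))
        (trans (cong opposite (Finₚ.toℕ-injective eq)) (Finₚ.opposite-involutive j))
      opposite-< : ∀ {i j : Fin n} → toℕ (opposite j) ℕ.< toℕ (opposite i) → toℕ i ℕ.< toℕ j
      opposite-< {i} {j} lt = ℕₚ.≰⇒> (λ j≤i → ℕₚ.<⇒≱ lt (ℕₚ.≤-trans (ℕₚ.≤-reflexive (Finₚ.opposite-prop i))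
        (ℕₚ.≤-trans (ℕₚ.∸-monoʳ-≤ n (s≤s j≤i)) (ℕₚ.≤-reflexive (sym (Finₚ.opposite-prop j))))))

    conjugate-sum : ∀ {n} {C D : M n} → C ⇝ D → SumOfInvertiblePowers k D → SumOfInvertiblePowers k C
    conjugate-sum {n} {C} {D} C⇝D (A , A′ , B , B′ , AA′ , BB′ , eq) =
      let (P , P′ , PP′ , C≐) = ⇝⇒similar C⇝D
      in P ⊗ A ⊗ P′ , P ⊗ A′ ⊗ P′ , P ⊗ B ⊗ P′ , P ⊗ B′ ⊗ P′ , conjugate-pair PP′ AA′ , conjugate-pair PP′ BB′
       , λ i j → trans (cong₂ _+_ (conjugate-^ {P} {P′} A (proj₂ PP′) (proj₁ PP′) k i j) (conjugate-^ {P} {P′} B (proj₂ PP′) (proj₁ PP′) k i j))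
           (trans (sym (distribute P P′ i j)) (sym (trans (C≐ i j) (⊗-cong {n} {P ⊗ D} {P ⊗ (A ^ᵐ k ⊕ B ^ᵐ k)} {P′} {P′}
             (⊗-cong {n} {P} {P} {D} {A ^ᵐ k ⊕ B ^ᵐ k} (λ _ _ → refl) (λ i j → sym (eq i j))) (λ _ _ → refl) i j))))
      where
      open Conjugation (matrixRing n)
      distribute : ∀ P P′ → P ⊗ (A ^ᵐ k ⊕ B ^ᵐ k) ⊗ P′ ≐ P ⊗ A ^ᵐ k ⊗ P′ ⊕ P ⊗ B ^ᵐ k ⊗ P′
      distribute P P′ i j = trans (⊗-cong {n} {P ⊗ (A ^ᵐ k ⊕ B ^ᵐ k)} {P ⊗ A ^ᵐ k ⊕ P ⊗ B ^ᵐ k} {P′} {P′}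
        (⊗-distribˡ {n} P (A ^ᵐ k) (B ^ᵐ k)) (λ _ _ → refl) i j) (⊗-distribʳ {n} P′ (P ⊗ A ^ᵐ k) (P ⊗ B ^ᵐ k) i j)
      half : ∀ {P P′ X X′ : M n} → InversePair P P′ → X ⊗ X′ ≐ 𝟙 → (P ⊗ X ⊗ P′) ⊗ (P ⊗ X′ ⊗ P′) ≐ 𝟙
      half {P} {P′} {X} {X′} (PP′ , P′P) XX′ i j = trans (conjugate-* {P} {P′} X X′ P′P i j)
        (trans (⊗-cong {n} {P ⊗ (X ⊗ X′)} {P ⊗ 𝟙} {P′} {P′} (⊗-cong {n} {P} {P} {X ⊗ X′} {𝟙} (λ _ _ → refl) XX′) (λ _ _ → refl) i j)
          (conjugate-1 {P} {P′} PP′ i j))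
      conjugate-pair : ∀ {P P′ X X′ : M n} → InversePair P P′ → InversePair X X′ → InversePair (P ⊗ X ⊗ P′) (P ⊗ X′ ⊗ P′)
      conjugate-pair {P} {P′} {X} {X′} PP′ (XX′ , X′X) = half {P} {P′} {X} {X′} PP′ XX′ , half {P} {P′} {X′} {X} PP′ X′X

    nonscalar⇒sum : ∀ {n} (C : M (suc (suc n))) → p ℕ.≤ 2 ℕ.* suc (suc n) → Reachable 2≢0 C → SumOfInvertiblePowers k C
    nonscalar⇒sum C p≤2n (C₁ , C⇝C₁ , C₁₀≢0) =
      let (x , y , tx , ty , ∑≡) = prescribed-sum c^k≢1 p≤2n (trace C₁)
          (D , C₁⇝D , D≡) = prescribe-diagonal C₁ C₁₀≢0 (λ i → x i + y i) ∑≡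
      in conjugate-sum (⇝-trans C⇝C₁ C₁⇝D) (prescribed-diagonal⇒sum D x y (s≤s z≤n) D≡ tx ty)

-- Scalar matrices

module ScalarMatrices (K : FiniteRing) (isField : FiniteRing.IsField K) {n : ℕ} (c : Vec (FiniteRing.Carrier K) n)
  (field-V : FiniteRing.IsField (Quotient.ring-V K n c)) (k : ℕ) (1≤k : 1 ℕ.≤ k) where
  open FiniteRing K hiding (_^_)
  open Matrix K
  open Representation K c
  open Quotient K n c using (ring-V; one; •≡⊠)
  open Vector K using (_•_; _⊞_; ⊟_; •-assoc; •-identityˡ; •-zeroˡ; 𝕠)
  private module V = FiniteRing ring-V
  open V using (_^_)
  open SumsOfTwoPowers ring-V field-V k 1≤k using (sum-of-two-powers; sum-of-two-nonzero-powers; -1≢0; power≢0)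
  open ≡-Reasoning

  a•one≢0 : ∀ {a} → a ≢ 0# → a • one ≢ 𝕠
  a•one≢0 {a} a≢0 a•one≡0 = V.IsField.1≢0 field-V (begin
    one                   ≡⟨ sym (•-identityˡ one) ⟩
    1# • one              ≡⟨ cong (_• one) (sym (trans (*-comm a⁻¹ a) aa⁻¹≡1)) ⟩
    (a⁻¹ * a) • one       ≡⟨ sym (•-assoc a⁻¹ a one) ⟩
    a⁻¹ • a • one         ≡⟨ trans (cong (a⁻¹ •_) a•one≡0) (trans (•≡⊠ a⁻¹ 𝕠) (V.zeroʳ (a⁻¹ • one))) ⟩
    𝕠                     ∎)
    where
    a⁻¹ = proj₁ (IsField.inverse isField a a≢0)
    aa⁻¹≡1 = proj₂ (IsField.inverse isField a a≢0)

  rep-sum : ∀ {C : M n} {a} → (C ≐ λ i j → a * 𝟙 i j) → ∀ u v → u ^ k ⊞ v ^ k ≡ a • one → rep u ^ᵐ k ⊕ rep v ^ᵐ k ≐ C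
  rep-sum {C} {a} scalar u v eq i j = begin
    (rep u ^ᵐ k) i j + (rep v ^ᵐ k) i j    ≡⟨ sym (cong₂ _+_ (rep-^ u k i j) (rep-^ v k i j)) ⟩
    rep (u ^ k) i j + rep (v ^ k) i j      ≡⟨ sym (rep-⊞ (u ^ k) (v ^ k) i j) ⟩
    rep (u ^ k ⊞ v ^ k) i j                ≡⟨ cong (λ t → rep t i j) eq ⟩
    rep (a • one) i j                      ≡⟨ rep-scalar a i j ⟩
    a * 𝟙 i j                              ≡⟨ sym (scalar i j) ⟩
    C i j                                  ∎

  power-sum : (k ℕ.∸ 1) ℕ.^ 4 ℕ.< size ℕ.^ n → ∀ a → ∃ λ u → ∃ λ v → u ^ k ⊞ v ^ k ≡ a • one
  power-sum large a = cases (a ≟ 0#)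
    where
    cases : Dec (a ≡ 0#) → ∃ λ u → ∃ λ v → u ^ k ⊞ v ^ k ≡ a • one
    cases (no a≢0)  = sum-of-two-powers large (a • one) (a•one≢0 a≢0)
    -- The count covers nonzero values only; the zero matrix is 0ᵏ + 0ᵏ.
    cases (yes a≡0) = 𝕠 , 𝕠 , trans (cong₂ _⊞_ (V.0^n≡0 1≤k) (V.0^n≡0 1≤k))
      (trans (V.+-identityʳ 𝕠) (sym (trans (cong (_• one) a≡0) (•-zeroˡ one))))

  scalar⇒sum : (k ℕ.∸ 1) ℕ.^ 4 ℕ.< size ℕ.^ n → ∀ {C : M n} {a} → (C ≐ λ i j → a * 𝟙 i j) →
    ∃ λ A → ∃ λ B → A ^ᵐ k ⊕ B ^ᵐ k ≐ C
  scalar⇒sum large {C} {a} scalar =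
    let (u , v , eq) = power-sum large a
    in rep u , rep v , rep-sum {C} scalar u v eq

  module _ (large : (k ℕ.∸ 1) ℕ.^ 4 ℕ.+ 4 ℕ.* k ℕ.< size ℕ.^ n) (-1-power : ∃ λ w → w ^ k ≡ ⊟ one) where

    unit-power-sum : ∀ a → ∃ λ u → ∃ λ v → u ≢ 𝕠 × v ≢ 𝕠 × u ^ k ⊞ v ^ k ≡ a • one
    unit-power-sum a = cases (a ≟ 0#)
      where
      cases : Dec (a ≡ 0#) → ∃ λ u → ∃ λ v → u ≢ 𝕠 × v ≢ 𝕠 × u ^ k ⊞ v ^ k ≡ a • one
      cases (no a≢0)  = sum-of-two-nonzero-powers large -1-power (a • one) (a•one≢0 a≢0)
      -- Both summands must be invertible here, hence 0 = 1ᵏ + wᵏ with wᵏ = -1.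
      cases (yes a≡0) = one , proj₁ -1-power , V.IsField.1≢0 field-V , power≢0 (proj₂ -1-power) -1≢0
        , trans (cong₂ _⊞_ (V.1^n≡1 k) (proj₂ -1-power))
            (trans (V.-‿inverseʳ one) (sym (trans (cong (_• one) a≡0) (•-zeroˡ one))))

    scalar⇒invertible-sum : ∀ {C : M n} {a} → (C ≐ λ i j → a * 𝟙 i j) → SumOfInvertiblePowers k C
    scalar⇒invertible-sum {C} {a} scalar =
      let (u , v , u≢0 , v≢0 , eq) = unit-power-sum a
          (u′ , uu′≡1) = V.IsField.inverse field-V u u≢0
          (v′ , vv′≡1) = V.IsField.inverse field-V v v≢0
      in rep u , rep u′ , rep v , rep v′ , rep-inverse u u′ uu′≡1 , rep-inverse v v′ vv′≡1 , rep-sum {C} scalar u v eq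

-- Combining the scalar and non-scalar cases

module SumsOfMatrixPowers (K : FiniteRing) (isField : FiniteRing.IsField K) {p : ℕ} (pr : Prime p)
  (size≡p : FiniteRing.size K ≡ p)
  (char : ∀ a → FiniteRing._·_ K p a ≡ FiniteRing.0# K)
  (fermat : ∀ a → FiniteRing._^_ K a p ≡ a)
  (natural : ∀ z → ∃ λ J → J ℕ.< p × z ≡ FiniteRing._·_ K J (FiniteRing.1# K))
  (2≢0 : 2 ℕ.< p → FiniteRing._+_ K (FiniteRing.1# K) (FiniteRing.1# K) ≢ FiniteRing.0# K)
  (n-2 k : ℕ) (1≤k : 1 ℕ.≤ k) (d+1<p : gcd k (p ℕ.∸ 1) ℕ.+ 1 ℕ.< p) (p∤k : ¬ (p ∣ k))
  (p-1<2n : p ℕ.∸ 1 ℕ.< 2 ℕ.* suc (suc n-2)) where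

  n : ℕ
  n = suc (suc n-2)

  open FiniteRing K
  open Matrix K

  1≤d : 1 ℕ.≤ gcd k (p ℕ.∸ 1)
  1≤d = ℕₚ.n≢0⇒n>0 (gcd[m,n]≢0 k (p ℕ.∸ 1) (inj₁ (λ k≡0 → ℕₚ.<⇒≢ 1≤k (sym k≡0))))

  2<p : 2 ℕ.< p
  2<p = ℕₚ.≤-<-trans (ℕₚ.+-monoˡ-≤ 1 1≤d) d+1<p

  1<p : 1 ℕ.< p
  1<p = ℕₚ.<⇒≤ 2<p

  p≤2n : p ℕ.≤ 2 ℕ.* n
  p≤2n = ℕₚ.≤-trans (ℕₚ.≤-reflexive (sym (ℕₚ.suc-pred p {{prime⇒nonZero pr}}))) p-1<2n

  -- Together with c^(p-1) = 1, the equation cᵏ = 1 would give c^d = 1, which has at most d < p - 1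
  -- solutions.
  non-trivial-power : ∃ λ c → c ≢ 0# × c ^ k ≢ 1#
  non-trivial-power =
    let (c , c≢0 , c^d≢1) = UnitGroup.non-root-of-unity K isField 1≤d (subst (gcd k (p ℕ.∸ 1) ℕ.+ 1 ℕ.<_) (sym size≡p) d+1<p)
    in c , c≢0 , λ c^k≡1 → c^d≢1 (UnitGroup.gcd-power≡1 K isField k (p ℕ.∸ 1) {c} c^k≡1
         (UnitGroup.fermat-unit K isField {p} {c} (ℕₚ.<⇒≤ 1<p) (fermat c) c≢0))

  scalar-or-sum : (C : M n) → (C ≐ λ i j → C zero zero * 𝟙 i j) ⊎ SumOfInvertiblePowers k C
  scalar-or-sum C = cases (Fillmore.scalar-or-reachable K isField (2≢0 2<p) C) non-trivial-power
    where
    cases : (C ≐ λ i j → C zero zero * 𝟙 i j) ⊎ Fillmore.Reachable K isField (2≢0 2<p) C →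
      (∃ λ c → c ≢ 0# × c ^ k ≢ 1#) → (C ≐ λ i j → C zero zero * 𝟙 i j) ⊎ SumOfInvertiblePowers k C
    cases (inj₁ scalar)    _                     = inj₁ scalar
    cases (inj₂ reachable) (c , c≢0 , c^k≢1) = inj₂
      (NonScalar.nonscalar⇒sum K isField pr char fermat natural (2≢0 2<p) p∤k 1≤k c≢0 c^k≢1 C p≤2n reachable)

  Extension : Set
  Extension = Σ (Vec Carrier n) λ c → FiniteRing.IsField (Quotient.ring-V K n c)
    × (∀ v → FiniteRing._^_ (Quotient.ring-V K n c) v (p ℕ.^ n) ≡ v)

  extension : Extension
  extension = GaloisField.galois-field K isField pr char fermat size≡p n (s≤s z≤n)

  q≡ : size ℕ.^ n ≡ p ℕ.^ n
  q≡ = cong (ℕ._^ n) size≡p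

  sum-of-powers : (k ℕ.∸ 1) ℕ.^ 4 ℕ.< p ℕ.^ n → (C : M n) → ∃ λ A → ∃ λ B → A ^ᵐ k ⊕ B ^ᵐ k ≐ C
  sum-of-powers large C = cases (scalar-or-sum C) extension
    where
    cases : (C ≐ λ i j → C zero zero * 𝟙 i j) ⊎ SumOfInvertiblePowers k C → Extension → ∃ λ A → ∃ λ B → A ^ᵐ k ⊕ B ^ᵐ k ≐ C
    cases (inj₂ (A , _ , B , _ , _ , _ , eq)) _ = A , B , eq
    cases (inj₁ scalar) (c , field-V , _) = ScalarMatrices.scalar⇒sum K isField c field-V k 1≤k
      (subst ((k ℕ.∸ 1) ℕ.^ 4 ℕ.<_) (sym q≡) large) scalar

  module _ (large : (k ℕ.∸ 1) ℕ.^ 4 ℕ.+ 4 ℕ.* k ℕ.< p ℕ.^ n)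
    (t : ℕ) (tg≡ : t ℕ.* gcd k (p ℕ.^ n ℕ.∸ 1) ≡ p ℕ.^ n ℕ.∸ 1) (2∣pt : 2 ∣ p ℕ.* t) where

    -- p is odd by p > d + 1 ≥ 2, so the parity hypothesis falls on t = (pⁿ - 1)/dₙ. Its half h is
    -- the exponent that produces -1.
    2∣t : 2 ∣ t
    2∣t with euclidsLemma p t prime[2] 2∣pt
    ... | inj₂ 2∣t = 2∣t
    ... | inj₁ 2∣p with prime⇒irreducible pr 2∣p
    ...   | inj₁ ()
    ...   | inj₂ 2≡p = contradiction 2≡p (ℕₚ.<⇒≢ 2<p)

    sum-of-invertible-powers : (C : M n) → SumOfInvertiblePowers k C
    sum-of-invertible-powers C = cases (scalar-or-sum C) extension 2∣t
      where
      cases : (C ≐ λ i j → C zero zero * 𝟙 i j) ⊎ SumOfInvertiblePowers k C → Extension → 2 ∣ t → SumOfInvertiblePowers k C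
      cases (inj₂ sum) _ _ = sum
      cases (inj₁ scalar) (c , field-V , fermat-V) (divides h t≡h*2) =
        ScalarMatrices.scalar⇒invertible-sum K isField c field-V k 1≤k
          (subst ((k ℕ.∸ 1) ℕ.^ 4 ℕ.+ 4 ℕ.* k ℕ.<_) (sym q≡) large)
          (UnitGroup.-1-is-power (Quotient.ring-V K n c) field-V k {p ℕ.^ n}
            (ℕₚ.≤-trans 1<p (ℕₚ.m≤m*n p (p ℕ.^ suc n-2) {{ℕₚ.m^n≢0 p (suc n-2) {{prime⇒nonZero pr}}}}))
            q≡ fermat-V h
            (trans (cong (ℕ._* gcd k (p ℕ.^ n ℕ.∸ 1)) (trans (ℕₚ.*-comm 2 h) (sym t≡h*2))) tg≡))
          scalar

-- Transfer to matrices of natural numbers modulo p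

module Reduction (p : ℕ) (pr : Prime p) where
  open PrimeField p pr
  open FiniteRing 𝔽 using (_+_)
  open Matrix 𝔽
  private instance
    p-nonZero : NonZero p
    p-nonZero = prime⇒nonZero pr

  reduce : ∀ {n} → Defs.Mat n → M n
  reduce A i j = π (A i j)

  lift : ∀ {n} → M n → Defs.Mat n
  lift A i j = toℕ (A i j)

  reduce-lift : ∀ {n} (A : M n) → reduce (lift A) ≐ A
  reduce-lift A i j = π-toℕ (A i j)

  π-∑ : ∀ n (f : Fin n → ℕ) → π (Defs.∑ n f) ≡ sum (π ∘ f)
  π-∑ zero    f = refl
  π-∑ (suc n) f = trans (π-+ (f zero) _) (cong (π (f zero) +_) (π-∑ n (f ∘ suc)))

  reduce-⊗ : ∀ {n} (A B : Defs.Mat n) → reduce (A Defs.⊗ B) ≐ reduce A ⊗ reduce B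
  reduce-⊗ {n} A B i j = trans (π-∑ n _) (sum-cong-≗ {n} (λ l → π-* (A i l) (B l j)))

  reduce-𝟙 : ∀ {n} → reduce (Defs.𝟙 {n}) ≐ 𝟙
  reduce-𝟙 i j with i Finₚ.≟ j
  ... | yes _ = refl
  ... | no _  = refl

  reduce-^ : ∀ {n} (A : Defs.Mat n) k → reduce (A Defs.^ᴹ k) ≐ reduce A ^ᵐ k
  reduce-^ A zero = reduce-𝟙
  reduce-^ {n} A (suc k) i j = trans (reduce-⊗ A (A Defs.^ᴹ k) i j)
    (⊗-cong {n} {reduce A} {reduce A} (λ _ _ → refl) (reduce-^ A k) i j)

  lift-sum : ∀ {n} k (A B : M n) (C : Defs.Mat n) → A ^ᵐ k ⊕ B ^ᵐ k ≐ reduce C →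
    ((lift A Defs.^ᴹ k) Defs.⊕ (lift B Defs.^ᴹ k)) Defs.≈[ p ] C
  lift-sum {n} k A B C eq i j = π-injective (trans (π-+ _ _) (trans (cong₂ _+_ (power A) (power B)) (eq i j)))
    where
    power : ∀ A → reduce (lift A Defs.^ᴹ k) i j ≡ (A ^ᵐ k) i j
    power A = trans (reduce-^ (lift A) k i j) (^ᵐ-congˡ {n} k {reduce (lift A)} {A} (reduce-lift A) i j)

  lift-invertible : ∀ {n} {A A′ : M n} → InversePair A A′ → Defs.Invertible p (lift A)
  lift-invertible {n} {A} {A′} (AA′ , A′A) = lift A′ , one A A′ AA′ , one A′ A A′A
    where
    one : ∀ A A′ → A ⊗ A′ ≐ 𝟙 → (lift A Defs.⊗ lift A′) Defs.≈[ p ] Defs.𝟙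
    one A A′ AA′ i j = π-injective (trans (reduce-⊗ (lift A) (lift A′) i j)
      (trans (⊗-cong {n} {reduce (lift A)} {A} {reduce (lift A′)} {A′} (reduce-lift A) (reduce-lift A′) i j)
        (trans (AA′ i j) (sym (reduce-𝟙 i j)))))

open import Defs
open import Data.Nat using (_+_; _*_; _∸_; _^_; _≤_; _<_)

-- Logarithms and quotients are cleared: n > 4 ln(k-1)/ln p reads (k-1)⁴ < pⁿ, which at k = 1 always
-- holds, in agreement with ln 0 = -∞. The quotient (pⁿ - 1)/dₙ is the t with t dₙ = pⁿ - 1.
theorem1p14 : (p n k : ℕ) → .{{_ : NonZero p}} → Prime p → 2 ≤ n → 1 ≤ k →
    gcd k (p ∸ 1) + 1 < p → ¬ (p ∣ k) →
    (((p ∸ 1) < 2 * n × (k ∸ 1) ^ 4 < p ^ n) →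
      (C : Mat n) → Σ (Mat n) λ A → Σ (Mat n) λ B → ((A ^ᴹ k) ⊕ (B ^ᴹ k)) ≈[ p ] C)
    ×
    (((p ∸ 1) < 2 * n × (k ∸ 1) ^ 4 + 4 * k < p ^ n ×
        Σ ℕ (λ t → t * gcd k (p ^ n ∸ 1) ≡ p ^ n ∸ 1 × 2 ∣ p * t)) →
      (C : Mat n) → Σ (Mat n) λ A → Σ (Mat n) λ B →
        Invertible p A × Invertible p B × ((A ^ᴹ k) ⊕ (B ^ᴹ k)) ≈[ p ] C)
theorem1p14 p (suc (suc n)) k pr (s≤s (s≤s _)) 1≤k d+1<p p∤k =
    (λ (p-1<2n , large) C →
      let (A , B , eq) = W.sum-of-powers n k 1≤k d+1<p p∤k p-1<2n large (R.reduce C)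
      in R.lift A , R.lift B , R.lift-sum k A B C eq)
  , (λ (p-1<2n , large , t , tg≡ , 2∣pt) C →
      let (A , A′ , B , B′ , AA′ , BB′ , eq) =
            W.sum-of-invertible-powers n k 1≤k d+1<p p∤k p-1<2n large t tg≡ 2∣pt (R.reduce C)
      in R.lift A , R.lift B , R.lift-invertible {A = A} {A′} AA′ , R.lift-invertible {A = B} {B′} BB′ , R.lift-sum k A B C eq)
  where
  module R = Reduction p pr
  module P = PrimeField p pr
  module W = SumsOfMatrixPowers P.𝔽 P.isField pr refl P.char P.fermat P.natural P.2≢0
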